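{- For all integers $n\ge0$ and $k\ge0$, we have \[ \mathcal{EO}_u\left(2\times 5^{2 k+3}n+\frac{5^{2k+4}-1}{6}\right)\equiv 3^{k+1}\,\mathcal{EO}_u(10n+4) \pmod 5, \] and, for each $r\in\{1,2,3,4\}$, \[ \mathcal{EO}_u\left(2\times 5^{2k+2}n+2\times 5^{2k+1}r+\frac{5^{2k+2}-1}{6}\right)\equiv 0 \pmod{16}. \]
   Context: For a positive integer $k$, let $f_k:=(q^k;q^k)_\infty=\prod_{i=1}^\infty(1-q^{ki})$. The integers $\mathcal{EO}_u(n)$, $n\ge 0$, are defined by $\sum_{n=0}^\infty \mathcal{EO}_u(n)q^n=\dfrac{f_4^2}{f_2^2}$. -}

module Defs where

open import Algebra.Properties.CommutativeMonoid.Sum using (sum; sum-cong-≗; sum-replicate-zero)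
open import Data.Bool.Base using (if_then_else_)
open import Data.Fin.Base using (Fin; zero; suc; toℕ)
open import Data.Fin.Properties using (toℕ<n)
open import Data.Integer.Base using (ℤ; +_; 0ℤ; 1ℤ; _+_; _-_; _*_; -_)
open import Data.Integer.Divisibility using (_∣_)
open import Data.Integer.Properties using (+-0-commutativeMonoid; +-identityʳ; *-identityˡ; +-inverseˡ)
open import Data.Nat.Base as ℕ using (ℕ; zero; suc; _∸_; _≤_; _<_; z≤n; s≤s)
import Data.Nat.Properties as ℕ
open import Data.Sum.Base using (inj₁; inj₂)
open import Data.Vec.Base using (Vec; []; _∷_; head; lookup)
open import Relation.Binary.PropositionalEquality
open import Relation.Nullary.Decidable using (does; dec-false)

Σℤ : ∀ {n} → (Fin n → ℤ) → ℤ
Σℤ = sum +-0-commutativeMonoid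

-- Formal power series in q over ℤ, given by their coefficients.

Series : Set
Series = ℕ → ℤ

infix  9 q^_
infixl 7 _⊛_
infixl 6 _⊖_
infix  8 _⁻¹

q^_ : ℕ → Series
(q^ m) n = if does (n ℕ.≟ m) then 1ℤ else 0ℤ

1ₛ : Series
1ₛ = q^ 0

_⊖_ : Series → Series → Series
(a ⊖ b) n = a n - b n

_⊛_ : Series → Series → Series
(a ⊛ b) n = Σℤ {suc n} (λ i → a (toℕ i) * b (n ∸ toℕ i))

-- reciprocals a n lists the coefficients of 1/a in degrees n, n-1, …, 0,
-- obtained by solving a · (1/a) = 1 degree by degree. This is meaningful
-- only when a has constant term 1; see ⊛-inverseʳ.

reciprocals : Series → (n : ℕ) → Vec ℤ (suc n)
reciprocals a zero    = 1ℤ ∷ []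
reciprocals a (suc n) = - Σℤ (λ i → a (suc (toℕ i)) * lookup rs i) ∷ rs
  where
  rs : Vec ℤ (suc n)
  rs = reciprocals a n

_⁻¹ : Series → Series
(a ⁻¹) n = head (reciprocals a n)

lookup-reciprocals : ∀ a n (i : Fin (suc n)) →
                     lookup (reciprocals a n) i ≡ (a ⁻¹) (n ∸ toℕ i)
lookup-reciprocals a zero    zero    = refl
lookup-reciprocals a (suc n) zero    = refl
lookup-reciprocals a (suc n) (suc i) = lookup-reciprocals a n i

⊛-inverseʳ : ∀ a → a 0 ≡ 1ℤ → ∀ n → (a ⊛ a ⁻¹) n ≡ 1ₛ n
⊛-inverseʳ a a₀≡1 zero    = cong (λ x → x * 1ℤ + 0ℤ) a₀≡1
⊛-inverseʳ a a₀≡1 (suc n) = begin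
  a 0 * (- S) + T  ≡⟨ cong (λ x → x * (- S) + T) a₀≡1 ⟩
  1ℤ * (- S) + T   ≡⟨ cong (_+ T) (*-identityˡ (- S)) ⟩
  - S + T          ≡⟨ cong (λ x → - S + x) T≡S ⟩
  - S + S          ≡⟨ +-inverseˡ S ⟩
  0ℤ               ∎
  where
  open ≡-Reasoning
  S T : ℤ
  S = Σℤ (λ i → a (suc (toℕ i)) * lookup (reciprocals a n) i)
  T = Σℤ {suc n} (λ i → a (suc (toℕ i)) * (a ⁻¹) (n ∸ toℕ i))
  T≡S : T ≡ S
  T≡S = sum-cong-≗ +-0-commutativeMonoid
          (λ i → cong (a (suc (toℕ i)) *_) (sym (lookup-reciprocals a n i)))

-- fPartial k N = ∏_{i=1}^{N} (1 - q^{ki})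

fPartial : ℕ → ℕ → Series
fPartial k zero    = 1ₛ
fPartial k (suc N) = (1ₛ ⊖ q^ (k ℕ.* suc N)) ⊛ fPartial k N

-- The infinite product ∏_{i≥1} (1 - q^{ki}): for k ≥ 1 the coefficient of
-- q^n is the same in all partial products with at least n factors; see
-- f-stable.

f : (k : ℕ) .{{_ : ℕ.NonZero k}} → Series
f k n = fPartial k n n

1-q^m-⊛ : ∀ {m n} → n < m → ∀ a → ((1ₛ ⊖ q^ m) ⊛ a) n ≡ a n
1-q^m-⊛ {m} {n} n<m a = begin
  (1ℤ - (q^ m) 0) * a n + T  ≡⟨ cong (λ x → (1ℤ - x) * a n + T) (q^-off 0 (ℕ.≤-<-trans z≤n n<m)) ⟩
  1ℤ * a n + T               ≡⟨ cong₂ _+_ (*-identityˡ (a n)) T≡0 ⟩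
  a n + 0ℤ                   ≡⟨ +-identityʳ (a n) ⟩
  a n                        ∎
  where
  open ≡-Reasoning
  q^-off : ∀ j → j < m → (q^ m) j ≡ 0ℤ
  q^-off j j<m = cong (if_then 1ℤ else 0ℤ) (dec-false (j ℕ.≟ m) (ℕ.<⇒≢ j<m))
  term : Fin n → ℤ
  term i = (0ℤ - (q^ m) (suc (toℕ i))) * a (n ∸ suc (toℕ i))
  T : ℤ
  T = Σℤ term
  term≡0 : ∀ i → term i ≡ 0ℤ
  term≡0 i = cong (λ x → (0ℤ - x) * a (n ∸ suc (toℕ i)))
                  (q^-off (suc (toℕ i)) (ℕ.≤-<-trans (toℕ<n i) n<m))
  T≡0 : T ≡ 0ℤ
  T≡0 = trans (sum-cong-≗ +-0-commutativeMonoid term≡0)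
              (sum-replicate-zero +-0-commutativeMonoid n)

f-stable : ∀ k .{{_ : ℕ.NonZero k}} {n N} → n ≤ N → fPartial k N n ≡ f k n
f-stable k {N = zero}  z≤n = refl
f-stable k {n} {suc N} n≤1+N with ℕ.m≤n⇒m<n∨m≡n n≤1+N
... | inj₂ refl      = refl
... | inj₁ (s≤s n≤N) =
  trans (1-q^m-⊛ (ℕ.≤-trans (s≤s n≤N) (ℕ.m≤n*m (suc N) k)) (fPartial k N))
        (f-stable k n≤N)

𝓔𝓞ᵤ : ℕ → ℤ
𝓔𝓞ᵤ = (f 4 ⊛ f 4) ⊛ (f 2 ⊛ f 2) ⁻¹

infix 4 _≡_[mod_]

_≡_[mod_] : ℤ → ℤ → ℕ → Set
a ≡ b [mod m ] = + m ∣ a - b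

{-
Let f₁ = (q;q)_∞, f₂ = f₁(q²) and Φ = φ(-q) = Σ_{s∈ℤ} (-1)^s q^{s²}. Only the
coefficients of 𝓔𝓞ᵤ in even degrees matter, and their generating function F = f₂²/f₁²
satisfies F Φ = f₂, because of Gauss' identity Φ f₂ = f₁². By Euler's pentagonal number
theorem

  f₁ = α(q⁵) − q β(q⁵) − q² γ(q⁵)   with β = f₁(q⁵),
  f₂ = α′(q⁵) − q² β′(q⁵) − q⁴ γ′(q⁵),
  Φ  = a(q⁵) − 2q b(q⁵) + 2q⁴ c(q⁵)   with a = Φ(q⁵).

Comparing the residue classes mod 5 in Φ f₂ = f₁² gives the exact relations

  b²α′ − q²c²γ′ = a²β′,   a(qα′c³ + γ′b³) = β′bc(a² + 2qbc),
  ab⁵ − q³ac⁵ = a⁴bc + qa²b²c² + 2q²b³c³.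

Modulo 16 the first two, applied to f₂/Φ with 1/Φ expanded in powers of Φ − a(q⁵), whose
coefficients are even, yield Σ F(5n+2) qⁿ ≡ 3 F(q⁵); iterating proves the second congruence.
Modulo 5 we have x⁵ ≡ x(q⁵), so that a ≡ Φ⁵ and, by the third relation, Φ⁶ ≡ (a² + qbc)³,
whence Φ² ≡ a² + qbc. It follows that g = Σ F(5n+2) qⁿ ≡ 3 f₂(q⁵) Φ³ and that
g(25n+10) ≡ 3 g(n), which iterates to the first congruence.
-}

module Submission where

open import Defs
open import Data.Nat.Base using (ℕ; _+_; _*_; _∸_; _^_; _/_; _≤_)
open import Data.Integer.Base as ℤ using (+_; 0ℤ)
open import Data.Product.Base using (_×_)

open import Algebra.Bundles using (CommutativeRing; RawRing)
open import Algebra.Structures using (IsCommutativeRing)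
open import Data.Bool.Base using (true; false; if_then_else_)
open import Data.Fin.Base as Fin using (Fin; toℕ)
open import Data.Fin.Patterns using (0F; 1F; 2F; 3F; 4F; 5F; 6F; 7F; 8F; 9F)
import Data.Fin.Properties as Fin
open import Data.Integer.Base using (ℤ; -[1+_]; 1ℤ)
import Data.Integer.Divisibility.Signed as ℤ
import Data.Integer.Properties as ℤ
open import Data.Integer.Solver using (module +-*-Solver)
import Data.Integer.Tactic.RingSolver as ℤ-Solver
open import Data.Maybe.Base using (nothing)
open import Data.Nat.Base as ℕ using (zero; suc; NonZero)
open import Data.Nat.Divisibility as ℕ using (divides; _∣?_) renaming (_∣_ to _∣ℕ_)
import Data.Nat.DivMod as ℕ
import Data.Nat.Properties as ℕ
import Data.Nat.Tactic.RingSolver as ℕ-Solver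
open import Data.Product.Base using (_,_; proj₁; proj₂)
open import Data.Sum.Base using (inj₁; inj₂)
open import Data.Vec.Base as Vec using (Vec; []; _∷_; allFin)
open import Data.Vec.N-ary using (N-ary; _$ⁿ_; ∀ⁿ; curryⁿ; left-inverse; uncurry-∀ⁿ)
import Data.Vec.Properties as Vec
open import Function.Base using (id)
open import Function.Bundles using (Equivalence)
open import Level using (0ℓ)
import Relation.Binary.Reasoning.Setoid as ≈-Reasoning
open import Relation.Binary.Bundles using (Setoid)
open import Relation.Binary.PropositionalEquality
  using (_≡_; _≢_; _≗_; refl; sym; trans; cong; cong₂; subst; module ≡-Reasoning)
open import Relation.Nullary.Decidable
  using (Dec; yes; no; does; True; False; toWitness; toWitnessFalse; dec-true; dec-false)
open import Relation.Nullary.Negation using (¬_; contradiction)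
open import Tactic.RingSolver.Core.AlmostCommutativeRing
  using (fromCommutativeRing; _-Raw-AlmostCommutative⟶_)
open import Tactic.RingSolver.Core.Polynomial.Parameters using (Homomorphism)

-- The components `α`, `γ`, `b`, `c` are known only as residue classes cut out of their series; `β`
-- and `a` alone are identified, since they reproduce the series itself. What ties the others
-- together is drawn from Gauss' identity: its class 2, combined with the same identity at q⁵, gives
-- `α γ = β²`, and q ↦ q² turns this into `α′ γ′ = β′²`. With these, `α`, `β`, `γ` can be eliminated
-- from products of the five classes. Every division on the way is by 2, by q or by a series with
-- constant term 1, hence sound over ℤ. The detour through Φ⁶ modulo 5 comes from the third
-- relation, whose left side has fifth powers of `b` and `c`: these are what the Frobenius
-- congruence makes of the dissection of Φ. The cube root leading back to Φ² is unique, because 3 is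
-- invertible modulo 5 and the constant terms are 1. The 3 modulo 16 is 4 - 1: in class 2 of f₂/Φ
-- the relation for a²β′ enters four times, against one -a²β′ from f₂ itself. The zero modulo 16
-- enters at the end of the iteration, where F(q⁵) is read at an exponent prime to 5.

-- The ring of formal power series.

infixl 6 _⊕_
infix  8 ⊝_

_⊕_ : Series → Series → Series
(a ⊕ b) n = a n ℤ.+ b n

⊝_ : Series → Series
(⊝ a) n = ℤ.- a n

const : ℤ → Series
const c zero    = c
const c (suc _) = 0ℤ

0ₛ : Series
0ₛ _ = 0ℤ

-- `(a ⊛ b) (suc n)` unfolds to `a 0 * b (suc n) + (tail a ⊛ b) n`, so the ring laws go by induction
-- on the degree with the left factor shifted.
tail : Series → Series
tail a n = a (suc n)

⊛-cong : ∀ {a b c d} → a ≗ b → c ≗ d → a ⊛ c ≗ b ⊛ d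
⊛-cong a≗b c≗d zero    = cong (ℤ._+ 0ℤ) (cong₂ ℤ._*_ (a≗b 0) (c≗d 0))
⊛-cong a≗b c≗d (suc n) =
  cong₂ ℤ._+_ (cong₂ ℤ._*_ (a≗b 0) (c≗d (suc n))) (⊛-cong (λ m → a≗b (suc m)) c≗d n)

⊛-zeroˡ : ∀ a → 0ₛ ⊛ a ≗ 0ₛ
⊛-zeroˡ a zero    = refl
⊛-zeroˡ a (suc n) = trans (ℤ.+-identityˡ _) (⊛-zeroˡ a n)

const-⊛ : ∀ c a n → (const c ⊛ a) n ≡ c ℤ.* a n
const-⊛ c a zero    = ℤ.+-identityʳ _
const-⊛ c a (suc n) = trans (cong (λ x → c ℤ.* a (suc n) ℤ.+ x) (⊛-zeroˡ a n)) (ℤ.+-identityʳ _)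

1ₛ≗const : 1ₛ ≗ const 1ℤ
1ₛ≗const zero    = refl
1ₛ≗const (suc n) = refl

⊛-identityˡ : ∀ a → 1ₛ ⊛ a ≗ a
⊛-identityˡ a n =
  trans (⊛-cong {c = a} 1ₛ≗const (λ _ → refl) n) (trans (const-⊛ 1ℤ a n) (ℤ.*-identityˡ (a n)))

⊛-distribʳ : ∀ a b c → (b ⊕ c) ⊛ a ≗ (b ⊛ a) ⊕ (c ⊛ a)
⊛-distribʳ a b c zero = solve 3 (λ x y z → (y :+ z) :* x :+ con 0ℤ := y :* x :+ con 0ℤ :+ (z :* x :+ con 0ℤ)) refl (a 0) (b 0) (c 0)
  where open +-*-Solver
⊛-distribʳ a b c (suc n) = begin
  (b 0 ℤ.+ c 0) ℤ.* a (suc n) ℤ.+ ((tail b ⊕ tail c) ⊛ a) n                ≡⟨ cong (λ x → (b 0 ℤ.+ c 0) ℤ.* a (suc n) ℤ.+ x) (⊛-distribʳ a (tail b) (tail c) n) ⟩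
  (b 0 ℤ.+ c 0) ℤ.* a (suc n) ℤ.+ ((tail b ⊛ a) n ℤ.+ (tail c ⊛ a) n)        ≡⟨ solve 5 (λ x y z u v → (y :+ z) :* x :+ (u :+ v) := y :* x :+ u :+ (z :* x :+ v)) refl (a (suc n)) (b 0) (c 0) _ _ ⟩
  b 0 ℤ.* a (suc n) ℤ.+ (tail b ⊛ a) n ℤ.+ (c 0 ℤ.* a (suc n) ℤ.+ (tail c ⊛ a) n) ∎
  where
  open +-*-Solver
  open ≡-Reasoning

-- The convolution unfolds along its left factor only; commutativity needs this mirror image.
⊛-sucʳ : ∀ a b n → (a ⊛ b) (suc n) ≡ (a ⊛ tail b) n ℤ.+ a (suc n) ℤ.* b 0
⊛-sucʳ a b zero    = solve 2 (λ u v → u :+ (v :+ con 0ℤ) := u :+ con 0ℤ :+ v) refl (a 0 ℤ.* b 1) _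
  where open +-*-Solver
⊛-sucʳ a b (suc n) =
  trans (cong (λ x → a 0 ℤ.* b (suc (suc n)) ℤ.+ x) (⊛-sucʳ (tail a) b n))
        (sym (ℤ.+-assoc (a 0 ℤ.* b (suc (suc n))) _ _))

⊛-comm : ∀ a b → a ⊛ b ≗ b ⊛ a
⊛-comm a b zero    = cong (ℤ._+ 0ℤ) (ℤ.*-comm (a 0) (b 0))
⊛-comm a b (suc n) = begin
  a 0 ℤ.* b (suc n) ℤ.+ (tail a ⊛ b) n ≡⟨ cong₂ ℤ._+_ (ℤ.*-comm (a 0) (b (suc n))) (⊛-comm (tail a) b n) ⟩
  b (suc n) ℤ.* a 0 ℤ.+ (b ⊛ tail a) n ≡⟨ ℤ.+-comm (b (suc n) ℤ.* a 0) _ ⟩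
  (b ⊛ tail a) n ℤ.+ b (suc n) ℤ.* a 0 ≡⟨ ⊛-sucʳ b a n ⟨
  (b ⊛ a) (suc n)                  ∎
  where
  open ≡-Reasoning

-- Shifting a product gives `a 0` times `tail b` plus `tail a ⊛ b`. The scalar summand is handled by
-- `const-assoc`, the other one by induction.
⊛-assoc : ∀ a b c → (a ⊛ b) ⊛ c ≗ a ⊛ (b ⊛ c)
⊛-assoc a b c zero = solve 3 (λ x y z → (x :* y :+ con 0ℤ) :* z :+ con 0ℤ := x :* (y :* z :+ con 0ℤ) :+ con 0ℤ) refl (a 0) (b 0) (c 0)
  where open +-*-Solver
⊛-assoc a b c (suc n) = begin
  (a ⊛ b) 0 ℤ.* c (suc n) ℤ.+ (tail (a ⊛ b) ⊛ c) n
    ≡⟨ cong (λ x → (a ⊛ b) 0 ℤ.* c (suc n) ℤ.+ x) (⊛-cong {c = c} tail-⊛ (λ _ → refl) n) ⟩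
  (a ⊛ b) 0 ℤ.* c (suc n) ℤ.+ (((const (a 0) ⊛ tail b) ⊕ (tail a ⊛ b)) ⊛ c) n
    ≡⟨ cong (λ x → (a ⊛ b) 0 ℤ.* c (suc n) ℤ.+ x) (⊛-distribʳ c (const (a 0) ⊛ tail b) (tail a ⊛ b) n) ⟩
  (a ⊛ b) 0 ℤ.* c (suc n) ℤ.+ (((const (a 0) ⊛ tail b) ⊛ c) n ℤ.+ ((tail a ⊛ b) ⊛ c) n)
    ≡⟨ cong₂ (λ x y → (a ⊛ b) 0 ℤ.* c (suc n) ℤ.+ (x ℤ.+ y)) (const-assoc (a 0) (tail b) c n) (⊛-assoc (tail a) b c n) ⟩
  (a 0 ℤ.* b 0 ℤ.+ 0ℤ) ℤ.* c (suc n) ℤ.+ (a 0 ℤ.* (tail b ⊛ c) n ℤ.+ (tail a ⊛ (b ⊛ c)) n)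
    ≡⟨ solve 5 (λ x y z u v → (x :* y :+ con 0ℤ) :* z :+ (x :* u :+ v) := x :* (y :* z :+ u) :+ v) refl (a 0) (b 0) (c (suc n)) _ _ ⟩
  a 0 ℤ.* (b 0 ℤ.* c (suc n) ℤ.+ (tail b ⊛ c) n) ℤ.+ (tail a ⊛ (b ⊛ c)) n ∎
  where
  open +-*-Solver
  open ≡-Reasoning
  tail-⊛ : tail (a ⊛ b) ≗ (const (a 0) ⊛ tail b) ⊕ (tail a ⊛ b)
  tail-⊛ m = cong (ℤ._+ (tail a ⊛ b) m) (sym (const-⊛ (a 0) (tail b) m))
  const-assoc : ∀ x b c m → ((const x ⊛ b) ⊛ c) m ≡ x ℤ.* (b ⊛ c) m
  const-assoc x b c zero = solve 3 (λ x y z → (x :* y :+ con 0ℤ) :* z :+ con 0ℤ := x :* (y :* z :+ con 0ℤ)) refl x (b 0) (c 0)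
  const-assoc x b c (suc m) = begin
    (x ℤ.* b 0 ℤ.+ 0ℤ) ℤ.* c (suc m) ℤ.+ (tail (const x ⊛ b) ⊛ c) m
      ≡⟨ cong (λ z → (x ℤ.* b 0 ℤ.+ 0ℤ) ℤ.* c (suc m) ℤ.+ z) (⊛-cong {c = c} tail-const (λ _ → refl) m) ⟩
    (x ℤ.* b 0 ℤ.+ 0ℤ) ℤ.* c (suc m) ℤ.+ ((const x ⊛ tail b) ⊛ c) m
      ≡⟨ cong (λ z → (x ℤ.* b 0 ℤ.+ 0ℤ) ℤ.* c (suc m) ℤ.+ z) (const-assoc x (tail b) c m) ⟩
    (x ℤ.* b 0 ℤ.+ 0ℤ) ℤ.* c (suc m) ℤ.+ x ℤ.* (tail b ⊛ c) m
      ≡⟨ solve 4 (λ x y z u → (x :* y :+ con 0ℤ) :* z :+ x :* u := x :* (y :* z :+ u)) refl x (b 0) (c (suc m)) _ ⟩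
    x ℤ.* (b 0 ℤ.* c (suc m) ℤ.+ (tail b ⊛ c) m) ∎
    where
    tail-const : tail (const x ⊛ b) ≗ const x ⊛ tail b
    tail-const k = trans (const-⊛ x b (suc k)) (sym (const-⊛ x (tail b) k))

-- A record rather than a function type, so that the two sides can be inferred
-- without unfolding any series.

infix 4 _≐_

record _≐_ (a b : Series) : Set where
  constructor coeffwise
  field
    coeff : a ≗ b

open _≐_

seriesRing : CommutativeRing 0ℓ 0ℓ
seriesRing = record
  { Carrier = Series
  ; _≈_ = _≐_
  ; _+_ = _⊕_
  ; _*_ = _⊛_
  ; -_  = ⊝_
  ; 0#  = 0ₛ
  ; 1#  = 1ₛ
  ; isCommutativeRing = record
    { isRing = record
      { +-isAbelianGroup = record
        { isGroup = record
          { isMonoid = record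
            { isSemigroup = record
              { isMagma = record
                { isEquivalence = record
                  { refl  = coeffwise λ _ → refl
                  ; sym   = λ p → coeffwise λ n → sym (coeff p n)
                  ; trans = λ p q → coeffwise λ n → trans (coeff p n) (coeff q n)
                  }
                ; ∙-cong = λ p q → coeffwise λ n → cong₂ ℤ._+_ (coeff p n) (coeff q n)
                }
              ; assoc = λ a b c → coeffwise λ n → ℤ.+-assoc (a n) (b n) (c n)
              }
            ; identity = (λ a → coeffwise λ n → ℤ.+-identityˡ (a n))
                       , (λ a → coeffwise λ n → ℤ.+-identityʳ (a n))
            }
          ; inverse = (λ a → coeffwise λ n → ℤ.+-inverseˡ (a n))
                    , (λ a → coeffwise λ n → ℤ.+-inverseʳ (a n))
          ; ⁻¹-cong = λ p → coeffwise λ n → cong ℤ.-_ (coeff p n)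
          }
        ; comm = λ a b → coeffwise λ n → ℤ.+-comm (a n) (b n)
        }
      ; *-cong = λ p q → coeffwise (⊛-cong (coeff p) (coeff q))
      ; *-assoc = λ a b c → coeffwise (⊛-assoc a b c)
      ; *-identity = (λ a → coeffwise (⊛-identityˡ a))
                   , (λ a → coeffwise λ n → trans (⊛-comm a 1ₛ n) (⊛-identityˡ a n))
      ; distrib = (λ a b c → coeffwise λ n → trans (⊛-comm a (b ⊕ c) n) (trans (⊛-distribʳ a b c n)
                                     (cong₂ ℤ._+_ (⊛-comm b a n) (⊛-comm c a n))))
                , λ a b c → coeffwise (⊛-distribʳ a b c)
      }
    ; *-comm = λ a b → coeffwise (⊛-comm a b)
    }
  }

-- Integer constants and normal forms of ring expressions.

ℤ-rawRing : RawRing 0ℓ 0ℓ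
ℤ-rawRing = CommutativeRing.rawRing ℤ.+-*-commutativeRing

-- 0 and 1 are sent to 0ₛ and 1ₛ themselves, so that the solver recognises these.

fromℤ : ℤ → Series
fromℤ (+ 0) = 0ₛ
fromℤ (+ 1) = 1ₛ
fromℤ c     = const c

const-0 : const 0ℤ ≗ 0ₛ
const-0 zero    = refl
const-0 (suc n) = refl

fromℤ≗const : ∀ c → fromℤ c ≗ const c
fromℤ≗const (+ 0)             n = sym (const-0 n)
fromℤ≗const (+ 1)             n = 1ₛ≗const n
fromℤ≗const (+ suc (suc _))   n = refl
fromℤ≗const ℤ.-[1+ _ ]        n = refl

fromℤ-homo : ℤ-rawRing -Raw-AlmostCommutative⟶ fromCommutativeRing seriesRing (λ _ → nothing)
fromℤ-homo = record
  { ⟦_⟧    = fromℤ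
  ; +-homo = λ x y → coeffwise λ n → trans (fromℤ≗const (x ℤ.+ y) n)
      (trans (const-+ x y n) (sym (cong₂ ℤ._+_ (fromℤ≗const x n) (fromℤ≗const y n))))
  ; *-homo = λ x y → coeffwise λ n → trans (fromℤ≗const (x ℤ.* y) n)
      (trans (const-* x y n) (sym (⊛-cong (fromℤ≗const x) (fromℤ≗const y) n)))
  ; -‿homo = λ x → coeffwise λ n → trans (fromℤ≗const (ℤ.- x) n)
      (trans (const-neg x n) (cong ℤ.-_ (sym (fromℤ≗const x n))))
  ; 0-homo = coeffwise λ _ → refl
  ; 1-homo = coeffwise λ _ → refl
  }
  where
  const-+ : ∀ x y → const (x ℤ.+ y) ≗ const x ⊕ const y
  const-+ x y zero    = refl
  const-+ x y (suc n) = refl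
  const-* : ∀ x y → const (x ℤ.* y) ≗ const x ⊛ const y
  const-* x y zero    = sym (ℤ.+-identityʳ _)
  const-* x y (suc n) = sym (trans (const-⊛ x (const y) (suc n)) (ℤ.*-zeroʳ x))
  const-neg : ∀ x → const (ℤ.- x) ≗ ⊝ const x
  const-neg x zero    = refl
  const-neg x (suc n) = refl

-- In contrast to the solvers of the library, normal forms are compared as syntax, so
-- that the type checker never unfolds operations of the ring.

module Solver (R : CommutativeRing 0ℓ 0ℓ)
  (ℤ⟶R : ℤ-rawRing -Raw-AlmostCommutative⟶ fromCommutativeRing R (λ _ → nothing))
  where

  open CommutativeRing R using (_≈_; setoid; +-cong; *-cong; -‿cong; rawRing; semiring)

  private
    module R = CommutativeRing R

  open import Tactic.RingSolver.Core.Expression public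
    renaming ( _⊕_ to infixl 6 _:+_; _⊗_ to infixl 7 _:*_; _⊛_ to infixr 8 _:^_; ⊝_ to infix 8 :-_
             ; Κ to con; Ι to var )

  infixl 6 _:-_

  _:-_ : ∀ {n} → Expr ℤ n → Expr ℤ n → Expr ℤ n
  x :- y = x :+ :- y

  open _-Raw-AlmostCommutative⟶_ ℤ⟶R using (0-homo) renaming (⟦_⟧ to ⟦_⟧ᶻ)

  private
    homo : Homomorphism 0ℓ 0ℓ 0ℓ 0ℓ
    homo = record
      { from = record
        { rawRing = ℤ-rawRing
        ; isZero  = λ { (+ zero) → true ; _ → false }
        }
      ; to = fromCommutativeRing R (λ _ → nothing)
      ; morphism = ℤ⟶R
      ; Zero-C⟶Zero-R = λ { (+ zero) _ → R.sym 0-homo }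
      }

  open Eval rawRing ⟦_⟧ᶻ public
  open import Tactic.RingSolver.Core.Polynomial.Base (Homomorphism.from homo)
  open import Tactic.RingSolver.Core.Polynomial.Semantics homo using () renaming (⟦_⟧ to ⟦_⟧ₚ)
  open import Tactic.RingSolver.Core.Polynomial.Homomorphism homo
  open import Algebra.Properties.Semiring.Exp.TCOptimised semiring using (^-congˡ) renaming (_^_ to _^ᴿ_)
  open ≈-Reasoning setoid

  norm : ∀ {n} → Expr ℤ n → Poly n
  norm (con x)  = κ x
  norm (var x)  = ι x
  norm (x :+ y) = norm x ⊞ norm y
  norm (x :* y) = norm x ⊠ norm y
  norm (:- x)   = ⊟ norm x
  norm (x :^ i) = norm x ⊡ i

  norm-correct : ∀ {n} (e : Expr ℤ n) ρ → ⟦ norm e ⟧ₚ ρ ≈ ⟦ e ⟧ ρ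
  norm-correct (con x)  ρ = κ-hom x ρ
  norm-correct (var x)  ρ = ι-hom x ρ
  norm-correct (x :+ y) ρ = begin
    ⟦ norm x ⊞ norm y ⟧ₚ ρ          ≈⟨ ⊞-hom (norm x) (norm y) ρ ⟩
    ⟦ norm x ⟧ₚ ρ R.+ ⟦ norm y ⟧ₚ ρ ≈⟨ +-cong (norm-correct x ρ) (norm-correct y ρ) ⟩
    ⟦ x ⟧ ρ R.+ ⟦ y ⟧ ρ             ∎
  norm-correct (x :* y) ρ = begin
    ⟦ norm x ⊠ norm y ⟧ₚ ρ          ≈⟨ ⊠-hom (norm x) (norm y) ρ ⟩
    ⟦ norm x ⟧ₚ ρ R.* ⟦ norm y ⟧ₚ ρ ≈⟨ *-cong (norm-correct x ρ) (norm-correct y ρ) ⟩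
    ⟦ x ⟧ ρ R.* ⟦ y ⟧ ρ             ∎
  norm-correct (:- x)   ρ = begin
    ⟦ ⊟ norm x ⟧ₚ ρ     ≈⟨ ⊟-hom (norm x) ρ ⟩
    R.- ⟦ norm x ⟧ₚ ρ   ≈⟨ -‿cong (norm-correct x ρ) ⟩
    R.- ⟦ x ⟧ ρ         ∎
  norm-correct (x :^ i) ρ = begin
    ⟦ norm x ⊡ i ⟧ₚ ρ  ≈⟨ ⊡-hom (norm x) i ρ ⟩
    ⟦ norm x ⟧ₚ ρ ^ᴿ i ≈⟨ ^-congˡ i (norm-correct x ρ) ⟩
    ⟦ x ⟧ ρ ^ᴿ i       ∎

  prove : ∀ {n} (e₁ e₂ : Expr ℤ n) ρ → norm e₁ ≡ norm e₂ → ⟦ e₁ ⟧ ρ ≈ ⟦ e₂ ⟧ ρ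
  prove e₁ e₂ ρ eq = begin
    ⟦ e₁ ⟧ ρ       ≈⟨ norm-correct e₁ ρ ⟨
    ⟦ norm e₁ ⟧ₚ ρ ≡⟨ cong (λ p → ⟦ p ⟧ₚ ρ) eq ⟩
    ⟦ norm e₂ ⟧ₚ ρ ≈⟨ norm-correct e₂ ρ ⟩
    ⟦ e₂ ⟧ ρ       ∎

  solve : ∀ n (e : N-ary n (Expr ℤ n) (Expr ℤ n × Expr ℤ n)) →
          let (l , r) = e $ⁿ Vec.map var (allFin n) in
          norm l ≡ norm r → ∀ⁿ n (curryⁿ λ ρ → ⟦ l ⟧ ρ ≈ ⟦ r ⟧ ρ)
  solve n e eq = Equivalence.from (uncurry-∀ⁿ n) λ ρ →
    subst id (sym (left-inverse (λ ρ′ → ⟦ l ⟧ ρ′ ≈ ⟦ r ⟧ ρ′) ρ)) (prove l r ρ eq)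
    where
    l = proj₁ (e $ⁿ Vec.map var (allFin n))
    r = proj₂ (e $ⁿ Vec.map var (allFin n))

module Unsealed = Solver seriesRing fromℤ-homo
module 𝕊 = CommutativeRing seriesRing
module ≐-Reasoning = ≈-Reasoning 𝕊.setoid

-- Monomials, extraction of residue classes and substitution of powers of q.

q^-on : ∀ {m n} → n ≡ m → (q^ m) n ≡ 1ℤ
q^-on {m} {n} n≡m = cong (if_then 1ℤ else 0ℤ) (dec-true (n ℕ.≟ m) n≡m)

q^-off : ∀ {m n} → n ≢ m → (q^ m) n ≡ 0ℤ
q^-off {m} {n} n≢m = cong (if_then 1ℤ else 0ℤ) (dec-false (n ℕ.≟ m) n≢m)

q^-⊛-≥ : ∀ k a n → (q^ k ⊛ a) (k ℕ.+ n) ≡ a n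
q^-⊛-≥ zero    a n = ⊛-identityˡ a n
q^-⊛-≥ (suc k) a n = trans (ℤ.+-identityˡ _) (q^-⊛-≥ k a n)

q^-⊛-< : ∀ {k} a {n} → n ℕ.< k → (q^ k ⊛ a) n ≡ 0ℤ
q^-⊛-< {suc k} a {zero}  _           = refl
q^-⊛-< {suc k} a {suc n} (ℕ.s≤s n<k) = trans (ℤ.+-identityˡ _) (q^-⊛-< a n<k)

q^-+ : ∀ m n → q^ m ⊛ q^ n ≗ q^ (m ℕ.+ n)
q^-+ zero    n k       = ⊛-identityˡ (q^ n) k
q^-+ (suc m) n zero    = refl
q^-+ (suc m) n (suc k) = trans (ℤ.+-identityˡ _) (q^-+ m n k)

-- V k substitutes q^k for q, and a = Σ_{r<k} q^r V k (U k r a).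

U : ℕ → ℕ → Series → Series
U k r a n = a (r ℕ.+ n ℕ.* k)

V : (k : ℕ) .{{_ : NonZero k}} → Series → Series
V k a n = if does (k ∣? n) then a (n / k) else 0ℤ

module _ {k : ℕ} .{{_ : NonZero k}} where

  V-∣ : ∀ a j → V k a (j ℕ.* k) ≡ a j
  V-∣ a j = trans (cong (if_then a (j ℕ.* k / k) else 0ℤ) (dec-true (k ∣? j ℕ.* k) (ℕ.n∣m*n j)))
                  (cong a (ℕ.m*n/n≡m j k))

  V-∤ : ∀ a {n} → ¬ k ∣ℕ n → V k a n ≡ 0ℤ
  V-∤ a {n} k∤n = cong (if_then a (n / k) else 0ℤ) (dec-false (k ∣? n) k∤n)

  digits-unique : ∀ {r s} m n → r ℕ.< k → s ℕ.< k → r ℕ.+ m ℕ.* k ≡ s ℕ.+ n ℕ.* k → r ≡ s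
  digits-unique {r} {s} m n r<k s<k eq = begin
    r                     ≡⟨ ℕ.m<n⇒m%n≡m r<k ⟨
    r ℕ.% k                 ≡⟨ ℕ.[m+kn]%n≡m%n r m k ⟨
    (r ℕ.+ m ℕ.* k) ℕ.% k   ≡⟨ cong (ℕ._% k) eq ⟩
    (s ℕ.+ n ℕ.* k) ℕ.% k   ≡⟨ ℕ.[m+kn]%n≡m%n s n k ⟩
    s ℕ.% k                 ≡⟨ ℕ.m<n⇒m%n≡m s<k ⟩
    s                     ∎
    where open ≡-Reasoning

  U-ext : ∀ {a b} → (∀ r → r ℕ.< k → U k r a ≗ U k r b) → a ≗ b
  U-ext {a} {b} eq n =
    subst (λ m → a m ≡ b m) (sym (ℕ.m≡m%n+[m/n]*n n k)) (eq (n ℕ.% k) (ℕ.m%n<n n k) (n / k))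

  U-q^-≡ : ∀ r m → U k r (q^ (r ℕ.+ m ℕ.* k)) ≗ q^ m
  U-q^-≡ r m n with n ℕ.≟ m
  ... | yes refl = trans (q^-on {r ℕ.+ m ℕ.* k} refl) (sym (q^-on {m} refl))
  ... | no  n≢m  = trans (q^-off λ eq → n≢m (ℕ.*-cancelʳ-≡ n m k (ℕ.+-cancelˡ-≡ r _ _ eq)))
                         (sym (q^-off n≢m))

  U-q^-≢ : ∀ {r s} m → r ℕ.< k → s ℕ.< k → r ≢ s → U k r (q^ (s ℕ.+ m ℕ.* k)) ≗ 0ₛ
  U-q^-≢ m r<k s<k r≢s n = q^-off λ eq → r≢s (digits-unique n m r<k s<k eq)

  U₀-V : ∀ a → U k 0 (V k a) ≗ a
  U₀-V a n = V-∣ a n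

  U-V : ∀ a {r} → 0 ℕ.< r → r ℕ.< k → U k r (V k a) ≗ 0ₛ
  U-V a {r} 0<r r<k n = V-∤ a λ { (divides j eq) →
    ℕ.<⇒≢ 0<r (sym (digits-unique {r} {0} n j r<k (ℕ.≤-<-trans ℕ.z≤n r<k) eq)) }

  V-cong : ∀ {a b} → a ≗ b → V k a ≗ V k b
  V-cong a≗b n = cong (if does (k ∣? n) then_else 0ℤ) (a≗b (n / k))

  V-step : ∀ a → V k a ≗ const (a 0) ⊕ q^ k ⊛ V k (tail a)
  V-step a = U-ext λ r r<k n → aux r r<k n
    where
    open ≡-Reasoning
    const-≢0 : ∀ c {n} → n ≢ 0 → const c n ≡ 0ℤ
    const-≢0 c {zero}  n≢0 = contradiction refl n≢0
    const-≢0 c {suc n} _   = refl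
    low : ∀ r → r ℕ.< k → V k a r ≡ const (a 0) r
    low zero    _   = V-∣ a 0
    low (suc r) r<k = trans (cong (V k a) (sym (ℕ.+-identityʳ (suc r)))) (U-V a ℕ.z<s r<k 0)
    high : ∀ r → r ℕ.< k → ∀ n → U k r (V k a) (suc n) ≡ U k r (V k (tail a)) n
    high zero    _   n = trans (V-∣ a (suc n)) (sym (V-∣ (tail a) n))
    high (suc r) r<k n = trans (U-V a ℕ.z<s r<k (suc n)) (sym (U-V (tail a) ℕ.z<s r<k n))
    aux : ∀ r → r ℕ.< k → ∀ n → U k r (V k a) n ≡ U k r (const (a 0) ⊕ q^ k ⊛ V k (tail a)) n
    aux r r<k zero = begin
      V k a (r ℕ.+ 0)  ≡⟨ cong (V k a) (ℕ.+-identityʳ r) ⟩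
      V k a r          ≡⟨ low r r<k ⟩
      const (a 0) r    ≡⟨ ℤ.+-identityʳ _ ⟨
      const (a 0) r ℤ.+ 0ℤ
        ≡⟨ cong (ℤ._+_ (const (a 0) r)) (q^-⊛-< (V k (tail a)) r<k) ⟨
      (const (a 0) ⊕ q^ k ⊛ V k (tail a)) r
        ≡⟨ cong (const (a 0) ⊕ q^ k ⊛ V k (tail a)) (ℕ.+-identityʳ r) ⟨
      (const (a 0) ⊕ q^ k ⊛ V k (tail a)) (r ℕ.+ 0) ∎
    aux r r<k (suc n) = begin
      U k r (V k a) (suc n)             ≡⟨ high r r<k n ⟩
      V k (tail a) m                    ≡⟨ q^-⊛-≥ k (V k (tail a)) m ⟨
      (q^ k ⊛ V k (tail a)) (k ℕ.+ m)   ≡⟨ ℤ.+-identityˡ _ ⟨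
      0ℤ ℤ.+ (q^ k ⊛ V k (tail a)) (k ℕ.+ m)
        ≡⟨ cong (ℤ._+ (q^ k ⊛ V k (tail a)) (k ℕ.+ m))
                (const-≢0 (a 0) (λ eq → ℕ.≢-nonZero⁻¹ k (ℕ.m+n≡0⇒m≡0 k eq))) ⟨
      (const (a 0) ⊕ q^ k ⊛ V k (tail a)) (k ℕ.+ m)
        ≡⟨ cong (const (a 0) ⊕ q^ k ⊛ V k (tail a)) k+m≡ ⟩
      (const (a 0) ⊕ q^ k ⊛ V k (tail a)) (r ℕ.+ suc n ℕ.* k) ∎
      where
      m = r ℕ.+ n ℕ.* k
      k+m≡ : k ℕ.+ m ≡ r ℕ.+ suc n ℕ.* k
      k+m≡ = trans (sym (ℕ.+-assoc k r _)) (trans (cong (ℕ._+ n ℕ.* k) (ℕ.+-comm k r)) (ℕ.+-assoc r k _))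

  -- A series in `q^k` acts as a scalar on residue classes. By `V-step` its constant term multiplies
  -- the class, and the remaining factor `q^k` lowers `n` by one, contributing nothing at `n = 0`
  -- because `r < k`.
  U-V-⊛ : ∀ a b {r} → r ℕ.< k → U k r (V k a ⊛ b) ≗ a ⊛ U k r b
  U-V-⊛ a b {r} r<k n = trans (⊛-cong {c = b} (V-step a) (λ _ → refl) (r ℕ.+ n ℕ.* k))
    (trans (⊛-distribʳ b (const (a 0)) (q^ k ⊛ V k (tail a)) (r ℕ.+ n ℕ.* k))
    (trans (cong₂ ℤ._+_ (const-⊛ (a 0) b (r ℕ.+ n ℕ.* k)) (⊛-assoc (q^ k) (V k (tail a)) b (r ℕ.+ n ℕ.* k)))
           (rest n)))
    where
    c = V k (tail a) ⊛ b
    rest : ∀ n → a 0 ℤ.* b (r ℕ.+ n ℕ.* k) ℤ.+ (q^ k ⊛ c) (r ℕ.+ n ℕ.* k) ≡ (a ⊛ U k r b) n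
    rest zero    = cong (ℤ._+_ (a 0 ℤ.* b (r ℕ.+ 0)))
      (trans (cong (q^ k ⊛ c) (ℕ.+-identityʳ r)) (q^-⊛-< c r<k))
    rest (suc n) = cong (ℤ._+_ (a 0 ℤ.* b (r ℕ.+ suc n ℕ.* k)))
      (trans (cong (q^ k ⊛ c) (trans (sym (ℕ.+-assoc r k _)) (trans (cong (ℕ._+ n ℕ.* k) (ℕ.+-comm r k)) (ℕ.+-assoc k r _))))
      (trans (q^-⊛-≥ k c (r ℕ.+ n ℕ.* k)) (U-V-⊛ (tail a) b r<k n)))

  -- Compared class by class: class 0 is an instance of `U-V-⊛`, and in the other classes both sides
  -- vanish.
  V-⊛ : ∀ a b → V k (a ⊛ b) ≗ V k a ⊛ V k b
  V-⊛ a b = U-ext λ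
    { zero    0<k n → trans (U₀-V (a ⊛ b) n)
        (sym (trans (U-V-⊛ a (V k b) 0<k n) (⊛-cong {a = a} (λ _ → refl) (U₀-V b) n)))
    ; (suc r) r<k n → trans (U-V (a ⊛ b) ℕ.z<s r<k n)
        (sym (trans (U-V-⊛ a (V k b) r<k n)
          (trans (⊛-cong {a = a} (λ _ → refl) (U-V b ℕ.z<s r<k) n) (coeff (𝕊.zeroʳ a) n)))) }

  V-⊕ : ∀ a b → V k (a ⊕ b) ≗ V k a ⊕ V k b
  V-⊕ a b n with does (k ∣? n)
  ... | true  = refl
  ... | false = refl

  V-⊝ : ∀ a → V k (⊝ a) ≗ ⊝ V k a
  V-⊝ a n with does (k ∣? n)
  ... | true  = refl
  ... | false = refl

  V-q^ : ∀ m → V k (q^ m) ≗ q^ (m ℕ.* k)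
  V-q^ m = U-ext λ
    { zero    _   n → trans (U₀-V (q^ m) n) (sym (U-q^-≡ 0 m n))
    ; (suc r) r<k n → trans (U-V (q^ m) ℕ.z<s r<k n)
        (sym (U-q^-≢ m r<k (ℕ.<-trans ℕ.z<s r<k) (λ ()) n)) }

  V-const : ∀ c → V k (const c) ≗ const c
  V-const c n = trans (V-step (const c) n)
    (trans (cong (ℤ._+_ (const c n)) (trans (⊛-cong {a = q^ k} (λ _ → refl) V-0 n) (coeff (𝕊.zeroʳ (q^ k)) n))) (ℤ.+-identityʳ _))
    where
    V-0 : V k 0ₛ ≗ 0ₛ
    V-0 m with does (k ∣? m)
    ... | true  = refl
    ... | false = refl

V-V : ∀ k m .{{_ : NonZero k}} .{{_ : NonZero m}} a → V k (V m a) ≗ V (m ℕ.* k) {{ℕ.m*n≢0 m k}} a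
V-V k m a n = by-cases (k ∣? n)
  where
  instance _ = ℕ.m*n≢0 m k
  multiple : ∀ j → Dec (m ∣ℕ j) → V k (V m a) (j ℕ.* k) ≡ V (m ℕ.* k) a (j ℕ.* k)
  multiple j (no m∤j) = trans (V-∣ (V m a) j) (trans (V-∤ a m∤j)
    (sym (V-∤ {m ℕ.* k} a λ mk∣jk → m∤j (ℕ.*-cancelʳ-∣ k mk∣jk))))
  multiple j (yes (divides i refl)) = trans (V-∣ (V m a) j) (trans (V-∣ a i)
    (sym (trans (cong (V (m ℕ.* k) a) (ℕ.*-assoc i m k)) (V-∣ {m ℕ.* k} a i))))
  by-cases : Dec (k ∣ℕ n) → V k (V m a) n ≡ V (m ℕ.* k) a n
  by-cases (no k∤n) = trans (V-∤ {k} (V m a) k∤n)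
    (sym (V-∤ {m ℕ.* k} a λ mk∣n → k∤n (ℕ.∣-trans (ℕ.n∣m*n m) mk∣n)))
  by-cases (yes (divides j refl)) = multiple j (m ∣? j)

dissected-⊛ : (Fin 5 → Series) → Series
dissected-⊛ A = V 5 (A 0F) ⊕ q^ 1 ⊛ V 5 (A 1F) ⊕ q^ 2 ⊛ V 5 (A 2F) ⊕ q^ 3 ⊛ V 5 (A 3F) ⊕ q^ 4 ⊛ V 5 (A 4F)

U-dissected-⊛ : ∀ A r → U 5 (toℕ r) (dissected-⊛ A) ≗ A r
U-dissected-⊛ A r n = go r
  where
  term : ∀ r s → U 5 (toℕ r) (q^ (toℕ s) ⊛ V 5 (A s)) n ≡ (if does (r Fin.≟ s) then A s n else 0ℤ)
  term r s = trans (⊛-comm (q^ (toℕ s)) (V 5 (A s)) (toℕ r ℕ.+ n ℕ.* 5))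
    (trans (U-V-⊛ (A s) (q^ (toℕ s)) (Fin.toℕ<n r) n) (case-eq (r Fin.≟ s)))
    where
    toℕ-q^ : q^ (toℕ s) ≗ q^ (toℕ s ℕ.+ 0)
    toℕ-q^ m = cong (λ e → (q^ e) m) (sym (ℕ.+-identityʳ (toℕ s)))
    case-eq : ∀ d → (A s ⊛ U 5 (toℕ r) (q^ (toℕ s))) n ≡ (if does d then A s n else 0ℤ)
    case-eq (yes refl) = trans (⊛-cong {a = A s} (λ _ → refl)
        (λ m → trans (toℕ-q^ (toℕ s ℕ.+ m ℕ.* 5)) (U-q^-≡ (toℕ s) 0 m)) n) (coeff (𝕊.*-identityʳ (A s)) n)
    case-eq (no r≢s) = trans (⊛-cong {a = A s} (λ _ → refl)
        (λ m → trans (toℕ-q^ (toℕ r ℕ.+ m ℕ.* 5))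
                 (U-q^-≢ 0 (Fin.toℕ<n r) (Fin.toℕ<n s) (λ eq → r≢s (Fin.toℕ-injective eq)) m)) n)
        (coeff (𝕊.zeroʳ (A s)) n)
  first : ∀ r → U 5 (toℕ r) (V 5 (A 0F)) n ≡ (if does (r Fin.≟ 0F) then A 0F n else 0ℤ)
  first r = trans (sym (⊛-identityˡ (V 5 (A 0F)) (toℕ r ℕ.+ n ℕ.* 5))) (term r 0F)
  terms : ∀ r → U 5 (toℕ r) (dissected-⊛ A) n ≡ _
  terms r = cong₂ ℤ._+_ (cong₂ ℤ._+_ (cong₂ ℤ._+_ (cong₂ ℤ._+_ (first r) (term r 1F)) (term r 2F)) (term r 3F)) (term r 4F)
  open +-*-Solver
  z = con 0ℤ
  go : ∀ r → U 5 (toℕ r) (dissected-⊛ A) n ≡ A r n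
  go 0F = trans (terms 0F) (solve 1 (λ x → x :+ z :+ z :+ z :+ z := x) refl (A 0F n))
  go 1F = trans (terms 1F) (solve 1 (λ x → z :+ x :+ z :+ z :+ z := x) refl (A 1F n))
  go 2F = trans (terms 2F) (solve 1 (λ x → z :+ z :+ x :+ z :+ z := x) refl (A 2F n))
  go 3F = trans (terms 3F) (solve 1 (λ x → z :+ z :+ z :+ x :+ z := x) refl (A 3F n))
  go 4F = trans (terms 4F) (solve 1 (λ x → z :+ z :+ z :+ z :+ x := x) refl (A 4F n))

dissect-⊛ : ∀ a → a ≗ dissected-⊛ (λ r → U 5 (toℕ r) a)
dissect-⊛ a = U-ext λ r r<5 → subst (λ s → U 5 s a ≗ U 5 s (dissected-⊛ (λ r → U 5 (toℕ r) a)))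
  (Fin.toℕ-fromℕ< r<5) (λ n → sym (U-dissected-⊛ (λ r → U 5 (toℕ r) a) (Fin.fromℕ< r<5) n))

f-V : ∀ k m .{{_ : NonZero k}} .{{_ : NonZero m}} → V k (f m) ≗ f (m ℕ.* k) {{ℕ.m*n≢0 m k}}
f-V k m n = sym (trans (fPartial-V n n) (aux (k ∣? n)))
  where
  instance _ = ℕ.m*n≢0 m k
  factor-V : ∀ e → 1ₛ ⊖ q^ ((m ℕ.* k) ℕ.* e) ≐ V k (1ₛ ⊖ q^ (m ℕ.* e))
  factor-V e = begin
    1ₛ ⊕ ⊝ q^ (m ℕ.* k ℕ.* e)     ≡⟨ cong (λ x → 1ₛ ⊕ ⊝ q^ x) (trans (ℕ.*-assoc m k e)
                                       (trans (cong (m ℕ.*_) (ℕ.*-comm k e)) (sym (ℕ.*-assoc m e k)))) ⟩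
    1ₛ ⊕ ⊝ q^ (m ℕ.* e ℕ.* k)     ≈⟨ 𝕊.+-cong (coeffwise (V-q^ {k} 0)) (𝕊.-‿cong (coeffwise (V-q^ (m ℕ.* e)))) ⟨
    V k 1ₛ ⊕ ⊝ V k (q^ (m ℕ.* e)) ≈⟨ 𝕊.+-congˡ {V k 1ₛ} (coeffwise (V-⊝ (q^ (m ℕ.* e)))) ⟨
    V k 1ₛ ⊕ V k (⊝ q^ (m ℕ.* e)) ≈⟨ coeffwise (V-⊕ 1ₛ (⊝ q^ (m ℕ.* e))) ⟨
    V k (1ₛ ⊖ q^ (m ℕ.* e))       ∎
    where open ≐-Reasoning
  fPartial-V : ∀ N → fPartial (m ℕ.* k) N ≗ V k (fPartial m N)
  fPartial-V zero    n = sym (V-q^ {k} 0 n)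
  fPartial-V (suc N) n = trans (⊛-cong (coeff (factor-V (suc N))) (fPartial-V N) n)
                               (sym (V-⊛ (1ₛ ⊖ q^ (m ℕ.* suc N)) (fPartial m N) n))
  aux : ∀ {n} → Dec (k ∣ℕ n) → V k (fPartial m n) n ≡ V k (f m) n
  aux {n} (no k∤n) = trans (V-∤ (fPartial m n) k∤n) (sym (V-∤ (f m) k∤n))
  -- The partial product has `j * k` factors but is read in degree `j`, where `f m` uses `j`
  -- factors; `f-stable` bridges the gap.
  aux (yes (divides j refl)) = trans (V-∣ (fPartial m (j ℕ.* k)) j)
    (trans (f-stable m (ℕ.m≤m*n j k)) (sym (V-∣ (f m) j)))

-- Truncation and infinite sums; the identities of Euler and Gauss.

_≐_upTo_ : Series → Series → ℕ → Set
a ≐ b upTo n = ∀ m → m ℕ.≤ n → a m ≡ b m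

infix 4 _≐_upTo_

⊕-upTo : ∀ {a b c d n} → a ≐ b upTo n → c ≐ d upTo n → a ⊕ c ≐ b ⊕ d upTo n
⊕-upTo p q m m≤n = cong₂ ℤ._+_ (p m m≤n) (q m m≤n)

⊛-upTo : ∀ {a b c d n} → a ≐ b upTo n → c ≐ d upTo n → a ⊛ c ≐ b ⊛ d upTo n
⊛-upTo p q zero m≤n = cong (ℤ._+ 0ℤ) (cong₂ ℤ._*_ (p 0 m≤n) (q 0 m≤n))
⊛-upTo {n = suc n} p q (suc m) (ℕ.s≤s m≤n) = cong₂ ℤ._+_ (cong₂ ℤ._*_ (p 0 ℕ.z≤n) (q (suc m) (ℕ.s≤s m≤n)))
  (⊛-upTo {n = n} (λ k k≤n → p (suc k) (ℕ.s≤s k≤n)) (λ k k≤n → q k (ℕ.m≤n⇒m≤1+n k≤n)) m m≤n)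

⊛-q^-upTo : ∀ a {e n} → n ℕ.< e → a ⊛ q^ e ≐ 0ₛ upTo n
⊛-q^-upTo a {e} n<e m m≤n = trans (⊛-comm a (q^ e) m) (q^-⊛-< a (ℕ.≤-<-trans m≤n n<e))

-- The sign `(-1)^n` as a series, so that ring identities can treat `ε (suc n)` as the negative of
-- an atom.
ε : ℕ → Series
ε zero    = 1ₛ
ε (suc n) = ⊝ ε n

T : ℕ → ℕ
T zero    = 0
T (suc n) = T n ℕ.+ suc n

n≤T : ∀ n → n ℕ.≤ T n
n≤T zero    = ℕ.z≤n
n≤T (suc n) = ℕ.m≤n+m (suc n) (T n)

ω : ℕ → ℕ
ω n = n ℕ.* n ℕ.+ T n

n≤ω : ∀ n → n ℕ.≤ ω n
n≤ω n = ℕ.≤-trans (n≤T n) (ℕ.m≤n+m (T n) (n ℕ.* n))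

sumTo : (ℕ → Series) → ℕ → Series
sumTo t zero    = 0ₛ
sumTo t (suc n) = sumTo t n ⊕ t n

Σ∞ : (ℕ → Series) → Series
Σ∞ t n = sumTo t (suc n) n

Summable : (ℕ → Series) → Set
Summable t = ∀ {s m} → m ℕ.< s → t s m ≡ 0ℤ

sumTo-stable : ∀ {t} → Summable t → ∀ {m N} → m ℕ.< N → sumTo t N m ≡ Σ∞ t m
sumTo-stable {t} t-sum {m} {suc N} (ℕ.s≤s m≤N) with ℕ.m≤n⇒m<n∨m≡n m≤N
... | inj₂ refl = refl
... | inj₁ m<N  = trans (cong₂ ℤ._+_ (sumTo-stable t-sum m<N) (t-sum m<N)) (ℤ.+-identityʳ _)

-- Shanks' finite form of the pentagonal number theorem: in Horner form,
-- shanks n s = Σ_{j≤s} (-1)^j (∏_{j<i≤s} (1 - q^i)) q^{jn + T j}, and going from n to n + 1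
-- telescopes. T and ω are the triangular and the second pentagonal numbers.

shanks : ℕ → ℕ → Series
shanks n zero    = 1ₛ
shanks n (suc s) = (1ₛ ⊖ q^ (suc s)) ⊛ shanks n s ⊕ ε (suc s) ⊛ q^ (suc s ℕ.* n ℕ.+ T (suc s))

q^-≡ : ∀ {m n} → m ≡ n → q^ m ≐ q^ n
q^-≡ m≡n = 𝕊.reflexive (cong q^_ m≡n)

q^-split : ∀ {m} a b → m ≡ a ℕ.+ b → q^ m ≐ q^ a ⊛ q^ b
q^-split a b m≡a+b = 𝕊.trans (q^-≡ m≡a+b) (𝕊.sym (coeffwise (q^-+ a b)))

-- With X, Y, M, e as below, the induction hypothesis contributes `(1 − X) e M` and the last Horner
-- term `(1 − Y) e M X`. Their sum is `e M − e M X Y`: the first part completes `shanks n (suc s)`,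
-- the second is the next correction.
shanks-step : ∀ n s → (1ₛ ⊖ q^ (suc n)) ⊛ shanks (suc n) s
                      ≐ shanks n s ⊕ ε (suc s) ⊛ q^ (suc s ℕ.* n ℕ.+ T (suc s))
shanks-step n zero = begin
  (1ₛ ⊖ q^ (suc n)) ⊛ 1ₛ       ≈⟨ 𝕊.*-identityʳ (1ₛ ⊖ q^ (suc n)) ⟩
  1ₛ ⊕ ⊝ q^ (suc n)            ≈⟨ 𝕊.+-congˡ {1ₛ} (𝕊.-‿cong (q^-≡ (exponent n))) ⟩
  1ₛ ⊕ ⊝ q^ (1 ℕ.* n ℕ.+ T 1)  ≈⟨ solve 1 (λ y → con 1ℤ :- y , con 1ℤ :+ (:- con 1ℤ) :* y) refl y ⟩
  1ₛ ⊕ ε 1 ⊛ q^ (1 ℕ.* n ℕ.+ T 1) ∎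
  where
  open ≐-Reasoning
  open Unsealed
  y = q^ (1 ℕ.* n ℕ.+ T 1)
  exponent : ∀ n → suc n ≡ 1 ℕ.* n ℕ.+ 1
  exponent = ℕ-Solver.solve-∀
shanks-step n (suc s) = begin
  (1ₛ ⊕ ⊝ Y) ⊛ ((1ₛ ⊕ ⊝ X) ⊛ H′ ⊕ e ⊛ q^ (suc s ℕ.* suc n ℕ.+ T (suc s)))
    ≈⟨ 𝕊.*-congˡ {1ₛ ⊕ ⊝ Y} (𝕊.+-congˡ {(1ₛ ⊕ ⊝ X) ⊛ H′} (𝕊.*-congˡ {e} MX)) ⟩
  (1ₛ ⊕ ⊝ Y) ⊛ ((1ₛ ⊕ ⊝ X) ⊛ H′ ⊕ e ⊛ (M ⊛ X))
    ≈⟨ solve 5 (λ y x h e m → (con 1ℤ :- y) :* ((con 1ℤ :- x) :* h :+ e :* (m :* x)) ,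
                              (con 1ℤ :- x) :* ((con 1ℤ :- y) :* h) :+ (con 1ℤ :- y) :* (e :* (m :* x)))
               refl Y X H′ e M ⟩
  (1ₛ ⊕ ⊝ X) ⊛ ((1ₛ ⊕ ⊝ Y) ⊛ H′) ⊕ (1ₛ ⊕ ⊝ Y) ⊛ (e ⊛ (M ⊛ X))
    ≈⟨ 𝕊.+-congʳ {(1ₛ ⊕ ⊝ Y) ⊛ (e ⊛ (M ⊛ X))} (𝕊.*-congˡ {1ₛ ⊕ ⊝ X} (shanks-step n s)) ⟩
  (1ₛ ⊕ ⊝ X) ⊛ (H ⊕ e ⊛ M) ⊕ (1ₛ ⊕ ⊝ Y) ⊛ (e ⊛ (M ⊛ X))
    ≈⟨ solve 5 (λ y x h e m → (con 1ℤ :- x) :* (h :+ e :* m) :+ (con 1ℤ :- y) :* (e :* (m :* x)) ,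
                              ((con 1ℤ :- x) :* h :+ e :* m) :+ (:- e) :* (m :* x :* y))
               refl Y X H e M ⟩
  ((1ₛ ⊕ ⊝ X) ⊛ H ⊕ e ⊛ M) ⊕ (⊝ e) ⊛ (M ⊛ X ⊛ Y)
    ≈⟨ 𝕊.+-congˡ {(1ₛ ⊕ ⊝ X) ⊛ H ⊕ e ⊛ M} (𝕊.*-congˡ {⊝ e} MXY) ⟨
  ((1ₛ ⊕ ⊝ X) ⊛ H ⊕ e ⊛ M) ⊕ (⊝ e) ⊛ q^ (suc (suc s) ℕ.* n ℕ.+ T (suc (suc s))) ∎
  where
  open ≐-Reasoning
  open Unsealed
  X = q^ (suc s)
  Y = q^ (suc n)
  H = shanks n s
  H′ = shanks (suc n) s
  e = ε (suc s)
  M = q^ (suc s ℕ.* n ℕ.+ T (suc s))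
  MX : q^ (suc s ℕ.* suc n ℕ.+ T (suc s)) ≐ M ⊛ X
  MX = q^-split (suc s ℕ.* n ℕ.+ T (suc s)) (suc s) (lemma n s (T (suc s)))
    where
    lemma : ∀ n s t → suc s ℕ.* suc n ℕ.+ t ≡ suc s ℕ.* n ℕ.+ t ℕ.+ suc s
    lemma = ℕ-Solver.solve-∀
  MXY : q^ (suc (suc s) ℕ.* n ℕ.+ T (suc (suc s))) ≐ M ⊛ X ⊛ Y
  MXY = 𝕊.trans (q^-split (suc s ℕ.* n ℕ.+ T (suc s) ℕ.+ suc s) (suc n) (lemma n s (T (suc s)))) (𝕊.*-congʳ {Y} (𝕊.sym (coeffwise (q^-+ (suc s ℕ.* n ℕ.+ T (suc s)) (suc s)))))
    where
    lemma : ∀ n s t → suc (suc s) ℕ.* n ℕ.+ (t ℕ.+ suc (suc s)) ≡ suc s ℕ.* n ℕ.+ t ℕ.+ suc s ℕ.+ suc n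
    lemma = ℕ-Solver.solve-∀

-- All terms with `j ≥ 1` have order above `n`, so only the product, the term `j = 0`, is left.
shanks-upTo : ∀ n s → shanks n s ≐ fPartial 1 s upTo n
shanks-upTo n zero    m m≤n = refl
shanks-upTo n (suc s) m m≤n = trans
  (⊕-upTo {b = (1ₛ ⊖ q^ (1 ℕ.* suc s)) ⊛ fPartial 1 s} {n = n}
    (⊛-upTo {n = n} (λ k _ → cong (λ e → (1ₛ ⊖ q^ e) k) (sym (ℕ.*-identityˡ (suc s)))) (shanks-upTo n s))
    (⊛-q^-upTo (ε (suc s)) n<e) m m≤n)
  (ℤ.+-identityʳ _)
  where
  n<e : n ℕ.< suc s ℕ.* n ℕ.+ T (suc s)
  n<e = ℕ.≤-trans (ℕ.≤-reflexive (ℕ.+-comm 1 n))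
    (ℕ.+-mono-≤ (ℕ.m≤m+n n (s ℕ.* n)) (ℕ.≤-trans (ℕ.s≤s ℕ.z≤n) (n≤T (suc s))))

-- The indices `s` and `-(s + 1)` of the bilateral sum, taken together: the exponents are s(3s+1)/2
-- and (s+1)(3s+2)/2. The sum over `s ≥ 0` then needs no exceptional first term.
pentagonal : ℕ → Series
pentagonal s = ε s ⊛ (q^ (ω s) ⊖ q^ (ω s ℕ.+ suc (2 ℕ.* s)))

-- The subtracted monomial is, up to sign, the correction of `shanks-step n n`. Absorbing it turns
-- `shanks n n` into `(1 − q^(n+1))` times `shanks (suc n) n`, and the first half of the next
-- pentagonal term supplies the rest of `shanks (suc n) (suc n)`.
pentagonal-sum : ∀ n → sumTo pentagonal (suc n) ≐ shanks n n ⊖ ε n ⊛ q^ (ω n ℕ.+ suc (2 ℕ.* n))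
pentagonal-sum zero = solve 1 (λ x → con 0ℤ :+ con 1ℤ :* (con 1ℤ :- x) , con 1ℤ :- con 1ℤ :* x) refl (q^ 1)
  where open Unsealed
pentagonal-sum (suc n) = begin
  sumTo pentagonal (suc n) ⊕ e ⊛ (W ⊕ ⊝ W′)
    ≈⟨ 𝕊.+-congʳ {e ⊛ (W ⊕ ⊝ W′)} (pentagonal-sum n) ⟩
  (H ⊕ ⊝ (ε n ⊛ q^ (ω n ℕ.+ suc (2 ℕ.* n)))) ⊕ e ⊛ (W ⊕ ⊝ W′)
    ≈⟨ 𝕊.+-congʳ {e ⊛ (W ⊕ ⊝ W′)} (𝕊.+-congˡ {H} (𝕊.-‿cong (𝕊.*-congˡ {ε n} (q^-≡ (exponent n (T n)))))) ⟩
  (H ⊕ ⊝ (ε n ⊛ M)) ⊕ e ⊛ (W ⊕ ⊝ W′)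
    ≈⟨ solve 5 (λ h e m w w′ → (h :- e :* m) :+ (:- e) :* (w :- w′) ,
                               (h :+ (:- e) :* m) :+ (:- e) :* w :- (:- e) :* w′) refl H (ε n) M W W′ ⟩
  (H ⊕ e ⊛ M) ⊕ e ⊛ W ⊕ ⊝ (e ⊛ W′)
    ≈⟨ 𝕊.+-congʳ {⊝ (e ⊛ W′)} (𝕊.+-congʳ {e ⊛ W} (shanks-step n n)) ⟨
  shanks (suc n) (suc n) ⊕ ⊝ (e ⊛ W′) ∎
  where
  open ≐-Reasoning
  open Unsealed
  e = ε (suc n)
  H = shanks n n
  M = q^ (suc n ℕ.* n ℕ.+ T (suc n))
  W = q^ (ω (suc n))
  W′ = q^ (ω (suc n) ℕ.+ suc (2 ℕ.* suc n))
  exponent : ∀ n t → n ℕ.* n ℕ.+ t ℕ.+ suc (2 ℕ.* n) ≡ suc n ℕ.* n ℕ.+ (t ℕ.+ suc n)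
  exponent = ℕ-Solver.solve-∀

euler : f 1 ≗ Σ∞ pentagonal
euler n = sym (begin
  sumTo pentagonal (suc n) n             ≡⟨ coeff (pentagonal-sum n) n ⟩
  shanks n n n ℤ.- (ε n ⊛ q^ (ω n ℕ.+ suc (2 ℕ.* n))) n
    ≡⟨ cong₂ ℤ._-_ (shanks-upTo n n n ℕ.≤-refl) (⊛-q^-upTo (ε n) n<e n ℕ.≤-refl) ⟩
  f 1 n ℤ.- 0ℤ                           ≡⟨ ℤ.+-identityʳ _ ⟩
  f 1 n                                  ∎)
  where
  open ≡-Reasoning
  n<e : n ℕ.< ω n ℕ.+ suc (2 ℕ.* n)
  n<e = ℕ.≤-trans (ℕ.s≤s (ℕ.m≤m+n n (n ℕ.+ 0))) (ℕ.m≤n+m _ (ω n))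

-- The analogue for Gauss' identity: gaussSum n s = ∏_{i≤s} (1 - q^i)
-- + 2 Σ_{1≤j≤s} (-1)^j (∏_{j<i≤s} (1 - q^i)) (∏_{i<j} (1 + q^i)) q^{j(n+1)}.

∏[1+q^_] : ℕ → Series
∏[1+q^ zero  ] = 1ₛ
∏[1+q^ suc n ] = (1ₛ ⊕ q^ (suc n)) ⊛ ∏[1+q^ n ]

gaussSum : ℕ → ℕ → Series
gaussSum n zero    = 1ₛ
gaussSum n (suc s) = (1ₛ ⊖ q^ (suc s)) ⊛ gaussSum n s
                     ⊕ const (+ 2) ⊛ ε (suc s) ⊛ ∏[1+q^ s ] ⊛ q^ (suc s ℕ.* suc n)

-- As in `shanks-step`, but the new terms add up to `2 e B M (1 − X Y)`, and
-- `1 − X Y = (1 + Y) − (1 + X) Y`: the first part completes `gaussSum n (suc s)`, while in the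
-- second `(1 + X) B` is the next product.
gaussSum-step : ∀ n s → (1ₛ ⊖ q^ (suc n)) ⊛ gaussSum (suc n) s
                        ≐ (1ₛ ⊕ q^ (suc n)) ⊛ gaussSum n s
                          ⊕ const (+ 2) ⊛ ε (suc s) ⊛ ∏[1+q^ s ] ⊛ q^ (suc s ℕ.* suc n)
gaussSum-step n zero = begin
  (1ₛ ⊕ ⊝ q^ (suc n)) ⊛ 1ₛ
    ≈⟨ solve 1 (λ y → (con 1ℤ :- y) :* con 1ℤ ,
                      (con 1ℤ :+ y) :* con 1ℤ :+ con (+ 2) :* (:- con 1ℤ) :* con 1ℤ :* y) refl (q^ (suc n)) ⟩
  (1ₛ ⊕ q^ (suc n)) ⊛ 1ₛ ⊕ const (+ 2) ⊛ ε 1 ⊛ 1ₛ ⊛ q^ (suc n)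
    ≈⟨ 𝕊.+-congˡ {(1ₛ ⊕ q^ (suc n)) ⊛ 1ₛ} (𝕊.*-congˡ {const (+ 2) ⊛ ε 1 ⊛ 1ₛ} (q^-≡ (sym (ℕ.*-identityˡ (suc n))))) ⟩
  (1ₛ ⊕ q^ (suc n)) ⊛ 1ₛ ⊕ const (+ 2) ⊛ ε 1 ⊛ 1ₛ ⊛ q^ (1 ℕ.* suc n) ∎
  where
  open ≐-Reasoning
  open Unsealed
gaussSum-step n (suc s) = begin
  (1ₛ ⊕ ⊝ Y) ⊛ ((1ₛ ⊕ ⊝ X) ⊛ G′ ⊕ const (+ 2) ⊛ e ⊛ B ⊛ q^ (suc s ℕ.* suc (suc n)))
    ≈⟨ 𝕊.*-congˡ {1ₛ ⊕ ⊝ Y} (𝕊.+-congˡ {(1ₛ ⊕ ⊝ X) ⊛ G′} (𝕊.*-congˡ {const (+ 2) ⊛ e ⊛ B} MX)) ⟩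
  (1ₛ ⊕ ⊝ Y) ⊛ ((1ₛ ⊕ ⊝ X) ⊛ G′ ⊕ const (+ 2) ⊛ e ⊛ B ⊛ (M ⊛ X))
    ≈⟨ solve 6 (λ y x g e b m → (con 1ℤ :- y) :* ((con 1ℤ :- x) :* g :+ con (+ 2) :* e :* b :* (m :* x)) ,
         (con 1ℤ :- x) :* ((con 1ℤ :- y) :* g) :+ (con 1ℤ :- y) :* (con (+ 2) :* e :* b :* (m :* x)))
         refl Y X G′ e B M ⟩
  (1ₛ ⊕ ⊝ X) ⊛ ((1ₛ ⊕ ⊝ Y) ⊛ G′) ⊕ (1ₛ ⊕ ⊝ Y) ⊛ (const (+ 2) ⊛ e ⊛ B ⊛ (M ⊛ X))
    ≈⟨ 𝕊.+-congʳ {(1ₛ ⊕ ⊝ Y) ⊛ (const (+ 2) ⊛ e ⊛ B ⊛ (M ⊛ X))} (𝕊.*-congˡ {1ₛ ⊕ ⊝ X} (gaussSum-step n s)) ⟩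
  (1ₛ ⊕ ⊝ X) ⊛ ((1ₛ ⊕ Y) ⊛ G ⊕ const (+ 2) ⊛ e ⊛ B ⊛ M) ⊕ (1ₛ ⊕ ⊝ Y) ⊛ (const (+ 2) ⊛ e ⊛ B ⊛ (M ⊛ X))
    ≈⟨ solve 6 (λ y x g e b m →
         (con 1ℤ :- x) :* ((con 1ℤ :+ y) :* g :+ con (+ 2) :* e :* b :* m)
           :+ (con 1ℤ :- y) :* (con (+ 2) :* e :* b :* (m :* x)) ,
         (con 1ℤ :+ y) :* ((con 1ℤ :- x) :* g :+ con (+ 2) :* e :* b :* m)
           :+ con (+ 2) :* (:- e) :* ((con 1ℤ :+ x) :* b) :* (m :* y))
         refl Y X G e B M ⟩
  (1ₛ ⊕ Y) ⊛ ((1ₛ ⊕ ⊝ X) ⊛ G ⊕ const (+ 2) ⊛ e ⊛ B ⊛ M) ⊕ const (+ 2) ⊛ (⊝ e) ⊛ ((1ₛ ⊕ X) ⊛ B) ⊛ (M ⊛ Y)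
    ≈⟨ 𝕊.+-congˡ {(1ₛ ⊕ Y) ⊛ ((1ₛ ⊕ ⊝ X) ⊛ G ⊕ const (+ 2) ⊛ e ⊛ B ⊛ M)} (𝕊.*-congˡ {const (+ 2) ⊛ (⊝ e) ⊛ ((1ₛ ⊕ X) ⊛ B)} MY) ⟨
  (1ₛ ⊕ Y) ⊛ ((1ₛ ⊕ ⊝ X) ⊛ G ⊕ const (+ 2) ⊛ e ⊛ B ⊛ M) ⊕ const (+ 2) ⊛ (⊝ e) ⊛ ((1ₛ ⊕ X) ⊛ B) ⊛ q^ (suc (suc s) ℕ.* suc n) ∎
  where
  open ≐-Reasoning
  open Unsealed
  X = q^ (suc s)
  Y = q^ (suc n)
  G = gaussSum n s
  G′ = gaussSum (suc n) s
  B = ∏[1+q^ s ]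
  e = ε (suc s)
  M = q^ (suc s ℕ.* suc n)
  MX : q^ (suc s ℕ.* suc (suc n)) ≐ M ⊛ X
  MX = q^-split (suc s ℕ.* suc n) (suc s) (lemma n s)
    where
    lemma : ∀ n s → suc s ℕ.* suc (suc n) ≡ suc s ℕ.* suc n ℕ.+ suc s
    lemma = ℕ-Solver.solve-∀
  MY : q^ (suc (suc s) ℕ.* suc n) ≐ M ⊛ Y
  MY = q^-split (suc s ℕ.* suc n) (suc n) (ℕ.+-comm (suc n) (suc s ℕ.* suc n))

gaussSum-upTo : ∀ n s → gaussSum n s ≐ fPartial 1 s upTo n
gaussSum-upTo n zero    m m≤n = refl
gaussSum-upTo n (suc s) m m≤n = trans
  (⊕-upTo {b = (1ₛ ⊖ q^ (1 ℕ.* suc s)) ⊛ fPartial 1 s} {n = n}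
    (⊛-upTo {n = n} (λ k _ → cong (λ e → (1ₛ ⊖ q^ e) k) (sym (ℕ.*-identityˡ (suc s)))) (gaussSum-upTo n s))
    (⊛-q^-upTo (const (+ 2) ⊛ ε (suc s) ⊛ ∏[1+q^ s ]) (ℕ.m≤m+n (suc n) (s ℕ.* suc n))) m m≤n)
  (ℤ.+-identityʳ _)

-- The theta term of `s + 1`: the term of 0 is the leading 1 of Φ, and the terms of opposite indices
-- coincide, whence the factor 2 there.
square : ℕ → Series
square s = ε (suc s) ⊛ q^ (suc s ℕ.* suc s)

-- The factor `1 + Y` splits the new square term in two: one part is the correction in
-- `gaussSum-step n n`, the other the last Horner term of `gaussSum (suc n) (suc n)`.
square-sum : ∀ n → ∏[1+q^ n ] ⊛ (1ₛ ⊕ const (+ 2) ⊛ sumTo square n) ≐ gaussSum n n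
square-sum zero = solve 0 (con 1ℤ :* (con 1ℤ :+ con (+ 2) :* con 0ℤ) , con 1ℤ) refl
  where open Unsealed
square-sum (suc n) = begin
  ((1ₛ ⊕ Y) ⊛ B) ⊛ (1ₛ ⊕ const (+ 2) ⊛ (S ⊕ e ⊛ M))
    ≈⟨ solve 5 (λ y b s e m → ((con 1ℤ :+ y) :* b) :* (con 1ℤ :+ con (+ 2) :* (s :+ e :* m)) ,
         (con 1ℤ :+ y) :* (b :* (con 1ℤ :+ con (+ 2) :* s)) :+ con (+ 2) :* e :* b :* m
           :+ con (+ 2) :* e :* b :* (m :* y)) refl Y B S e M ⟩
  (1ₛ ⊕ Y) ⊛ (B ⊛ (1ₛ ⊕ const (+ 2) ⊛ S)) ⊕ const (+ 2) ⊛ e ⊛ B ⊛ M ⊕ const (+ 2) ⊛ e ⊛ B ⊛ (M ⊛ Y)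
    ≈⟨ 𝕊.+-cong (𝕊.+-congʳ {const (+ 2) ⊛ e ⊛ B ⊛ M} (𝕊.*-congˡ {1ₛ ⊕ Y} (square-sum n)))
                (𝕊.*-congˡ {const (+ 2) ⊛ e ⊛ B} (𝕊.sym (q^-split (suc n ℕ.* suc n) (suc n) (exponent n)))) ⟩
  (1ₛ ⊕ Y) ⊛ gaussSum n n ⊕ const (+ 2) ⊛ e ⊛ B ⊛ M ⊕ const (+ 2) ⊛ e ⊛ B ⊛ q^ (suc n ℕ.* suc (suc n))
    ≈⟨ 𝕊.+-congʳ {const (+ 2) ⊛ e ⊛ B ⊛ q^ (suc n ℕ.* suc (suc n))} (gaussSum-step n n) ⟨
  gaussSum (suc n) (suc n) ∎
  where
  open ≐-Reasoning
  open Unsealed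
  Y = q^ (suc n)
  B = ∏[1+q^ n ]
  S = sumTo square n
  e = ε (suc n)
  M = q^ (suc n ℕ.* suc n)
  exponent : ∀ n → suc n ℕ.* suc (suc n) ≡ suc n ℕ.* suc n ℕ.+ suc n
  exponent = ℕ-Solver.solve-∀

f₁-∏ : ∀ n → fPartial 1 n ⊛ ∏[1+q^ n ] ≐ fPartial 2 n
f₁-∏ zero    = 𝕊.*-identityʳ 1ₛ
f₁-∏ (suc n) = begin
  ((1ₛ ⊕ ⊝ q^ (1 ℕ.* suc n)) ⊛ fPartial 1 n) ⊛ ((1ₛ ⊕ Y) ⊛ ∏[1+q^ n ])
    ≈⟨ 𝕊.*-congʳ {(1ₛ ⊕ Y) ⊛ ∏[1+q^ n ]} (𝕊.*-congʳ {fPartial 1 n} (𝕊.+-congˡ {1ₛ} (𝕊.-‿cong (q^-≡ (ℕ.*-identityˡ (suc n)))))) ⟩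
  ((1ₛ ⊕ ⊝ Y) ⊛ fPartial 1 n) ⊛ ((1ₛ ⊕ Y) ⊛ ∏[1+q^ n ])
    ≈⟨ solve 3 (λ y a b → ((con 1ℤ :- y) :* a) :* ((con 1ℤ :+ y) :* b) , (con 1ℤ :- y :* y) :* (a :* b)) refl Y (fPartial 1 n) ∏[1+q^ n ] ⟩
  (1ₛ ⊕ ⊝ (Y ⊛ Y)) ⊛ (fPartial 1 n ⊛ ∏[1+q^ n ])
    ≈⟨ 𝕊.*-cong (𝕊.+-congˡ {1ₛ} (𝕊.-‿cong (𝕊.sym (q^-split (suc n) (suc n) (double n))))) (f₁-∏ n) ⟩
  (1ₛ ⊕ ⊝ q^ (2 ℕ.* suc n)) ⊛ fPartial 2 n ∎
  where
  open ≐-Reasoning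
  open Unsealed
  Y = q^ (suc n)
  double : ∀ n → 2 ℕ.* suc n ≡ suc n ℕ.+ suc n
  double = ℕ-Solver.solve-∀

square-summable : Summable square
square-summable {s} {m} m<s = ⊛-q^-upTo (ε (suc s)) (ℕ.m≤m*n (suc s) (suc s)) m (ℕ.<⇒≤ m<s)

pentagonal-summable : Summable pentagonal
pentagonal-summable {s} {m} m<s =
  trans (coeff (solve 3 (λ e x y → e :* (x :- y) , e :* x :- e :* y) refl (ε s) (q^ (ω s)) (q^ (ω s ℕ.+ suc (2 ℕ.* s)))) m)
    (cong₂ ℤ._-_ (⊛-q^-upTo (ε s) (ℕ.≤-trans m<s (n≤ω s)) m ℕ.≤-refl)
                 (⊛-q^-upTo (ε s) (ℕ.≤-trans m<s (ℕ.≤-trans (n≤ω s) (ℕ.m≤m+n (ω s) _))) m ℕ.≤-refl))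
  where open Unsealed

τ : Series
τ = Σ∞ square

-- In degree `n` everything may be cut off after `n` factors. The truncated `f 2` splits by
-- `1 − q^(2i) = (1 − q^i)(1 + q^i)`; the factors `1 + q^i` are absorbed by `square-sum`, and what
-- results is again the truncated `f 1`.
gauss-⊛ : (1ₛ ⊕ const (+ 2) ⊛ τ) ⊛ f 2 ≐ f 1 ⊛ f 1
gauss-⊛ = coeffwise λ n →
  let
    τ-upTo : τ ≐ sumTo square n upTo n
    -- `Σ∞` may include one term more than `square-sum`; that term has order `(n + 1)²` and is
    -- invisible here.
    τ-upTo m m≤n = trans (sym (sumTo-stable {square} square-summable (ℕ.s≤s m≤n)))
      (trans (cong (ℤ._+_ (sumTo square n m)) (⊛-q^-upTo (ε (suc n)) (ℕ.m≤m*n (suc n) (suc n)) m m≤n)) (ℤ.+-identityʳ _))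
    f-upTo : ∀ k .{{_ : NonZero k}} → f k ≐ fPartial k n upTo n
    f-upTo k m m≤n = sym (f-stable k m≤n)
    P = fPartial 1 n
  in begin
  ((1ₛ ⊕ const (+ 2) ⊛ τ) ⊛ f 2) n
    ≡⟨ ⊛-upTo {n = n} (⊕-upTo {1ₛ} {n = n} (λ _ _ → refl) (⊛-upTo {const (+ 2)} {n = n} (λ _ _ → refl) τ-upTo)) (f-upTo 2) n ℕ.≤-refl ⟩
  ((1ₛ ⊕ const (+ 2) ⊛ sumTo square n) ⊛ fPartial 2 n) n
    ≡⟨ coeff (𝕊.*-congˡ {1ₛ ⊕ const (+ 2) ⊛ sumTo square n} (𝕊.sym (f₁-∏ n))) n ⟩
  ((1ₛ ⊕ const (+ 2) ⊛ sumTo square n) ⊛ (P ⊛ ∏[1+q^ n ])) n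
    ≡⟨ coeff (solve 3 (λ t p b → t :* (p :* b) , p :* (b :* t)) refl (1ₛ ⊕ const (+ 2) ⊛ sumTo square n) P ∏[1+q^ n ]) n ⟩
  (P ⊛ (∏[1+q^ n ] ⊛ (1ₛ ⊕ const (+ 2) ⊛ sumTo square n))) n
    ≡⟨ coeff (𝕊.*-congˡ {P} (square-sum n)) n ⟩
  (P ⊛ gaussSum n n) n
    ≡⟨ ⊛-upTo {n = n} (λ m m≤n → sym (f-upTo 1 m m≤n)) (λ m m≤n → trans (gaussSum-upTo n n m m≤n) (sym (f-upTo 1 m m≤n))) n ℕ.≤-refl ⟩
  (f 1 ⊛ f 1) n ∎
  where
  open ≡-Reasoning
  open Unsealed

-- Residue classes modulo 5 in the series of Euler and Gauss.

-- Modulo 5 the exponents of both series depend only on the index modulo 5, so every block of five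
-- terms shows the same pattern of residues.
block : (ℕ → Series) → ℕ → Series
block t j = t (j ℕ.* 5) ⊕ t (1 ℕ.+ j ℕ.* 5) ⊕ t (2 ℕ.+ j ℕ.* 5) ⊕ t (3 ℕ.+ j ℕ.* 5) ⊕ t (4 ℕ.+ j ℕ.* 5)

sumTo-block : ∀ t N → sumTo t (N ℕ.* 5) ≗ sumTo (block t) N
sumTo-block t zero    n = refl
sumTo-block t (suc N) n = trans
  (cong (λ x → x ℤ.+ t (N ℕ.* 5) n ℤ.+ t (1 ℕ.+ N ℕ.* 5) n ℤ.+ t (2 ℕ.+ N ℕ.* 5) n ℤ.+ t (3 ℕ.+ N ℕ.* 5) n ℤ.+ t (4 ℕ.+ N ℕ.* 5) n)
        (sumTo-block t N n))
  (solve 6 (λ x a b c d e → x :+ a :+ b :+ c :+ d :+ e := x :+ (a :+ b :+ c :+ d :+ e)) refl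
         (sumTo (block t) N n) (t (N ℕ.* 5) n) _ _ _ _)
  where open +-*-Solver

-- Degree `r + 5n` lies below `5(n + 1)`, so the first `n + 1` blocks suffice, which is exactly
-- where `Σ∞ u` is cut off in degree `n`.
U-Σ∞ : ∀ {t u r} → Summable t → r ℕ.< 5 → (∀ j → U 5 r (block t j) ≗ u j) → U 5 r (Σ∞ t) ≗ Σ∞ u
U-Σ∞ {t} {u} {r} t-sum r<5 eq n = begin
  Σ∞ t (r ℕ.+ n ℕ.* 5)                   ≡⟨ sumTo-stable {t} t-sum (ℕ.+-monoˡ-< (n ℕ.* 5) r<5) ⟨
  sumTo t (suc n ℕ.* 5) (r ℕ.+ n ℕ.* 5)  ≡⟨ sumTo-block t (suc n) _ ⟩
  U 5 r (sumTo (block t) (suc n)) n      ≡⟨ blocks (suc n) ⟩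
  sumTo u (suc n) n                      ∎
  where
  open ≡-Reasoning
  blocks : ∀ N → U 5 r (sumTo (block t) N) n ≡ sumTo u N n
  blocks zero    = refl
  blocks (suc N) = cong₂ ℤ._+_ (blocks N) (eq N n)

Σ∞-0 : Σ∞ (λ _ → 0ₛ) ≗ 0ₛ
Σ∞-0 n = go (suc n)
  where
  go : ∀ N → sumTo (λ _ → 0ₛ) N n ≡ 0ℤ
  go zero    = refl
  go (suc N) = trans (ℤ.+-identityʳ _) (go N)

Σ∞-⊝ : ∀ t → Σ∞ (λ s → ⊝ t s) ≗ ⊝ Σ∞ t
Σ∞-⊝ t n = go (suc n)
  where
  go : ∀ N → sumTo (λ s → ⊝ t s) N n ≡ ℤ.- sumTo t N n
  go zero    = refl
  go (suc N) = trans (cong (ℤ._- t N n) (go N)) (sym (ℤ.neg-distrib-+ (sumTo t N n) (t N n)))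

Σ∞-V : ∀ k .{{_ : NonZero k}} {t} → Summable t → Σ∞ (λ s → V k (t s)) ≗ V k (Σ∞ t)
Σ∞-V k {t} t-sum n = trans (sym (V-sumTo (suc n))) (stable (k ∣? n))
  where
  V-sumTo : ∀ N → V k (sumTo t N) n ≡ sumTo (λ s → V k (t s)) N n
  V-sumTo zero    = trans (V-cong {k} (λ m → sym (const-0 m)) n) (trans (V-const {k} 0ℤ n) (const-0 n))
  V-sumTo (suc N) = trans (V-⊕ (sumTo t N) (t N) n) (cong (ℤ._+ V k (t N) n) (V-sumTo N))
  stable : ∀ {n} → Dec (k ∣ℕ n) → V k (sumTo t (suc n)) n ≡ V k (Σ∞ t) n
  stable {n} (no k∤n) = trans (V-∤ (sumTo t (suc n)) k∤n) (sym (V-∤ (Σ∞ t) k∤n))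
  stable (yes (divides j refl)) = trans (V-∣ (sumTo t (suc (j ℕ.* k))) j)
    (trans (sumTo-stable {t} t-sum (ℕ.s≤s (ℕ.m≤m*n j k))) (sym (V-∣ (Σ∞ t) j)))

ε-⊛ : ∀ s a k r → U k r (ε s ⊛ a) ≗ ε s ⊛ U k r a
ε-⊛ zero    a k r n = trans (⊛-identityˡ a _) (sym (⊛-identityˡ (U k r a) n))
ε-⊛ (suc s) a k r n = trans (neg-⊛ (ε s) a _) (trans (cong ℤ.-_ (ε-⊛ s a k r n)) (sym (neg-⊛ (ε s) (U k r a) n)))
  where
  open Unsealed
  neg-⊛ : ∀ a b → (⊝ a) ⊛ b ≗ ⊝ (a ⊛ b)
  neg-⊛ a b = coeff (solve 2 (λ a b → (:- a) :* b , :- (a :* b)) refl a b)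

V-ε : ∀ k .{{_ : NonZero k}} s → V k (ε s) ≗ ε s
V-ε k zero    = V-q^ {k} 0
V-ε k (suc s) n = trans (V-⊝ (ε s) n) (cong ℤ.-_ (V-ε k s n))

ε-*5 : ∀ j → ε (j ℕ.* 5) ≐ ε j
ε-*5 zero    = 𝕊.refl
ε-*5 (suc j) = 𝕊.trans (solve 1 (λ e → :- :- :- :- :- e , :- e) refl (ε (j ℕ.* 5))) (𝕊.-‿cong (ε-*5 j))
  where open Unsealed

T-+ : ∀ i n → T (i ℕ.+ n) ≡ T i ℕ.+ i ℕ.* n ℕ.+ T n
T-+ zero    n = refl
T-+ (suc i) n = trans (cong (ℕ._+ suc (i ℕ.+ n)) (T-+ i n)) (rearrange i n (T i) (T n))
  where
  rearrange : ∀ i n s t → s ℕ.+ i ℕ.* n ℕ.+ t ℕ.+ suc (i ℕ.+ n) ≡ s ℕ.+ suc i ℕ.+ suc i ℕ.* n ℕ.+ t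
  rearrange = ℕ-Solver.solve-∀

T-*5 : ∀ j → T (j ℕ.* 5) ≡ T j ℕ.* 5 ℕ.+ 10 ℕ.* (j ℕ.* j)
T-*5 zero    = refl
T-*5 (suc j) = trans (T-+ 5 (j ℕ.* 5)) (trans (cong (15 ℕ.+ 5 ℕ.* (j ℕ.* 5) ℕ.+_) (T-*5 j)) (rearrange j (T j)))
  where
  rearrange : ∀ j t → 15 ℕ.+ 5 ℕ.* (j ℕ.* 5) ℕ.+ (t ℕ.* 5 ℕ.+ 10 ℕ.* (j ℕ.* j)) ≡ (t ℕ.+ suc j) ℕ.* 5 ℕ.+ 10 ℕ.* (suc j ℕ.* suc j)
  rearrange = ℕ-Solver.solve-∀

ω-digits : ∀ i j → ω (i ℕ.+ j ℕ.* 5) ≡ ω i ℕ.+ (7 ℕ.* (j ℕ.* j) ℕ.+ T j ℕ.+ 3 ℕ.* i ℕ.* j) ℕ.* 5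
ω-digits i j = trans (cong ((i ℕ.+ j ℕ.* 5) ℕ.* (i ℕ.+ j ℕ.* 5) ℕ.+_)
                           (trans (T-+ i (j ℕ.* 5)) (cong (T i ℕ.+ i ℕ.* (j ℕ.* 5) ℕ.+_) (T-*5 j))))
                     (rearrange i j (T i) (T j))
  where
  rearrange : ∀ i j s t → (i ℕ.+ j ℕ.* 5) ℕ.* (i ℕ.+ j ℕ.* 5) ℕ.+ (s ℕ.+ i ℕ.* (j ℕ.* 5) ℕ.+ (t ℕ.* 5 ℕ.+ 10 ℕ.* (j ℕ.* j)))
                          ≡ i ℕ.* i ℕ.+ s ℕ.+ (7 ℕ.* (j ℕ.* j) ℕ.+ t ℕ.+ 3 ℕ.* i ℕ.* j) ℕ.* 5
  rearrange = ℕ-Solver.solve-∀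

ω′ : ℕ → ℕ
ω′ n = ω n ℕ.+ suc (2 ℕ.* n)

ω′-digits : ∀ i j → ω′ (i ℕ.+ j ℕ.* 5) ≡ ω′ i ℕ.+ (7 ℕ.* (j ℕ.* j) ℕ.+ T j ℕ.+ 3 ℕ.* i ℕ.* j ℕ.+ 2 ℕ.* j) ℕ.* 5
ω′-digits i j = trans (cong (ℕ._+ suc (2 ℕ.* (i ℕ.+ j ℕ.* 5))) (ω-digits i j)) (rearrange i j (ω i) (7 ℕ.* (j ℕ.* j) ℕ.+ T j ℕ.+ 3 ℕ.* i ℕ.* j))
  where
  rearrange : ∀ i j w x → w ℕ.+ x ℕ.* 5 ℕ.+ suc (2 ℕ.* (i ℕ.+ j ℕ.* 5)) ≡ w ℕ.+ suc (2 ℕ.* i) ℕ.+ (x ℕ.+ 2 ℕ.* j) ℕ.* 5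
  rearrange = ℕ-Solver.solve-∀

2*T : ∀ n → 2 ℕ.* T n ≡ n ℕ.* suc n
2*T zero    = refl
2*T (suc n) = trans (ℕ.*-distribˡ-+ 2 (T n) (suc n)) (trans (cong (ℕ._+ 2 ℕ.* suc n) (2*T n)) (rearrange n))
  where
  rearrange : ∀ n → n ℕ.* suc n ℕ.+ 2 ℕ.* suc n ≡ suc n ℕ.* suc (suc n)
  rearrange = ℕ-Solver.solve-∀

U-hit : ∀ {e} r m → e ≡ r ℕ.+ m ℕ.* 5 → U 5 r (q^ e) ≐ q^ m
U-hit r m refl = coeffwise (U-q^-≡ r m)

U-miss : ∀ {e} r s m {_ : True (r ℕ.<? 5)} {_ : True (s ℕ.<? 5)} {_ : False (r ℕ.≟ s)} →
         e ≡ s ℕ.+ m ℕ.* 5 → U 5 r (q^ e) ≐ 0ₛ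
U-miss r s m {r<5} {s<5} {r≢s} refl = coeffwise (U-q^-≢ m (toWitness r<5) (toWitness s<5) (toWitnessFalse r≢s))

module _ (j : ℕ) where

  private
    x : ℕ → ℕ
    x i = 7 ℕ.* (j ℕ.* j) ℕ.+ T j ℕ.+ 3 ℕ.* i ℕ.* j
    x′ : ℕ → ℕ
    x′ i = x i ℕ.+ 2 ℕ.* j

  U-pentagonal : ∀ i r {a b} → U 5 r (q^ (ω (i ℕ.+ j ℕ.* 5))) ≐ a → U 5 r (q^ (ω′ (i ℕ.+ j ℕ.* 5))) ≐ b →
                 U 5 r (pentagonal (i ℕ.+ j ℕ.* 5)) ≐ ε (i ℕ.+ j ℕ.* 5) ⊛ (a ⊖ b)
  U-pentagonal i r p p′ = 𝕊.trans
    (coeffwise (ε-⊛ (i ℕ.+ j ℕ.* 5) (q^ (ω (i ℕ.+ j ℕ.* 5)) ⊖ q^ (ω′ (i ℕ.+ j ℕ.* 5))) 5 r))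
    (𝕊.*-congˡ {ε (i ℕ.+ j ℕ.* 5)} (𝕊.+-cong p (𝕊.-‿cong p′)))

  -- For `i = 0, …, 4` the values of `ω` are 0, 2, 7, 15, 26 and those of `ω′` are 1, 5, 12, 22, 35,
  -- so only the residues 0, 1, 2 occur. The numerals added to `x i` and `x′ i` are the quotients of
  -- these values by 5.
  pentagonal-block-0 : ∀ r → {True (r ℕ.<? 5)} → {False (r ℕ.≟ 0)} → {False (r ℕ.≟ 1)} → {False (r ℕ.≟ 2)} →
                       U 5 r (block pentagonal j) ≐ 0ₛ
  pentagonal-block-0 r {r<5} {r≢0} {r≢1} {r≢2} = 𝕊.trans
    (𝕊.+-cong (𝕊.+-cong (𝕊.+-cong (𝕊.+-cong
      (U-pentagonal 0 r (miss₀ (x 0) (ω-digits 0 j)) (miss₁ (x′ 0) (ω′-digits 0 j)))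
      (U-pentagonal 1 r (miss₂ (x 1) (ω-digits 1 j)) (miss₀ (1 ℕ.+ x′ 1) (ω′-digits 1 j))))
      (U-pentagonal 2 r (miss₂ (1 ℕ.+ x 2) (ω-digits 2 j)) (miss₂ (2 ℕ.+ x′ 2) (ω′-digits 2 j))))
      (U-pentagonal 3 r (miss₀ (3 ℕ.+ x 3) (ω-digits 3 j)) (miss₂ (4 ℕ.+ x′ 3) (ω′-digits 3 j))))
      (U-pentagonal 4 r (miss₁ (5 ℕ.+ x 4) (ω-digits 4 j)) (miss₀ (7 ℕ.+ x′ 4) (ω′-digits 4 j))))
    (solve 1 (λ e → let z = con 0ℤ :- con 0ℤ in
      e :* z :+ (:- e) :* z :+ (:- :- e) :* z :+ (:- :- :- e) :* z :+ (:- :- :- :- e) :* z , con 0ℤ) refl (ε (j ℕ.* 5)))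
    where
    open Unsealed
    miss₀ : ∀ {e} m → e ≡ 0 ℕ.+ m ℕ.* 5 → U 5 r (q^ e) ≐ 0ₛ
    miss₀ m = U-miss r 0 m {r<5} {_} {r≢0}
    miss₁ : ∀ {e} m → e ≡ 1 ℕ.+ m ℕ.* 5 → U 5 r (q^ e) ≐ 0ₛ
    miss₁ m = U-miss r 1 m {r<5} {_} {r≢1}
    miss₂ : ∀ {e} m → e ≡ 2 ℕ.+ m ℕ.* 5 → U 5 r (q^ e) ≐ 0ₛ
    miss₂ m = U-miss r 2 m {r<5} {_} {r≢2}

  -- Residue 1 is hit twice: by `ω′` at `i = 0`, with quotient `5 ω j`, and by `ω` at `i = 4`, with
  -- quotient `5 ω′ j`. Conceptually, `24N + 1` is a square for a pentagonal `N`; if `N ≡ 1` modulo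
  -- 5 it is divisible by 25, and `(N − 1)/25` is pentagonal again.
  pentagonal-block-1 : U 5 1 (block pentagonal j) ≐ ⊝ V 5 (pentagonal j)
  pentagonal-block-1 = begin
    U 5 1 (block pentagonal j)
      ≈⟨ 𝕊.+-cong (𝕊.+-cong (𝕊.+-cong (𝕊.+-cong
          (U-pentagonal 0 1 (U-miss 1 0 (x 0) (ω-digits 0 j)) (U-hit 1 (ω j ℕ.* 5) (trans (ω′-digits 0 j) (cong (λ m → 1 ℕ.+ m ℕ.* 5) (low j (T j) (2*T j))))))
          (U-pentagonal 1 1 (U-miss 1 2 (x 1) (ω-digits 1 j)) (U-miss 1 0 (1 ℕ.+ x′ 1) (ω′-digits 1 j))))
          (U-pentagonal 2 1 (U-miss 1 2 (1 ℕ.+ x 2) (ω-digits 2 j)) (U-miss 1 2 (2 ℕ.+ x′ 2) (ω′-digits 2 j))))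
          (U-pentagonal 3 1 (U-miss 1 0 (3 ℕ.+ x 3) (ω-digits 3 j)) (U-miss 1 2 (4 ℕ.+ x′ 3) (ω′-digits 3 j))))
          (U-pentagonal 4 1 (U-hit 1 (ω′ j ℕ.* 5) (trans (ω-digits 4 j) (cong (λ m → 1 ℕ.+ m ℕ.* 5) (high j (T j) (2*T j))))) (U-miss 1 0 (7 ℕ.+ x′ 4) (ω′-digits 4 j))) ⟩
    _ ≈⟨ solve 3 (λ e w w′ → let z = con 0ℤ :- con 0ℤ in
         e :* (con 0ℤ :- w) :+ (:- e) :* z :+ (:- :- e) :* z :+ (:- :- :- e) :* z :+ (:- :- :- :- e) :* (w′ :- con 0ℤ) ,
         :- (e :* (w :- w′))) refl (ε (j ℕ.* 5)) (q^ (ω j ℕ.* 5)) (q^ (ω′ j ℕ.* 5)) ⟩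
    ⊝ (ε (j ℕ.* 5) ⊛ (q^ (ω j ℕ.* 5) ⊕ ⊝ q^ (ω′ j ℕ.* 5)))
      ≈⟨ 𝕊.-‿cong (𝕊.*-cong (𝕊.trans (ε-*5 j) (𝕊.sym (coeffwise (V-ε 5 j))))
           (𝕊.+-cong (𝕊.sym (coeffwise (V-q^ (ω j)))) (𝕊.-‿cong (𝕊.sym (coeffwise (V-q^ (ω′ j))))))) ⟩
    ⊝ (V 5 (ε j) ⊛ (V 5 (q^ ω j) ⊕ ⊝ V 5 (q^ ω′ j)))
      ≈⟨ 𝕊.-‿cong (𝕊.*-congˡ {V 5 (ε j)} (𝕊.+-congˡ {V 5 (q^ ω j)} (coeffwise (V-⊝ (q^ ω′ j))))) ⟨
    ⊝ (V 5 (ε j) ⊛ (V 5 (q^ ω j) ⊕ V 5 (⊝ q^ ω′ j)))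
      ≈⟨ 𝕊.-‿cong (𝕊.*-congˡ {V 5 (ε j)} (coeffwise (V-⊕ (q^ ω j) (⊝ q^ ω′ j)))) ⟨
    ⊝ (V 5 (ε j) ⊛ V 5 (q^ ω j ⊕ ⊝ q^ ω′ j))
      ≈⟨ 𝕊.-‿cong (coeffwise (V-⊛ (ε j) (q^ ω j ⊖ q^ ω′ j))) ⟨
    ⊝ V 5 (pentagonal j) ∎
    where
    open Unsealed
    open ≐-Reasoning
    -- `2j² + 2j` is rewritten as `4t`, which makes the quotient divisible by 5 once more.
    low : ∀ j t → 2 ℕ.* t ≡ j ℕ.* suc j →
          7 ℕ.* (j ℕ.* j) ℕ.+ t ℕ.+ 3 ℕ.* 0 ℕ.* j ℕ.+ 2 ℕ.* j ≡ (j ℕ.* j ℕ.+ t) ℕ.* 5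
    low j t eq = trans (left j t) (trans (cong (λ y → 5 ℕ.* (j ℕ.* j) ℕ.+ t ℕ.+ 2 ℕ.* y) (sym eq)) (right j t))
      where
      left : ∀ j t → 7 ℕ.* (j ℕ.* j) ℕ.+ t ℕ.+ 3 ℕ.* 0 ℕ.* j ℕ.+ 2 ℕ.* j ≡ 5 ℕ.* (j ℕ.* j) ℕ.+ t ℕ.+ 2 ℕ.* (j ℕ.* suc j)
      left = ℕ-Solver.solve-∀
      right : ∀ j t → 5 ℕ.* (j ℕ.* j) ℕ.+ t ℕ.+ 2 ℕ.* (2 ℕ.* t) ≡ (j ℕ.* j ℕ.+ t) ℕ.* 5
      right = ℕ-Solver.solve-∀
    high : ∀ j t → 2 ℕ.* t ≡ j ℕ.* suc j →
           5 ℕ.+ (7 ℕ.* (j ℕ.* j) ℕ.+ t ℕ.+ 3 ℕ.* 4 ℕ.* j) ≡ (j ℕ.* j ℕ.+ t ℕ.+ suc (2 ℕ.* j)) ℕ.* 5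
    high j t eq = trans (left j t) (trans (cong (λ y → y ℕ.+ 5 ℕ.+ 10 ℕ.* j) (low j t eq)) (right j t))
      where
      left : ∀ j t → 5 ℕ.+ (7 ℕ.* (j ℕ.* j) ℕ.+ t ℕ.+ 3 ℕ.* 4 ℕ.* j)
                     ≡ 7 ℕ.* (j ℕ.* j) ℕ.+ t ℕ.+ 3 ℕ.* 0 ℕ.* j ℕ.+ 2 ℕ.* j ℕ.+ 5 ℕ.+ 10 ℕ.* j
      left = ℕ-Solver.solve-∀
      right : ∀ j t → (j ℕ.* j ℕ.+ t) ℕ.* 5 ℕ.+ 5 ℕ.+ 10 ℕ.* j ≡ (j ℕ.* j ℕ.+ t ℕ.+ suc (2 ℕ.* j)) ℕ.* 5
      right = ℕ-Solver.solve-∀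

  square-digits : ∀ i → suc (i ℕ.+ j ℕ.* 5) ℕ.* suc (i ℕ.+ j ℕ.* 5)
                        ≡ suc i ℕ.* suc i ℕ.+ (5 ℕ.* (j ℕ.* j) ℕ.+ 2 ℕ.* suc i ℕ.* j) ℕ.* 5
  square-digits i = rearrange i j
    where
    rearrange : ∀ i j → suc (i ℕ.+ j ℕ.* 5) ℕ.* suc (i ℕ.+ j ℕ.* 5)
                        ≡ suc i ℕ.* suc i ℕ.+ (5 ℕ.* (j ℕ.* j) ℕ.+ 2 ℕ.* suc i ℕ.* j) ℕ.* 5
    rearrange = ℕ-Solver.solve-∀

  U-square : ∀ i r {a} → U 5 r (q^ (suc (i ℕ.+ j ℕ.* 5) ℕ.* suc (i ℕ.+ j ℕ.* 5))) ≐ a →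
             U 5 r (square (i ℕ.+ j ℕ.* 5)) ≐ ε (suc (i ℕ.+ j ℕ.* 5)) ⊛ a
  U-square i r p = 𝕊.trans
    (coeffwise (ε-⊛ (suc (i ℕ.+ j ℕ.* 5)) (q^ (suc (i ℕ.+ j ℕ.* 5) ℕ.* suc (i ℕ.+ j ℕ.* 5))) 5 r))
    (𝕊.*-congˡ {ε (suc (i ℕ.+ j ℕ.* 5))} p)

  private
    y : ℕ → ℕ
    y i = 5 ℕ.* (j ℕ.* j) ℕ.+ 2 ℕ.* suc i ℕ.* j

  -- The squares 1, 4, 9, 16, 25 have residues 1, 4, 4, 1, 0; the numerals added to `y i` are their
  -- quotients by 5.
  square-block-0 : ∀ r → {True (r ℕ.<? 5)} → {False (r ℕ.≟ 0)} → {False (r ℕ.≟ 1)} → {False (r ℕ.≟ 4)} →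
                   U 5 r (block square j) ≐ 0ₛ
  square-block-0 r {r<5} {r≢0} {r≢1} {r≢4} = 𝕊.trans
    (𝕊.+-cong (𝕊.+-cong (𝕊.+-cong (𝕊.+-cong
      (U-square 0 r (U-miss r 1 (y 0) {r<5} {_} {r≢1} (square-digits 0)))
      (U-square 1 r (U-miss r 4 (y 1) {r<5} {_} {r≢4} (square-digits 1))))
      (U-square 2 r (U-miss r 4 (1 ℕ.+ y 2) {r<5} {_} {r≢4} (square-digits 2))))
      (U-square 3 r (U-miss r 1 (3 ℕ.+ y 3) {r<5} {_} {r≢1} (square-digits 3))))
      (U-square 4 r (U-miss r 0 (5 ℕ.+ y 4) {r<5} {_} {r≢0} (square-digits 4))))
    (solve 1 (λ e → let z = con 0ℤ in
      (:- e) :* z :+ (:- :- e) :* z :+ (:- :- :- e) :* z :+ (:- :- :- :- e) :* z :+ (:- :- :- :- :- e) :* z , con 0ℤ) refl (ε (j ℕ.* 5)))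
    where open Unsealed

  square-block-V : U 5 0 (block square j) ≐ V 5 (square j)
  square-block-V = begin
    U 5 0 (block square j)
      ≈⟨ 𝕊.+-cong (𝕊.+-cong (𝕊.+-cong (𝕊.+-cong
          (U-square 0 0 (U-miss 0 1 (y 0) (square-digits 0)))
          (U-square 1 0 (U-miss 0 4 (y 1) (square-digits 1))))
          (U-square 2 0 (U-miss 0 4 (1 ℕ.+ y 2) (square-digits 2))))
          (U-square 3 0 (U-miss 0 1 (3 ℕ.+ y 3) (square-digits 3))))
          (U-square 4 0 (U-hit 0 (suc j ℕ.* suc j ℕ.* 5) (trans (square-digits 4) (cong (ℕ._* 5) (exponent j))))) ⟩
    _ ≈⟨ solve 2 (λ e w → let z = con 0ℤ in
      (:- e) :* z :+ (:- :- e) :* z :+ (:- :- :- e) :* z :+ (:- :- :- :- e) :* z :+ (:- :- :- :- :- e) :* w , (:- e) :* w)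
      refl (ε (j ℕ.* 5)) (q^ (suc j ℕ.* suc j ℕ.* 5)) ⟩
    (⊝ ε (j ℕ.* 5)) ⊛ q^ (suc j ℕ.* suc j ℕ.* 5)
      ≈⟨ 𝕊.*-cong (𝕊.trans (𝕊.-‿cong (ε-*5 j)) (𝕊.sym (coeffwise (V-ε 5 (suc j))))) (𝕊.sym (coeffwise (V-q^ (suc j ℕ.* suc j)))) ⟩
    V 5 (ε (suc j)) ⊛ V 5 (q^ (suc j ℕ.* suc j))
      ≈⟨ coeffwise (V-⊛ (ε (suc j)) (q^ (suc j ℕ.* suc j))) ⟨
    V 5 (square j) ∎
    where
    open Unsealed
    open ≐-Reasoning
    exponent : ∀ j → 5 ℕ.+ (5 ℕ.* (j ℕ.* j) ℕ.+ 2 ℕ.* 5 ℕ.* j) ≡ suc j ℕ.* suc j ℕ.* 5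
    exponent = ℕ-Solver.solve-∀

r<5 : ∀ r {_ : True (r ℕ.<? 5)} → r ℕ.< 5
r<5 r {p} = toWitness p

U-f₁-0 : ∀ r → {True (r ℕ.<? 5)} → {False (r ℕ.≟ 0)} → {False (r ℕ.≟ 1)} → {False (r ℕ.≟ 2)} → U 5 r (f 1) ≐ 0ₛ
U-f₁-0 r {p} {p₀} {p₁} {p₂} = coeffwise λ n → trans (euler (r ℕ.+ n ℕ.* 5))
  (trans (U-Σ∞ {pentagonal} {λ _ → 0ₛ} pentagonal-summable (toWitness p) (λ j → coeff (pentagonal-block-0 j r {p} {p₀} {p₁} {p₂})) n) (Σ∞-0 n))

U-f₁-1-⊝ : U 5 1 (f 1) ≐ ⊝ V 5 (f 1)
U-f₁-1-⊝ = coeffwise λ n → begin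
  f 1 (1 ℕ.+ n ℕ.* 5)               ≡⟨ euler (1 ℕ.+ n ℕ.* 5) ⟩
  Σ∞ pentagonal (1 ℕ.+ n ℕ.* 5)     ≡⟨ U-Σ∞ {pentagonal} {λ j → ⊝ V 5 (pentagonal j)} pentagonal-summable (r<5 1) (λ j → coeff (pentagonal-block-1 j)) n ⟩
  Σ∞ (λ j → ⊝ V 5 (pentagonal j)) n ≡⟨ Σ∞-⊝ (λ j → V 5 (pentagonal j)) n ⟩
  ℤ.- Σ∞ (λ j → V 5 (pentagonal j)) n ≡⟨ cong ℤ.-_ (Σ∞-V 5 {pentagonal} pentagonal-summable n) ⟩
  ℤ.- V 5 (Σ∞ pentagonal) n         ≡⟨ cong ℤ.-_ (V-cong {5} euler n) ⟨
  ℤ.- V 5 (f 1) n                   ∎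
  where open ≡-Reasoning

U-τ-0 : ∀ r → {True (r ℕ.<? 5)} → {False (r ℕ.≟ 0)} → {False (r ℕ.≟ 1)} → {False (r ℕ.≟ 4)} → U 5 r τ ≐ 0ₛ
U-τ-0 r {p} {p₀} {p₁} {p₄} = coeffwise λ n →
  trans (U-Σ∞ {square} {λ _ → 0ₛ} square-summable (toWitness p) (λ j → coeff (square-block-0 j r {p} {p₀} {p₁} {p₄})) n) (Σ∞-0 n)

U-τ-V : U 5 0 τ ≐ V 5 τ
U-τ-V = coeffwise λ n →
  trans (U-Σ∞ {square} {λ j → V 5 (square j)} square-summable (r<5 0) (λ j → coeff (square-block-V j)) n)
        (Σ∞-V 5 {square} square-summable n)

-- Fermat's little theorem for the prime 5.

fermat-ℕ : ∀ n → (+ 5) ℤ.∣ (+ n) ℤ.^ 5 ℤ.- + n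
fermat-ℕ zero    = ℤ.divides 0ℤ refl
fermat-ℕ (suc n) = subst ((+ 5) ℤ.∣_) (step (+ n)) (ℤ.∣m∣n⇒∣m+n (fermat-ℕ n)
  (ℤ.divides ((+ n) ℤ.^ 4 ℤ.+ + 2 ℤ.* (+ n) ℤ.^ 3 ℤ.+ + 2 ℤ.* (+ n) ℤ.^ 2 ℤ.+ + n) refl))
  where
  open +-*-Solver
  step : ∀ n → (n ℤ.^ 5 ℤ.- n) ℤ.+ (n ℤ.^ 4 ℤ.+ + 2 ℤ.* n ℤ.^ 3 ℤ.+ + 2 ℤ.* n ℤ.^ 2 ℤ.+ n) ℤ.* + 5
               ≡ (1ℤ ℤ.+ n) ℤ.^ 5 ℤ.- (1ℤ ℤ.+ n)
  step = solve 1 (λ n → 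
    (n :^ 5 :- n) :+ (n :^ 4 :+ con (+ 2) :* n :^ 3 :+ con (+ 2) :* n :^ 2 :+ n) :* con (+ 5)
    := (con 1ℤ :+ n) :^ 5 :- (con 1ℤ :+ n)) refl

fermat : ∀ x → (+ 5) ℤ.∣ x ℤ.^ 5 ℤ.- x
fermat (+ n)    = fermat-ℕ n
fermat -[1+ n ] = subst ((+ 5) ℤ.∣_) (negate (+ suc n)) (ℤ.∣m⇒∣-m (fermat-ℕ (suc n)))
  where
  open +-*-Solver
  negate : ∀ n → ℤ.- (n ℤ.^ 5 ℤ.- n) ≡ (ℤ.- n) ℤ.^ 5 ℤ.- (ℤ.- n)
  negate = solve 1 (λ n →  :- (n :^ 5 :- n) := (:- n) :^ 5 :- (:- n)) refl

-- Sealed copies of the ring operations: convolutions would otherwise be unfolded to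
-- sums of coefficients whenever two series are compared.

infixl 7 _·_
infixl 6 _+ₛ_
infix  8 -ₛ_

opaque

  _·_ _+ₛ_ : Series → Series → Series
  _·_  = _⊛_
  _+ₛ_ = _⊕_

  -ₛ_ : Series → Series
  -ₛ_ = ⊝_

  sealedRing-isCommutativeRing : IsCommutativeRing _≐_ _+ₛ_ _·_ -ₛ_ 0ₛ 1ₛ
  sealedRing-isCommutativeRing = CommutativeRing.isCommutativeRing seriesRing

sealedRing : CommutativeRing 0ℓ 0ℓ
sealedRing = record { isCommutativeRing = sealedRing-isCommutativeRing }

module ≐ = CommutativeRing sealedRing

Φ : Series
Φ = 1ₛ +ₛ const (+ 2) · τ

dissected : (Fin 5 → Series) → Series
dissected A = V 5 (A 0F) +ₛ q^ 1 · V 5 (A 1F) +ₛ q^ 2 · V 5 (A 2F) +ₛ q^ 3 · V 5 (A 3F) +ₛ q^ 4 · V 5 (A 4F)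

opaque
  unfolding _·_ _+ₛ_ -ₛ_

  +ₛ-at : ∀ x y n → (x +ₛ y) n ≡ x n ℤ.+ y n
  +ₛ-at x y n = refl

  fromℤ-+ : ∀ x y → fromℤ (x ℤ.+ y) ≐ fromℤ x +ₛ fromℤ y
  fromℤ-+ = _-Raw-AlmostCommutative⟶_.+-homo fromℤ-homo

  fromℤ-· : ∀ x y → fromℤ (x ℤ.* y) ≐ fromℤ x · fromℤ y
  fromℤ-· = _-Raw-AlmostCommutative⟶_.*-homo fromℤ-homo

  fromℤ--ₛ : ∀ x → fromℤ (ℤ.- x) ≐ -ₛ fromℤ x
  fromℤ--ₛ = _-Raw-AlmostCommutative⟶_.-‿homo fromℤ-homo

  const-· : ∀ c x n → (const c · x) n ≡ c ℤ.* x n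
  const-· = const-⊛

  ·-inverseʳ : ∀ x → x 0 ≡ 1ℤ → x · x ⁻¹ ≗ 1ₛ
  ·-inverseʳ = ⊛-inverseʳ

  q^-·-≥ : ∀ k x n → (q^ k · x) (k ℕ.+ n) ≡ x n
  q^-·-≥ = q^-⊛-≥

  q^-·-< : ∀ {k} x {n} → n ℕ.< k → (q^ k · x) n ≡ 0ℤ
  q^-·-< = q^-⊛-<

  q^-· : ∀ m n → q^ m · q^ n ≗ q^ (m ℕ.+ n)
  q^-· = q^-+

  U-dissected : ∀ A r → U 5 (toℕ r) (dissected A) ≗ A r
  U-dissected = U-dissected-⊛

  dissect : ∀ x → x ≗ dissected (λ r → U 5 (toℕ r) x)
  dissect = dissect-⊛

  V-· : ∀ {k} .{{_ : NonZero k}} x y → V k (x · y) ≗ V k x · V k y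
  V-· = V-⊛

  V-step-sealed : ∀ {k} .{{_ : NonZero k}} x → V k x ≐ const (x 0) +ₛ q^ k · V k (tail x)
  V-step-sealed x = coeffwise (V-step x)

  head-tail : ∀ x → x ≐ const (x 0) +ₛ q^ 1 · tail x
  head-tail x = coeffwise λ { zero    → sym (ℤ.+-identityʳ _)
                            ; (suc n) → sym (trans (ℤ.+-identityˡ _) (q^-⊛-≥ 1 (tail x) n)) }

  V-+ₛ : ∀ {k} .{{_ : NonZero k}} x y → V k (x +ₛ y) ≗ V k x +ₛ V k y
  V-+ₛ = V-⊕

  V--ₛ : ∀ {k} .{{_ : NonZero k}} x → V k (-ₛ x) ≗ -ₛ V k x
  V--ₛ = V-⊝

  U-V-· : ∀ {k} .{{_ : NonZero k}} x y {r} → r ℕ.< k → U k r (V k x · y) ≗ x · U k r y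
  U-V-· = U-V-⊛

  U-f₁-1 : U 5 1 (f 1) ≐ -ₛ V 5 (f 1)
  U-f₁-1 = U-f₁-1-⊝

  gauss : Φ · f 2 ≐ f 1 · f 1
  gauss = gauss-⊛

  Φ-0 : Φ 0 ≡ 1ℤ
  Φ-0 = refl

  ·-0 : ∀ {x y} → x 0 ≡ 1ℤ → y 0 ≡ 1ℤ → (x · y) 0 ≡ 1ℤ
  ·-0 x₀ y₀ = cong₂ (λ x₀ y₀ → x₀ ℤ.* y₀ ℤ.+ 0ℤ) x₀ y₀

  𝓔𝓞ᵤ-sealed : 𝓔𝓞ᵤ ≐ (f 4 · f 4) · (f 2 · f 2) ⁻¹
  𝓔𝓞ᵤ-sealed = ≐.refl

fromℤ-sealed-homo : ℤ-rawRing -Raw-AlmostCommutative⟶ fromCommutativeRing sealedRing (λ _ → nothing)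
fromℤ-sealed-homo = record
  { ⟦_⟧    = fromℤ
  ; +-homo = fromℤ-+
  ; *-homo = fromℤ-·
  ; -‿homo = fromℤ--ₛ
  ; 0-homo = ≐.refl
  ; 1-homo = ≐.refl
  }

module Sealed = Solver sealedRing fromℤ-sealed-homo

open Sealed
open import Algebra.Properties.Semiring.Exp.TCOptimised (CommutativeRing.semiring sealedRing)
  using (^-congˡ) renaming (_^_ to _^ˢ_)

-- Arithmetic of series dissected modulo 5.

q : Series
q = q^ 1

q^ˢ : ∀ n → q ^ˢ n ≐ q^ n
q^ˢ 0             = ≐.refl
q^ˢ 1             = ≐.refl
q^ˢ (suc (suc n)) = ≐.trans (≐.*-congʳ {q} (q^ˢ (suc n)))
  (≐.trans (coeffwise (q^-· (suc n) 1)) (q^-≡ (ℕ.+-comm (suc n) 1)))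

V-+ : ∀ a b → V 5 (a +ₛ b) ≐ V 5 a +ₛ V 5 b
V-+ a b = coeffwise (V-+ₛ a b)

V-* : ∀ a b → V 5 (a · b) ≐ V 5 a · V 5 b
V-* a b = coeffwise (V-· a b)

V-1 : V 5 1ₛ ≐ 1ₛ
V-1 = coeffwise (V-q^ {5} 0)

V-^ : ∀ a k → V 5 (a ^ˢ k) ≐ V 5 a ^ˢ k
V-^ a 0             = V-1
V-^ a 1             = ≐.refl
V-^ a (suc (suc k)) = ≐.trans (V-* (a ^ˢ suc k) a) (≐.*-congʳ {V 5 a} (V-^ a (suc k)))

V-fromℤ : ∀ x → V 5 (fromℤ x) ≐ fromℤ x
V-fromℤ x = coeffwise λ n →
  trans (V-cong {5} (fromℤ≗const x) n) (trans (V-const {5} x n) (sym (fromℤ≗const x n)))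

-- `V 5` is a ring endomorphism fixing the integers, hence commutes with every polynomial
-- expression.
V-⟦⟧ : ∀ {n} (e : Expr ℤ n) ρ → V 5 (⟦ e ⟧ ρ) ≐ ⟦ e ⟧ (Vec.map (V 5) ρ)
V-⟦⟧ (con x)  ρ = V-fromℤ x
V-⟦⟧ (var i)  ρ = ≐.reflexive (sym (Vec.lookup-map i (V 5) ρ))
V-⟦⟧ (x :+ y) ρ = ≐.trans (V-+ (⟦ x ⟧ ρ) (⟦ y ⟧ ρ)) (≐.+-cong (V-⟦⟧ x ρ) (V-⟦⟧ y ρ))
V-⟦⟧ (x :* y) ρ = ≐.trans (V-* (⟦ x ⟧ ρ) (⟦ y ⟧ ρ)) (≐.*-cong (V-⟦⟧ x ρ) (V-⟦⟧ y ρ))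
V-⟦⟧ (:- x)   ρ = ≐.trans (coeffwise (V--ₛ (⟦ x ⟧ ρ))) (≐.-‿cong (V-⟦⟧ x ρ))
V-⟦⟧ (x :^ k) ρ = ≐.trans (V-^ (⟦ x ⟧ ρ) k) (^-congˡ k (V-⟦⟧ x ρ))

dissected-cong : ∀ {A B} → (∀ r → A r ≐ B r) → dissected A ≐ dissected B
dissected-cong {A} {B} eq =
  ≐.+-cong (≐.+-cong (≐.+-cong (≐.+-cong (V-≐ 0F) (p 1 1F)) (p 2 2F)) (p 3 3F)) (p 4 4F)
  where
  V-≐ : ∀ r → V 5 (A r) ≐ V 5 (B r)
  V-≐ r = coeffwise (V-cong {5} (coeff (eq r)))
  p : ∀ k r → q^ k · V 5 (A r) ≐ q^ k · V 5 (B r)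
  p k r = ≐.*-congˡ {q^ k} (V-≐ r)

sum₅ : (q₁ q₂ q₃ q₄ x₀ x₁ x₂ x₃ x₄ : Series) → Series
sum₅ q₁ q₂ q₃ q₄ x₀ x₁ x₂ x₃ x₄ = x₀ +ₛ q₁ · x₁ +ₛ q₂ · x₂ +ₛ q₃ · x₃ +ₛ q₄ · x₄

sum₅-cong : ∀ {q₁ q₂ q₃ q₄ p₁ p₂ p₃ p₄ x₀ x₁ x₂ x₃ x₄ y₀ y₁ y₂ y₃ y₄} →
            q₁ ≐ p₁ → q₂ ≐ p₂ → q₃ ≐ p₃ → q₄ ≐ p₄ → x₀ ≐ y₀ → x₁ ≐ y₁ → x₂ ≐ y₂ → x₃ ≐ y₃ → x₄ ≐ y₄ →
            sum₅ q₁ q₂ q₃ q₄ x₀ x₁ x₂ x₃ x₄ ≐ sum₅ p₁ p₂ p₃ p₄ y₀ y₁ y₂ y₃ y₄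
sum₅-cong e₁ e₂ e₃ e₄ d₀ d₁ d₂ d₃ d₄ =
  ≐.+-cong (≐.+-cong (≐.+-cong (≐.+-cong d₀ (≐.*-cong e₁ d₁)) (≐.*-cong e₂ d₂)) (≐.*-cong e₃ d₃)) (≐.*-cong e₄ d₄)

-- Multiplication with respect to the basis 1, q, ..., q⁴ over the series in q⁵. Indices adding up
-- to 5 or more wrap around, and the carried q⁵ is `V 5 q`, hence a factor `q` on components.
product : (Fin 5 → Series) → (Fin 5 → Series) → Fin 5 → Series
product A B 0F = A 0F · B 0F +ₛ q · (A 1F · B 4F +ₛ A 2F · B 3F +ₛ A 3F · B 2F +ₛ A 4F · B 1F)
product A B 1F = A 0F · B 1F +ₛ A 1F · B 0F +ₛ q · (A 2F · B 4F +ₛ A 3F · B 3F +ₛ A 4F · B 2F)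
product A B 2F = A 0F · B 2F +ₛ A 1F · B 1F +ₛ A 2F · B 0F +ₛ q · (A 3F · B 4F +ₛ A 4F · B 3F)
product A B 3F = A 0F · B 3F +ₛ A 1F · B 2F +ₛ A 2F · B 1F +ₛ A 3F · B 0F +ₛ q · (A 4F · B 4F)
product A B 4F = A 0F · B 4F +ₛ A 1F · B 3F +ₛ A 2F · B 2F +ₛ A 3F · B 1F +ₛ A 4F · B 0F

V-carry : ∀ {n} (x y : Expr ℤ n) ρ → V 5 (⟦ x ⟧ ρ +ₛ q · ⟦ y ⟧ ρ) ≐ ⟦ x ⟧ (Vec.map (V 5) ρ) +ₛ q ^ˢ 5 · ⟦ y ⟧ (Vec.map (V 5) ρ)
V-carry x y ρ = ≐.trans (V-+ (⟦ x ⟧ ρ) (q · ⟦ y ⟧ ρ)) (≐.+-cong (V-⟦⟧ x ρ)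
  (≐.trans (V-* q (⟦ y ⟧ ρ)) (≐.*-cong (≐.trans (coeffwise (V-q^ {5} 1)) (≐.sym (q^ˢ 5))) (V-⟦⟧ y ρ))))

dissected-* : ∀ A B → dissected A · dissected B ≐ dissected (product A B)
dissected-* A B = begin
  dissected A · dissected B
    ≈⟨ ≐.*-cong (to-powers (V 5 (A 0F)) (V 5 (A 1F)) (V 5 (A 2F)) (V 5 (A 3F)) (V 5 (A 4F)))
                (to-powers (V 5 (B 0F)) (V 5 (B 1F)) (V 5 (B 2F)) (V 5 (B 3F)) (V 5 (B 4F))) ⟩
  _ ≈⟨ solve 11 (λ q a₀ a₁ a₂ a₃ a₄ b₀ b₁ b₂ b₃ b₄ →
        (a₀ :+ q :* a₁ :+ q :^ 2 :* a₂ :+ q :^ 3 :* a₃ :+ q :^ 4 :* a₄)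
          :* (b₀ :+ q :* b₁ :+ q :^ 2 :* b₂ :+ q :^ 3 :* b₃ :+ q :^ 4 :* b₄) ,
        (a₀ :* b₀ :+ q :^ 5 :* (a₁ :* b₄ :+ a₂ :* b₃ :+ a₃ :* b₂ :+ a₄ :* b₁))
          :+ q :* (a₀ :* b₁ :+ a₁ :* b₀ :+ q :^ 5 :* (a₂ :* b₄ :+ a₃ :* b₃ :+ a₄ :* b₂))
          :+ q :^ 2 :* (a₀ :* b₂ :+ a₁ :* b₁ :+ a₂ :* b₀ :+ q :^ 5 :* (a₃ :* b₄ :+ a₄ :* b₃))
          :+ q :^ 3 :* (a₀ :* b₃ :+ a₁ :* b₂ :+ a₂ :* b₁ :+ a₃ :* b₀ :+ q :^ 5 :* (a₄ :* b₄))
          :+ q :^ 4 :* (a₀ :* b₄ :+ a₁ :* b₃ :+ a₂ :* b₂ :+ a₃ :* b₁ :+ a₄ :* b₀))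
        refl q (V 5 (A 0F)) (V 5 (A 1F)) (V 5 (A 2F)) (V 5 (A 3F)) (V 5 (A 4F))
               (V 5 (B 0F)) (V 5 (B 1F)) (V 5 (B 2F)) (V 5 (B 3F)) (V 5 (B 4F)) ⟩
  _ ≈⟨ sum₅-cong (≐.refl {q}) (q^ˢ 2) (q^ˢ 3) (q^ˢ 4)
         (≐.sym (V-carry (a₀ :* b₀) (a₁ :* b₄ :+ a₂ :* b₃ :+ a₃ :* b₂ :+ a₄ :* b₁) ρ))
         (≐.sym (V-carry (a₀ :* b₁ :+ a₁ :* b₀) (a₂ :* b₄ :+ a₃ :* b₃ :+ a₄ :* b₂) ρ))
         (≐.sym (V-carry (a₀ :* b₂ :+ a₁ :* b₁ :+ a₂ :* b₀) (a₃ :* b₄ :+ a₄ :* b₃) ρ))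
         (≐.sym (V-carry (a₀ :* b₃ :+ a₁ :* b₂ :+ a₂ :* b₁ :+ a₃ :* b₀) (a₄ :* b₄) ρ))
         (≐.sym (V-⟦⟧ (a₀ :* b₄ :+ a₁ :* b₃ :+ a₂ :* b₂ :+ a₃ :* b₁ :+ a₄ :* b₀) ρ)) ⟩
  dissected (product A B) ∎
  where
  open ≐-Reasoning
  to-powers : ∀ x₀ x₁ x₂ x₃ x₄ → sum₅ (q^ 1) (q^ 2) (q^ 3) (q^ 4) x₀ x₁ x₂ x₃ x₄
                                 ≐ sum₅ q (q ^ˢ 2) (q ^ˢ 3) (q ^ˢ 4) x₀ x₁ x₂ x₃ x₄
  to-powers x₀ x₁ x₂ x₃ x₄ = sum₅-cong (≐.refl {q}) (≐.sym (q^ˢ 2)) (≐.sym (q^ˢ 3)) (≐.sym (q^ˢ 4))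
    (≐.refl {x₀}) (≐.refl {x₁}) (≐.refl {x₂}) (≐.refl {x₃}) (≐.refl {x₄})
  ρ : Vec Series 10
  ρ = A 0F ∷ A 1F ∷ A 2F ∷ A 3F ∷ A 4F ∷ B 0F ∷ B 1F ∷ B 2F ∷ B 3F ∷ B 4F ∷ []
  a₀ a₁ a₂ a₃ a₄ b₀ b₁ b₂ b₃ b₄ : Expr ℤ 10
  a₀ = var 0F
  a₁ = var 1F
  a₂ = var 2F
  a₃ = var 3F
  a₄ = var 4F
  b₀ = var 5F
  b₁ = var 6F
  b₂ = var 7F
  b₃ = var 8F
  b₄ = var 9F

dissected-+ : ∀ A B → dissected A +ₛ dissected B ≐ dissected (λ r → A r +ₛ B r)
dissected-+ A B = begin
  dissected A +ₛ dissected B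
    ≈⟨ solve 14 (λ q₁ q₂ q₃ q₄ a₀ a₁ a₂ a₃ a₄ b₀ b₁ b₂ b₃ b₄ →
         (a₀ :+ q₁ :* a₁ :+ q₂ :* a₂ :+ q₃ :* a₃ :+ q₄ :* a₄) :+ (b₀ :+ q₁ :* b₁ :+ q₂ :* b₂ :+ q₃ :* b₃ :+ q₄ :* b₄) ,
         (a₀ :+ b₀) :+ q₁ :* (a₁ :+ b₁) :+ q₂ :* (a₂ :+ b₂) :+ q₃ :* (a₃ :+ b₃) :+ q₄ :* (a₄ :+ b₄)) refl
         (q^ 1) (q^ 2) (q^ 3) (q^ 4) (V 5 (A 0F)) (V 5 (A 1F)) (V 5 (A 2F)) (V 5 (A 3F)) (V 5 (A 4F))
         (V 5 (B 0F)) (V 5 (B 1F)) (V 5 (B 2F)) (V 5 (B 3F)) (V 5 (B 4F)) ⟩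
  (V 5 (A 0F) +ₛ V 5 (B 0F)) +ₛ q^ 1 · (V 5 (A 1F) +ₛ V 5 (B 1F)) +ₛ q^ 2 · (V 5 (A 2F) +ₛ V 5 (B 2F))
    +ₛ q^ 3 · (V 5 (A 3F) +ₛ V 5 (B 3F)) +ₛ q^ 4 · (V 5 (A 4F) +ₛ V 5 (B 4F))
    ≈⟨ ≐.+-cong (≐.+-cong (≐.+-cong (≐.+-cong (V-+ (A 0F) (B 0F)) (p 1 1F)) (p 2 2F)) (p 3 3F)) (p 4 4F) ⟨
  dissected (λ r → A r +ₛ B r) ∎
  where
  open ≐-Reasoning
  p : ∀ k r → q^ k · V 5 (A r +ₛ B r) ≐ q^ k · (V 5 (A r) +ₛ V 5 (B r))
  p k r = ≐.*-congˡ {q^ k} (V-+ (A r) (B r))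

comps : ∀ {X : Set} → X → X → X → X → X → Fin 5 → X
comps x₀ x₁ x₂ x₃ x₄ 0F = x₀
comps x₀ x₁ x₂ x₃ x₄ 1F = x₁
comps x₀ x₁ x₂ x₃ x₄ 2F = x₂
comps x₀ x₁ x₂ x₃ x₄ 3F = x₃
comps x₀ x₁ x₂ x₃ x₄ 4F = x₄

-- `product` on syntax: evaluation unfolds to `product` itself, so components of products are
-- computed by normalising polynomials.
productₑ : ∀ {n} → Expr ℤ n → (Fin 5 → Expr ℤ n) → (Fin 5 → Expr ℤ n) → Fin 5 → Expr ℤ n
productₑ q A B 0F = A 0F :* B 0F :+ q :* (A 1F :* B 4F :+ A 2F :* B 3F :+ A 3F :* B 2F :+ A 4F :* B 1F)
productₑ q A B 1F = A 0F :* B 1F :+ A 1F :* B 0F :+ q :* (A 2F :* B 4F :+ A 3F :* B 3F :+ A 4F :* B 2F)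
productₑ q A B 2F = A 0F :* B 2F :+ A 1F :* B 1F :+ A 2F :* B 0F :+ q :* (A 3F :* B 4F :+ A 4F :* B 3F)
productₑ q A B 3F = A 0F :* B 3F :+ A 1F :* B 2F :+ A 2F :* B 1F :+ A 3F :* B 0F :+ q :* (A 4F :* B 4F)
productₑ q A B 4F = A 0F :* B 4F :+ A 1F :* B 3F :+ A 2F :* B 2F :+ A 3F :* B 1F :+ A 4F :* B 0F

dissected-product : ∀ A B {x y} → x ≐ dissected A → y ≐ dissected B → x · y ≐ dissected (product A B)
dissected-product A B x≐A y≐B = ≐.trans (≐.*-cong x≐A y≐B) (dissected-* A B)

U-≐ : ∀ k r {x y} → x ≐ y → U k r x ≐ U k r y
U-≐ k r x≐y = coeffwise λ n → coeff x≐y (r ℕ.+ n ℕ.* k)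

component : ∀ A (r : Fin 5) {x} → x ≐ dissected A → U 5 (toℕ r) x ≐ A r
component A r x≐A = ≐.trans (U-≐ 5 (toℕ r) x≐A) (coeffwise (U-dissected A r))

V-dissected : ∀ x → V 5 x ≐ dissected (comps x 0ₛ 0ₛ 0ₛ 0ₛ)
V-dissected x = begin
  V 5 x
    ≈⟨ solve 5 (λ x a b c d → let z = con 0ℤ in x , x :+ a :* z :+ b :* z :+ c :* z :+ d :* z) refl (V 5 x) (q^ 1) (q^ 2) (q^ 3) (q^ 4) ⟩
  sum₅ (q^ 1) (q^ 2) (q^ 3) (q^ 4) (V 5 x) 0ₛ 0ₛ 0ₛ 0ₛ
    ≈⟨ sum₅-cong (≐.refl {q^ 1}) (≐.refl {q^ 2}) (≐.refl {q^ 3}) (≐.refl {q^ 4}) (≐.refl {V 5 x})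
         (≐.sym V-0) (≐.sym V-0) (≐.sym V-0) (≐.sym V-0) ⟩
  dissected (comps x 0ₛ 0ₛ 0ₛ 0ₛ) ∎
  where
  open ≐-Reasoning
  V-0 : V 5 0ₛ ≐ 0ₛ
  V-0 = V-fromℤ 0ℤ

unit-cancel : ∀ u {x y} → u 0 ≡ 1ℤ → u · x ≐ u · y → x ≐ y
unit-cancel u {x} {y} u₀≡1 ux≐uy = begin
  x               ≈⟨ ≐.*-identityˡ x ⟨
  1ₛ · x          ≈⟨ ≐.*-congʳ {x} inverse ⟨
  (u ⁻¹ · u) · x  ≈⟨ ≐.*-assoc (u ⁻¹) u x ⟩
  u ⁻¹ · (u · x)  ≈⟨ ≐.*-congˡ {u ⁻¹} ux≐uy ⟩
  u ⁻¹ · (u · y)  ≈⟨ ≐.*-assoc (u ⁻¹) u y ⟨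
  (u ⁻¹ · u) · y  ≈⟨ ≐.*-congʳ {y} inverse ⟩
  1ₛ · y          ≈⟨ ≐.*-identityˡ y ⟩
  y               ∎
  where
  open ≐-Reasoning
  inverse : u ⁻¹ · u ≐ 1ₛ
  inverse = ≐.trans (≐.*-comm (u ⁻¹) u) (coeffwise (·-inverseʳ u u₀≡1))

const-cancel : ∀ c .{{_ : ℤ.NonZero c}} {x y} → const c · x ≐ const c · y → x ≐ y
const-cancel c {x} {y} cx≐cy = coeffwise λ n → ℤ.*-cancelˡ-≡ c (x n) (y n)
  (trans (sym (const-· c x n)) (trans (coeff cx≐cy n) (const-· c y n)))

q-cancel : ∀ {x y} → q · x ≐ q · y → x ≐ y
q-cancel {x} {y} qx≐qy = coeffwise λ n → trans (sym (q^-·-≥ 1 x n)) (trans (coeff qx≐qy (suc n)) (q^-·-≥ 1 y n))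

-- An identity x = y follows from identities xᵢ = yᵢ once x − y is written as
-- Σ cᵢ (xᵢ − yᵢ).

difference : ∀ {x y} → x ≐ y → x +ₛ -ₛ y ≐ 0ₛ
difference {x} {y} x≐y = ≐.trans (≐.+-congʳ { -ₛ y} x≐y) (≐.-‿inverseʳ y)

no-difference : ∀ {x y} → x +ₛ -ₛ y ≐ 0ₛ → x ≐ y
no-difference {x} {y} d = ≐.trans (solve 2 (λ x y → x , (x :- y) :+ y) refl x y)
  (≐.trans (≐.+-congʳ {y} d) (≐.+-identityˡ y))

vanish : ∀ c {x y} → x ≐ y → c · (x +ₛ -ₛ y) ≐ 0ₛ
vanish c {x} {y} x≐y = ≐.trans (≐.*-congˡ {c} (difference x≐y)) (≐.zeroʳ c)

infixl 6 _⊞_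
_⊞_ : ∀ {x y} → x ≐ 0ₛ → y ≐ 0ₛ → x +ₛ y ≐ 0ₛ
p ⊞ r = ≐.trans (≐.+-cong p r) (≐.+-identityˡ 0ₛ)

combine : ∀ {x y z} → z ≐ 0ₛ → x +ₛ -ₛ y ≐ z → x ≐ y
combine z≐0 d = no-difference (≐.trans d z≐0)

-- The components of f₁, f₂ and Φ, and the relations between them.

-- The signs give all nine series constant term 1. Classically, `α` and `γ` are f₅ divided and
-- multiplied by the Rogers-Ramanujan continued fraction without its factor q^(1/5).
α β γ α′ β′ γ′ a b c : Series
α  = U 5 0 (f 1)
β  = V 5 (f 1)
γ  = -ₛ U 5 2 (f 1)
α′ = V 2 α
β′ = V 5 (f 2)
γ′ = V 2 γ
a  = V 5 Φ
b  = -ₛ U 5 1 τ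
c  = U 5 4 τ

-ₛ-involutive : ∀ x → x ≐ -ₛ -ₛ x
-ₛ-involutive x = solve 1 (λ x → x , :- :- x) refl x

f₁ᶜ f₂ᶜ Φᶜ : Fin 5 → Series
f₁ᶜ = comps α (-ₛ β) (-ₛ γ) 0ₛ 0ₛ
f₂ᶜ = comps α′ 0ₛ (-ₛ β′) 0ₛ (-ₛ γ′)
Φᶜ = comps a (-ₛ (const (+ 2) · b)) 0ₛ 0ₛ (const (+ 2) · c)

f₁-dissected : f 1 ≐ dissected f₁ᶜ
f₁-dissected = ≐.trans (coeffwise (dissect (f 1))) (dissected-cong {λ r → U 5 (toℕ r) (f 1)} {f₁ᶜ}
  λ { 0F → ≐.refl ; 1F → U-f₁-1 ; 2F → -ₛ-involutive (U 5 2 (f 1)) ; 3F → U-f₁-0 3 ; 4F → U-f₁-0 4 })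

f₁-dissection : f 1 ≐ V 5 α +ₛ -ₛ (q · V 5 β) +ₛ -ₛ (q ^ˢ 2 · V 5 γ)
f₁-dissection = begin
  f 1                                                      ≈⟨ f₁-dissected ⟩
  dissected f₁ᶜ
    ≈⟨ sum₅-cong (≐.refl {q}) (≐.sym (q^ˢ 2)) (≐.refl {q^ 3}) (≐.refl {q^ 4}) (≐.refl {V 5 α})
         (coeffwise (V--ₛ β)) (coeffwise (V--ₛ γ)) (V-fromℤ 0ℤ) (V-fromℤ 0ℤ) ⟩
  sum₅ q (q ^ˢ 2) (q^ 3) (q^ 4) (V 5 α) (-ₛ V 5 β) (-ₛ V 5 γ) 0ₛ 0ₛ
    ≈⟨ solve 6 (λ q q₃ q₄ a b c → a :+ q :* (:- b) :+ q :^ 2 :* (:- c) :+ q₃ :* con 0ℤ :+ q₄ :* con 0ℤ ,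
                                  a :- q :* b :- q :^ 2 :* c) refl q (q^ 3) (q^ 4) (V 5 α) (V 5 β) (V 5 γ) ⟩
  V 5 α +ₛ -ₛ (q · V 5 β) +ₛ -ₛ (q ^ˢ 2 · V 5 γ) ∎
  where open ≐-Reasoning

V₂-f₁ : V 2 (f 1) ≐ f 2
V₂-f₁ = coeffwise (f-V 2 1)

V₂-V₅ : ∀ x → V 2 (V 5 x) ≐ V 5 (V 2 x)
V₂-V₅ x = coeffwise λ n → trans (V-V 2 5 x n) (sym (V-V 5 2 x n))

V₂-* : ∀ x y → V 2 (x · y) ≐ V 2 x · V 2 y
V₂-* x y = coeffwise (V-· x y)

V₂-q : V 2 q ≐ q ^ˢ 2
V₂-q = ≐.trans (coeffwise (V-q^ {2} 1)) (≐.sym (q^ˢ 2))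

V₂-β : V 2 β ≐ β′
V₂-β = ≐.trans (V₂-V₅ (f 1)) (coeffwise (V-cong {5} (coeff V₂-f₁)))

-- Under q ↦ q² the classes 0, 1, 2 of `f 1` become 0, 2, 4: there is no carry, so each component
-- just has `V 2` applied to it.
f₂-dissected : f 2 ≐ dissected f₂ᶜ
f₂-dissected = begin
  f 2      ≈⟨ V₂-f₁ ⟨
  V 2 (f 1) ≈⟨ coeffwise (V-cong {2} (coeff f₁-dissection)) ⟩
  V 2 (V 5 α +ₛ -ₛ (q · V 5 β) +ₛ -ₛ (q ^ˢ 2 · V 5 γ))
    ≈⟨ ≐.trans (coeffwise (V-+ₛ (V 5 α +ₛ -ₛ (q · V 5 β)) (-ₛ (q ^ˢ 2 · V 5 γ))))
         (≐.+-cong (≐.trans (coeffwise (V-+ₛ (V 5 α) (-ₛ (q · V 5 β)))) (≐.+-cong (V₂-V₅ α) (≐.trans (coeffwise (V--ₛ (q · V 5 β))) (≐.-‿cong second))))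
                   (≐.trans (coeffwise (V--ₛ (q ^ˢ 2 · V 5 γ))) (≐.-‿cong third))) ⟩
  V 5 α′ +ₛ -ₛ (q ^ˢ 2 · V 5 β′) +ₛ -ₛ (q ^ˢ 4 · V 5 γ′)
    ≈⟨ solve 5 (λ q q₃ a b c → a :- q :^ 2 :* b :- q :^ 4 :* c ,
         a :+ q :* con 0ℤ :+ q :^ 2 :* (:- b) :+ q₃ :* con 0ℤ :+ q :^ 4 :* (:- c)) refl q (q^ 3) (V 5 α′) (V 5 β′) (V 5 γ′) ⟩
  sum₅ q (q ^ˢ 2) (q^ 3) (q ^ˢ 4) (V 5 α′) 0ₛ (-ₛ V 5 β′) 0ₛ (-ₛ V 5 γ′)
    ≈⟨ sum₅-cong (≐.refl {q}) (q^ˢ 2) (≐.refl {q^ 3}) (q^ˢ 4) (≐.refl {V 5 α′}) (≐.sym (V-fromℤ 0ℤ))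
         (≐.sym (coeffwise (V--ₛ β′))) (≐.sym (V-fromℤ 0ℤ)) (≐.sym (coeffwise (V--ₛ γ′))) ⟩
  dissected f₂ᶜ ∎
  where
  open ≐-Reasoning
  second : V 2 (q · V 5 β) ≐ q ^ˢ 2 · V 5 β′
  second = ≐.trans (V₂-* q (V 5 β)) (≐.*-cong V₂-q (≐.trans (V₂-V₅ β) (coeffwise (V-cong {5} (coeff V₂-β)))))
  third : V 2 (q ^ˢ 2 · V 5 γ) ≐ q ^ˢ 4 · V 5 γ′
  third = ≐.trans (V₂-* (q ^ˢ 2) (V 5 γ)) (≐.*-cong (≐.trans (V₂-* q q) (≐.trans (≐.*-cong V₂-q V₂-q)
            (solve 1 (λ q → q :^ 2 :* q :^ 2 , q :^ 4) refl q))) (V₂-V₅ γ))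

a≐ : a ≐ 1ₛ +ₛ const (+ 2) · V 5 τ
a≐ = V-⟦⟧ {1} (con 1ℤ :+ con (+ 2) :* var 0F) (τ ∷ [])

Φ-dissection : Φ ≐ V 5 a +ₛ -ₛ (const (+ 2) · q · V 5 b) +ₛ const (+ 2) · q ^ˢ 4 · V 5 c
Φ-dissection = begin
  1ₛ +ₛ const (+ 2) · τ
    ≈⟨ ≐.+-congˡ {1ₛ} (≐.*-congˡ {const (+ 2)} τ-dissection) ⟩
  1ₛ +ₛ const (+ 2) · (V 5 (V 5 τ) +ₛ q · -ₛ V 5 b +ₛ q^ 2 · 0ₛ +ₛ q^ 3 · 0ₛ +ₛ q ^ˢ 4 · V 5 c)
    ≈⟨ solve 6 (λ q q₂ q₃ t b c → con 1ℤ :+ con (+ 2) :* (t :+ q :* (:- b) :+ q₂ :* con 0ℤ :+ q₃ :* con 0ℤ :+ q :^ 4 :* c) ,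
                                  (con 1ℤ :+ con (+ 2) :* t) :- con (+ 2) :* q :* b :+ con (+ 2) :* q :^ 4 :* c) refl
                                  q (q^ 2) (q^ 3) (V 5 (V 5 τ)) (V 5 b) (V 5 c) ⟩
  (1ₛ +ₛ const (+ 2) · V 5 (V 5 τ)) +ₛ -ₛ (const (+ 2) · q · V 5 b) +ₛ const (+ 2) · q ^ˢ 4 · V 5 c
    ≈⟨ ≐.+-congʳ {const (+ 2) · q ^ˢ 4 · V 5 c} (≐.+-congʳ { -ₛ (const (+ 2) · q · V 5 b)} V₅-a) ⟨
  V 5 a +ₛ -ₛ (const (+ 2) · q · V 5 b) +ₛ const (+ 2) · q ^ˢ 4 · V 5 c ∎
  where
  open ≐-Reasoning
  A : Fin 5 → Series
  A 0F = V 5 τ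
  A 1F = -ₛ b
  A 2F = 0ₛ
  A 3F = 0ₛ
  A 4F = c
  τ-dissection : τ ≐ V 5 (V 5 τ) +ₛ q · -ₛ V 5 b +ₛ q^ 2 · 0ₛ +ₛ q^ 3 · 0ₛ +ₛ q ^ˢ 4 · V 5 c
  τ-dissection = begin
    τ                                      ≈⟨ coeffwise (dissect τ) ⟩
    dissected (λ r → U 5 (toℕ r) τ)
      ≈⟨ dissected-cong {λ r → U 5 (toℕ r) τ} {A} (λ { 0F → U-τ-V ; 1F → -ₛ-involutive (U 5 1 τ) ; 2F → U-τ-0 2 ; 3F → U-τ-0 3 ; 4F → ≐.refl }) ⟩
    dissected A
      ≈⟨ ≐.+-cong (≐.+-cong (≐.+-cong (≐.+-congˡ {V 5 (V 5 τ)} (≐.*-congˡ {q} (coeffwise (V--ₛ b))))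
           (≐.*-congˡ {q^ 2} (V-fromℤ 0ℤ))) (≐.*-congˡ {q^ 3} (V-fromℤ 0ℤ))) (≐.*-congʳ {V 5 c} (≐.sym (q^ˢ 4))) ⟩
    V 5 (V 5 τ) +ₛ q · -ₛ V 5 b +ₛ q^ 2 · 0ₛ +ₛ q^ 3 · 0ₛ +ₛ q ^ˢ 4 · V 5 c ∎
  V₅-a : V 5 a ≐ 1ₛ +ₛ const (+ 2) · V 5 (V 5 τ)
  V₅-a = ≐.trans (coeffwise (V-cong {5} (coeff a≐))) (V-⟦⟧ {1} (con 1ℤ :+ con (+ 2) :* var 0F) (V 5 τ ∷ []))

Φ-dissected : Φ ≐ dissected Φᶜ
Φ-dissected = begin
  Φ ≈⟨ Φ-dissection ⟩
  V 5 a +ₛ -ₛ (const (+ 2) · q · V 5 b) +ₛ const (+ 2) · q ^ˢ 4 · V 5 c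
    ≈⟨ solve 6 (λ q q₂ q₃ a b c → a :- con (+ 2) :* q :* b :+ con (+ 2) :* q :^ 4 :* c ,
         a :+ q :* (:- (con (+ 2) :* b)) :+ q₂ :* con 0ℤ :+ q₃ :* con 0ℤ :+ q :^ 4 :* (con (+ 2) :* c)) refl q (q^ 2) (q^ 3) (V 5 a) (V 5 b) (V 5 c) ⟩
  sum₅ q (q^ 2) (q^ 3) (q ^ˢ 4) (V 5 a) (-ₛ (const (+ 2) · V 5 b)) 0ₛ 0ₛ (const (+ 2) · V 5 c)
    ≈⟨ sum₅-cong (≐.refl {q}) (≐.refl {q^ 2}) (≐.refl {q^ 3}) (q^ˢ 4) (≐.refl {V 5 a})
         (≐.sym (V-⟦⟧ {1} (:- (con (+ 2) :* var 0F)) (b ∷ []))) (≐.sym (V-fromℤ 0ℤ)) (≐.sym (V-fromℤ 0ℤ))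
         (≐.sym (V-⟦⟧ {1} (con (+ 2) :* var 0F) (c ∷ []))) ⟩
  dissected Φᶜ ∎
  where open ≐-Reasoning

β′-0 : β′ 0 ≡ 1ℤ
β′-0 = refl
a-0 : a 0 ≡ 1ℤ
a-0 = Φ-0

gauss-component : ∀ r → product Φᶜ f₂ᶜ r ≐ product f₁ᶜ f₁ᶜ r
gauss-component r = begin
  product Φᶜ f₂ᶜ r     ≈⟨ component (product Φᶜ f₂ᶜ) r (dissected-product Φᶜ f₂ᶜ Φ-dissected f₂-dissected) ⟨
  U 5 (toℕ r) (Φ · f 2)   ≈⟨ U-≐ 5 (toℕ r) gauss ⟩
  U 5 (toℕ r) (f 1 · f 1) ≈⟨ component (product f₁ᶜ f₁ᶜ) r (dissected-product f₁ᶜ f₁ᶜ f₁-dissected f₁-dissected) ⟩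
  product f₁ᶜ f₁ᶜ r    ∎
  where open ≐-Reasoning

private
  f₁ₑ : ∀ {n} (x y z : Expr ℤ n) → Fin 5 → Expr ℤ n
  f₁ₑ x y z = comps x (:- y) (:- z) (con 0ℤ) (con 0ℤ)

f₂ₑ Φₑ : ∀ {n} (x y z : Expr ℤ n) → Fin 5 → Expr ℤ n
f₂ₑ x y z = comps x (con 0ℤ) (:- y) (con 0ℤ) (:- z)
Φₑ x y z = comps x (:- (con (+ 2) :* y)) (con 0ℤ) (con 0ℤ) (con (+ 2) :* z)

-- `E₀` to `E₄` are the five classes of Gauss' identity, freed from the common factors -2 in class 1
-- and 2 in class 3.
E₀ : a · α′ +ₛ const (+ 2) · q · b · γ′ ≐ α · α
E₀ = ≐.trans
  (solve 7 (λ q a b c a′ b′ c′ → a :* a′ :+ con (+ 2) :* q :* b :* c′ , productₑ q (Φₑ a b c) (f₂ₑ a′ b′ c′) 0F) refl q a b c α′ β′ γ′)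
  (≐.trans (gauss-component 0F)
  (solve 4 (λ q x y z → productₑ q (f₁ₑ x y z) (f₁ₑ x y z) 0F , x :* x) refl q α β γ))

E₁ : b · α′ +ₛ q · c · β′ ≐ α · β
E₁ = const-cancel -[1+ 1 ] (≐.trans
  (solve 7 (λ q a b c a′ b′ c′ → con -[1+ 1 ] :* (b :* a′ :+ q :* c :* b′) , productₑ q (Φₑ a b c) (f₂ₑ a′ b′ c′) 1F) refl q a b c α′ β′ γ′)
  (≐.trans (gauss-component 1F)
  (solve 4 (λ q x y z → productₑ q (f₁ₑ x y z) (f₁ₑ x y z) 1F , con -[1+ 1 ] :* (x :* y)) refl q α β γ)))

E₂ : -ₛ (a · β′) ≐ β · β +ₛ -ₛ (const (+ 2) · α · γ)
E₂ = ≐.trans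
  (solve 7 (λ q a b c a′ b′ c′ → :- (a :* b′) , productₑ q (Φₑ a b c) (f₂ₑ a′ b′ c′) 2F) refl q a b c α′ β′ γ′)
  (≐.trans (gauss-component 2F)
  (solve 4 (λ q x y z → productₑ q (f₁ₑ x y z) (f₁ₑ x y z) 2F , y :* y :- con (+ 2) :* x :* z) refl q α β γ))

E₃ : b · β′ +ₛ -ₛ (q · c · γ′) ≐ β · γ
E₃ = const-cancel (+ 2) (≐.trans
  (solve 7 (λ q a b c a′ b′ c′ → con (+ 2) :* (b :* b′ :- q :* c :* c′) , productₑ q (Φₑ a b c) (f₂ₑ a′ b′ c′) 3F) refl q a b c α′ β′ γ′)
  (≐.trans (gauss-component 3F)
  (solve 4 (λ q x y z → productₑ q (f₁ₑ x y z) (f₁ₑ x y z) 3F , con (+ 2) :* (y :* z)) refl q α β γ)))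

E₄ : const (+ 2) · c · α′ +ₛ -ₛ (a · γ′) ≐ γ · γ
E₄ = ≐.trans
  (solve 7 (λ q a b c a′ b′ c′ → con (+ 2) :* c :* a′ :- a :* c′ , productₑ q (Φₑ a b c) (f₂ₑ a′ b′ c′) 4F) refl q a b c α′ β′ γ′)
  (≐.trans (gauss-component 4F)
  (solve 4 (λ q x y z → productₑ q (f₁ₑ x y z) (f₁ₑ x y z) 4F , z :* z) refl q α β γ))

aβ′ : a · β′ ≐ β · β
aβ′ = begin
  V 5 Φ · V 5 (f 2)     ≈⟨ V-* Φ (f 2) ⟨
  V 5 (Φ · f 2)         ≈⟨ coeffwise (V-cong {5} (coeff gauss)) ⟩
  V 5 (f 1 · f 1)       ≈⟨ V-* (f 1) (f 1) ⟩
  V 5 (f 1) · V 5 (f 1) ∎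
  where open ≐-Reasoning

-- `E₂` says `2αγ = β² + aβ′`, and Gauss' identity at q⁵ replaces `aβ′` by `β²`.
αγ : α · γ ≐ β · β
αγ = const-cancel (+ 2) (combine (vanish 1ₛ E₂ ⊞ vanish 1ₛ aβ′)
  (solve 5 (λ a b′ x y z → con (+ 2) :* (x :* z) :- con (+ 2) :* (y :* y) ,
     con 1ℤ :* (:- (a :* b′) :- (y :* y :- con (+ 2) :* x :* z)) :+ con 1ℤ :* (a :* b′ :- y :* y)) refl a β′ α β γ))

α′γ′ : α′ · γ′ ≐ β′ · β′
α′γ′ = begin
  V 2 α · V 2 γ ≈⟨ V₂-* α γ ⟨
  V 2 (α · γ)   ≈⟨ coeffwise (V-cong {2} (coeff αγ)) ⟩
  V 2 (β · β)   ≈⟨ V₂-* β β ⟩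
  V 2 β · V 2 β ≈⟨ ≐.*-cong V₂-β V₂-β ⟩
  β′ · β′       ∎
  where open ≐-Reasoning

-- The product of `E₁` and `E₃` has right side `β² · αγ = β⁴ = a²β′²`. On the left the mixed terms
-- `qbc(β′² − α′γ′)` cancel, leaving a multiple of the unit `β′`.
relation₁ : b ^ˢ 2 · α′ +ₛ -ₛ (q ^ˢ 2 · c ^ˢ 2 · γ′) ≐ a ^ˢ 2 · β′
relation₁ = unit-cancel β′ β′-0 (combine
  (vanish (b · β′ +ₛ -ₛ (q · c · γ′)) E₁ ⊞ vanish (α · β) E₃ ⊞ vanish (q · b · c) α′γ′
    ⊞ vanish (β ^ˢ 2) αγ ⊞ vanish (-ₛ (a · β′ +ₛ β ^ˢ 2)) aβ′)
  (solve 10 (λ q a b c a′ b′ c′ x y z →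
    b′ :* (b :^ 2 :* a′ :- q :^ 2 :* c :^ 2 :* c′) :- b′ :* (a :^ 2 :* b′) ,
    (b :* b′ :- q :* c :* c′) :* ((b :* a′ :+ q :* c :* b′) :- x :* y)
      :+ x :* y :* ((b :* b′ :- q :* c :* c′) :- y :* z)
      :+ q :* b :* c :* (a′ :* c′ :- b′ :* b′)
      :+ y :^ 2 :* (x :* z :- y :* y)
      :+ (:- (a :* b′ :+ y :^ 2)) :* (a :* b′ :- y :* y)) refl q a b c α′ β′ γ′ α β γ))

-- The square of `E₁` and the product of `E₀` with `aβ′ = β²` both compute `α²β²`. Replacing
-- `a²α′β′` by means of `relation₁` and `α′γ′ = β′²` leaves the claim times `2qβ′`.
relation₂ : q · c ^ˢ 2 · β′ +ₛ b · c · α′ ≐ a · b · γ′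
relation₂ = q-cancel (const-cancel (+ 2) (unit-cancel β′ β′-0 (combine
  (vanish (b · α′ +ₛ q · c · β′ +ₛ α · β) E₁ ⊞ vanish (-ₛ β ^ˢ 2) E₀
    ⊞ vanish (-ₛ (a · α′ +ₛ const (+ 2) · q · b · γ′)) aβ′ ⊞ vanish (-ₛ α′) relation₁
    ⊞ vanish (-ₛ (q ^ˢ 2 · c ^ˢ 2)) α′γ′)
  (solve 9 (λ q a b c a′ b′ c′ x y →
    b′ :* (con (+ 2) :* (q :* (q :* c :^ 2 :* b′ :+ b :* c :* a′))) :- b′ :* (con (+ 2) :* (q :* (a :* b :* c′))) ,
    (b :* a′ :+ q :* c :* b′ :+ x :* y) :* ((b :* a′ :+ q :* c :* b′) :- x :* y)
      :+ (:- y :^ 2) :* ((a :* a′ :+ con (+ 2) :* q :* b :* c′) :- x :* x)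
      :+ (:- (a :* a′ :+ con (+ 2) :* q :* b :* c′)) :* (a :* b′ :- y :* y)
      :+ (:- a′) :* ((b :^ 2 :* a′ :- q :^ 2 :* c :^ 2 :* c′) :- a :^ 2 :* b′)
      :+ (:- (q :^ 2 :* c :^ 2)) :* (a′ :* c′ :- b′ :* b′)) refl q a b c α′ β′ γ′ α β))))

-- The counterpart for `β²γ²`, computed as the square of `E₃` and as the product of `E₄` with `aβ′`;
-- `relation₁` times `γ′` removes `a²β′γ′`.
relation₃ : a · c · α′ +ₛ q · b · c · γ′ ≐ b ^ˢ 2 · β′
relation₃ = ≐.sym (const-cancel (+ 2) (unit-cancel β′ β′-0 (combine
  (vanish (b · β′ +ₛ -ₛ (q · c · γ′) +ₛ β · γ) E₃ ⊞ vanish (-ₛ β ^ˢ 2) E₄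
    ⊞ vanish (-ₛ (const (+ 2) · c · α′ +ₛ -ₛ (a · γ′))) aβ′ ⊞ vanish γ′ relation₁ ⊞ vanish (-ₛ b ^ˢ 2) α′γ′)
  (solve 9 (λ q a b c a′ b′ c′ y z →
    b′ :* (con (+ 2) :* (b :^ 2 :* b′)) :- b′ :* (con (+ 2) :* (a :* c :* a′ :+ q :* b :* c :* c′)) ,
    (b :* b′ :- q :* c :* c′ :+ y :* z) :* ((b :* b′ :- q :* c :* c′) :- y :* z)
      :+ (:- y :^ 2) :* ((con (+ 2) :* c :* a′ :- a :* c′) :- z :* z)
      :+ (:- (con (+ 2) :* c :* a′ :- a :* c′)) :* (a :* b′ :- y :* y)
      :+ c′ :* ((b :^ 2 :* a′ :- q :^ 2 :* c :^ 2 :* c′) :- a :^ 2 :* b′)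
      :+ (:- b :^ 2) :* (a′ :* c′ :- b′ :* b′)) refl q a b c α′ β′ γ′ β γ))))

-- The bracket on the left is the second combination of `α′` and `γ′`, besides the one in
-- `relation₁`, that arises in the class 2 computations for powers of Φ and for 1/Φ.
relation₄ : a · (q · α′ · c ^ˢ 3 +ₛ γ′ · b ^ˢ 3) ≐ β′ · b · c · (a ^ˢ 2 +ₛ const (+ 2) · q · b · c)
relation₄ = combine
  (vanish (-ₛ b ^ˢ 2) relation₂ ⊞ vanish (b · c) relation₁ ⊞ vanish (q · c ^ˢ 2) relation₃)
  (solve 7 (λ q a b c a′ b′ c′ →
    a :* (q :* a′ :* c :^ 3 :+ c′ :* b :^ 3) :- b′ :* b :* c :* (a :^ 2 :+ con (+ 2) :* q :* b :* c) ,
    (:- b :^ 2) :* ((q :* c :^ 2 :* b′ :+ b :* c :* a′) :- a :* b :* c′)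
      :+ b :* c :* ((b :^ 2 :* a′ :- q :^ 2 :* c :^ 2 :* c′) :- a :^ 2 :* b′)
      :+ q :* c :^ 2 :* ((a :* c :* a′ :+ q :* b :* c :* c′) :- b :^ 2 :* b′)) refl q a b c α′ β′ γ′)

-- `relation₁` and `relation₂` are linear in `α′`, `β′`, `γ′`. Eliminating `α′` here and `γ′` in
-- `elimination₂` expresses both through `β′` with the common denominator `ab² − q²c³`.
elimination₁ : c · (a ^ˢ 2 +ₛ q · b · c) · β′ ≐ γ′ · (a · b ^ˢ 2 +ₛ -ₛ (q ^ˢ 2 · c ^ˢ 3))
elimination₁ = combine (vanish b relation₂ ⊞ vanish (-ₛ c) relation₁)
  (solve 7 (λ q a b c a′ b′ c′ →
    c :* (a :^ 2 :+ q :* b :* c) :* b′ :- c′ :* (a :* b :^ 2 :- q :^ 2 :* c :^ 3) ,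
    b :* ((q :* c :^ 2 :* b′ :+ b :* c :* a′) :- a :* b :* c′)
      :+ (:- c) :* ((b :^ 2 :* a′ :- q :^ 2 :* c :^ 2 :* c′) :- a :^ 2 :* b′)) refl q a b c α′ β′ γ′)

elimination₂ : α′ · b · (a · b ^ˢ 2 +ₛ -ₛ (q ^ˢ 2 · c ^ˢ 3)) ≐ β′ · (a ^ˢ 3 · b +ₛ q ^ˢ 3 · c ^ˢ 4)
elimination₂ = combine (vanish (a · b) relation₁ ⊞ vanish (-ₛ (q ^ˢ 2 · c ^ˢ 2)) relation₂)
  (solve 7 (λ q a b c a′ b′ c′ →
    a′ :* b :* (a :* b :^ 2 :- q :^ 2 :* c :^ 3) :- b′ :* (a :^ 3 :* b :+ q :^ 3 :* c :^ 4) ,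
    a :* b :* ((b :^ 2 :* a′ :- q :^ 2 :* c :^ 2 :* c′) :- a :^ 2 :* b′)
      :+ (:- (q :^ 2 :* c :^ 2)) :* ((q :* c :^ 2 :* b′ :+ b :* c :* a′) :- a :* b :* c′)) refl q a b c α′ β′ γ′)

-- Inserting both eliminations into `α′γ′ = β′²` gives `bD² = c(a² + qbc)(a³b + q³c⁴)` with
-- `D = ab² − q²c³`, up to a factor `β′²`. The terms `q⁴bc⁶` cancel, and the rest is divisible by
-- `a`.
relation₅ : a · b ^ˢ 5 +ₛ -ₛ (q ^ˢ 3 · a · c ^ˢ 5)
            ≐ a ^ˢ 4 · b · c +ₛ q · a ^ˢ 2 · b ^ˢ 2 · c ^ˢ 2 +ₛ const (+ 2) · q ^ˢ 2 · b ^ˢ 3 · c ^ˢ 3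
relation₅ = unit-cancel a a-0 (unit-cancel β′ β′-0 (unit-cancel β′ β′-0 (combine
  (vanish (-ₛ (b · (a · b ^ˢ 2 +ₛ -ₛ (q ^ˢ 2 · c ^ˢ 3)) ^ˢ 2)) α′γ′
    ⊞ vanish (γ′ · (a · b ^ˢ 2 +ₛ -ₛ (q ^ˢ 2 · c ^ˢ 3))) elimination₂
    ⊞ vanish (-ₛ (β′ · (a ^ˢ 3 · b +ₛ q ^ˢ 3 · c ^ˢ 4))) elimination₁)
  (solve 7 (λ q a b c a′ b′ c′ → let d = a :* b :^ 2 :- q :^ 2 :* c :^ 3 ; n = a :^ 3 :* b :+ q :^ 3 :* c :^ 4 in
    b′ :* (b′ :* (a :* (a :* b :^ 5 :- q :^ 3 :* a :* c :^ 5)))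
      :- b′ :* (b′ :* (a :* (a :^ 4 :* b :* c :+ q :* a :^ 2 :* b :^ 2 :* c :^ 2 :+ con (+ 2) :* q :^ 2 :* b :^ 3 :* c :^ 3))) ,
    (:- (b :* d :^ 2)) :* (a′ :* c′ :- b′ :* b′)
      :+ c′ :* d :* (a′ :* b :* d :- b′ :* n)
      :+ (:- (b′ :* n)) :* (c :* (a :^ 2 :+ q :* b :* c) :* b′ :- c′ :* d)) refl q a b c α′ β′ γ′))))

-- Congruences between series.

module Congruence (m : ℕ) where

  infix 4 _≈_

  -- The quotient is an explicit series, so a congruence reduces to one exact ring identity.
  record _≈_ (x y : Series) : Set where
    constructor by
    field
      quotient : Series
      equality : x ≐ y +ₛ const (+ m) · quotient

  open _≈_ public

  private
    M : Series
    M = const (+ m)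

  exact : ∀ {x y} → x ≐ y → x ≈ y
  exact {x} {y} x≐y = by 0ₛ (≐.trans x≐y (solve 2 (λ y m → y , y :+ m :* con 0ℤ) refl y M))

  ≈-refl : ∀ {x} → x ≈ x
  ≈-refl = exact ≐.refl

  ≈-sym : ∀ {x y} → x ≈ y → y ≈ x
  ≈-sym {x} {y} (by k eq) = by (-ₛ k) (≐.trans (solve 3 (λ y m k → y , (y :+ m :* k) :+ m :* (:- k)) refl y M k)
    (≐.+-congʳ {M · -ₛ k} (≐.sym eq)))

  ≈-trans : ∀ {x y z} → x ≈ y → y ≈ z → x ≈ z
  ≈-trans {x} {y} {z} (by k eq) (by l eq′) = by (l +ₛ k) (≐.trans eq (≐.trans (≐.+-congʳ {M · k} eq′)
    (solve 4 (λ z m k l → z :+ m :* l :+ m :* k , z :+ m :* (l :+ k)) refl z M k l)))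

  setoid : Setoid 0ℓ 0ℓ
  setoid = record { Carrier = Series ; _≈_ = _≈_ ; isEquivalence = record { refl = ≈-refl ; sym = ≈-sym ; trans = ≈-trans } }

  +ₛ-cong : ∀ {x y z w} → x ≈ y → z ≈ w → x +ₛ z ≈ y +ₛ w
  +ₛ-cong {x} {y} {z} {w} (by k eq) (by l eq′) = by (k +ₛ l) (≐.trans (≐.+-cong eq eq′)
    (solve 5 (λ y w m k l → y :+ m :* k :+ (w :+ m :* l) , y :+ w :+ m :* (k :+ l)) refl y w M k l))

  ≈-*-cong : ∀ {x y z w} → x ≈ y → z ≈ w → x · z ≈ y · w
  ≈-*-cong {x} {y} {z} {w} (by k eq) (by l eq′) = by (y · l +ₛ k · w +ₛ M · k · l) (≐.trans (≐.*-cong eq eq′)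
    (solve 5 (λ y w m k l → (y :+ m :* k) :* (w :+ m :* l) , y :* w :+ m :* (y :* l :+ k :* w :+ m :* k :* l)) refl y w M k l))

  ≈-*-congˡ : ∀ x {y z} → y ≈ z → x · y ≈ x · z
  ≈-*-congˡ x = ≈-*-cong (≈-refl {x})

  ≈-*-congʳ : ∀ x {y z} → y ≈ z → y · x ≈ z · x
  ≈-*-congʳ x y≈z = ≈-*-cong y≈z (≈-refl {x})

  ≈--ₛ-cong : ∀ {x y} → x ≈ y → -ₛ x ≈ -ₛ y
  ≈--ₛ-cong {x} {y} (by k eq) = by (-ₛ k) (≐.trans (≐.-‿cong eq)
    (solve 3 (λ y m k → :- (y :+ m :* k) , (:- y) :+ m :* (:- k)) refl y M k))

  ^-cong : ∀ n {x y} → x ≈ y → x ^ˢ n ≈ y ^ˢ n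
  ^-cong 0             x≈y = ≈-refl
  ^-cong 1             x≈y = x≈y
  ^-cong (suc (suc n)) x≈y = ≈-*-cong (^-cong (suc n) x≈y) x≈y

  ≈-U-cong : ∀ k r {x y} → x ≈ y → U k r x ≈ U k r y
  ≈-U-cong k r {x} {y} (by l eq) = by (U k r l) (coeffwise λ n → let d = r ℕ.+ n ℕ.* k in begin
    x d                             ≡⟨ coeff eq d ⟩
    (y +ₛ const (+ m) · l) d        ≡⟨ +ₛ-at y (const (+ m) · l) d ⟩
    y d ℤ.+ (const (+ m) · l) d     ≡⟨ cong (ℤ._+_ (y d)) (trans (const-· (+ m) l d) (sym (const-· (+ m) (U k r l) n))) ⟩
    y d ℤ.+ (const (+ m) · U k r l) n ≡⟨ +ₛ-at (U k r y) (const (+ m) · U k r l) n ⟨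
    (U k r y +ₛ const (+ m) · U k r l) n ∎)
    where open ≡-Reasoning

  cancel : ∀ u {x y} → u 0 ≡ 1ℤ → u · x ≈ u · y → x ≈ y
  cancel u {x} {y} u₀≡1 (by k eq) = by (u ⁻¹ · k) (unit-cancel u u₀≡1 (≐.trans eq (begin
    u · y +ₛ M · k                   ≈⟨ ≐.+-congˡ {u · y} (≐.*-congˡ {M} (≐.trans (≐.sym (≐.*-identityˡ k)) (≐.*-congʳ {k} (≐.sym (coeffwise (·-inverseʳ u u₀≡1)))))) ⟩
    u · y +ₛ M · ((u · u ⁻¹) · k)    ≈⟨ solve 5 (λ u y m v k → u :* y :+ m :* ((u :* v) :* k) , u :* (y :+ m :* (v :* k))) refl u y M (u ⁻¹) k ⟩
    u · (y +ₛ M · (u ⁻¹ · k))        ∎)))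
    where open ≐-Reasoning

  coefficient : ∀ {x y} → x ≈ y → ∀ n → x n ≡ y n [mod m ]
  coefficient {x} {y} (by k eq) n = ℤ.∣⇒∣ᵤ (ℤ.divides (k n) (begin
    x n ℤ.- y n                              ≡⟨ cong (ℤ._- y n) (trans (coeff eq n) (trans (+ₛ-at y (const (+ m) · k) n) (cong (ℤ._+_ (y n)) (const-· (+ m) k n)))) ⟩
    y n ℤ.+ + m ℤ.* k n ℤ.- y n              ≡⟨ rearrange (y n) (+ m) (k n) ⟩
    k n ℤ.* + m                              ∎))
    where
    open ≡-Reasoning
    rearrange : ∀ y m k → y ℤ.+ m ℤ.* k ℤ.- y ≡ k ℤ.* m
    rearrange = ℤ-Solver.solve-∀

  from-coefficients : ∀ {x y} → (∀ n → x n ≡ y n [mod m ]) → x ≈ y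
  from-coefficients {x} {y} eq = by (λ n → ℤ._∣_.quotient (d n)) (coeffwise λ n → begin
    x n                                   ≡⟨ rearrange (x n) (y n) ⟩
    y n ℤ.+ (x n ℤ.- y n)                 ≡⟨ cong (ℤ._+_ (y n)) (trans (ℤ._∣_.equality (d n)) (ℤ.*-comm _ (+ m))) ⟩
    y n ℤ.+ + m ℤ.* ℤ._∣_.quotient (d n)  ≡⟨ cong (ℤ._+_ (y n)) (const-· (+ m) (λ n → ℤ._∣_.quotient (d n)) n) ⟨
    y n ℤ.+ (const (+ m) · (λ n → ℤ._∣_.quotient (d n))) n ≡⟨ +ₛ-at y (const (+ m) · (λ n → ℤ._∣_.quotient (d n))) n ⟨
    (y +ₛ const (+ m) · (λ n → ℤ._∣_.quotient (d n))) n ∎)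
    where
    open ≡-Reasoning
    rearrange : ∀ x y → x ≡ y ℤ.+ (x ℤ.- y)
    rearrange = ℤ-Solver.solve-∀
    d : ∀ n → (+ m) ℤ.∣ x n ℤ.- y n
    d n = ℤ.∣ᵤ⇒∣ (eq n)

  module ≈-Reasoning′ = ≈-Reasoning setoid

-- The generating function F, and class 2 of f₂Φ² and f₂Φ⁴.

F : Series
F = (f 2 · f 2) · (f 1 · f 1) ⁻¹

FΦ : F · Φ ≐ f 2
FΦ = unit-cancel (f 2) refl (begin
  f 2 · (F · Φ)                                          ≈⟨ solve 3 (λ h u p → h :* (u :* p) , u :* (p :* h)) refl (f 2) F Φ ⟩
  F · (Φ · f 2)                                          ≈⟨ ≐.*-congˡ {F} gauss ⟩
  (f 2 · f 2) · (f 1 · f 1) ⁻¹ · (f 1 · f 1)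
    ≈⟨ solve 3 (λ h v g → h :* h :* v :* g , h :* h :* (g :* v)) refl (f 2) ((f 1 · f 1) ⁻¹) (f 1 · f 1) ⟩
  (f 2 · f 2) · ((f 1 · f 1) · (f 1 · f 1) ⁻¹)           ≈⟨ ≐.*-congˡ {f 2 · f 2} (coeffwise (·-inverseʳ (f 1 · f 1) (·-0 {f 1} {f 1} refl refl))) ⟩
  (f 2 · f 2) · 1ₛ                                       ≈⟨ ≐.*-identityʳ (f 2 · f 2) ⟩
  f 2 · f 2                                              ∎)
  where open ≐-Reasoning

𝓔𝓞ᵤ-V : 𝓔𝓞ᵤ ≐ V 2 F
𝓔𝓞ᵤ-V = ≐.trans 𝓔𝓞ᵤ-sealed (unit-cancel (f 2 · f 2) (·-0 {f 2} {f 2} refl refl) (begin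
  (f 2 · f 2) · ((f 4 · f 4) · (f 2 · f 2) ⁻¹)
    ≈⟨ solve 3 (λ h k v → (h :* h) :* ((k :* k) :* v) , (k :* k) :* ((h :* h) :* v)) refl (f 2) (f 4) ((f 2 · f 2) ⁻¹) ⟩
  (f 4 · f 4) · ((f 2 · f 2) · (f 2 · f 2) ⁻¹)
    ≈⟨ ≐.*-congˡ {f 4 · f 4} (coeffwise (·-inverseʳ (f 2 · f 2) (·-0 {f 2} {f 2} refl refl))) ⟩
  (f 4 · f 4) · 1ₛ              ≈⟨ ≐.*-identityʳ (f 4 · f 4) ⟩
  f 4 · f 4                     ≈⟨ ≐.*-cong (coeffwise (f-V 2 2)) (coeffwise (f-V 2 2)) ⟨
  V 2 (f 2) · V 2 (f 2)         ≈⟨ V₂-* (f 2) (f 2) ⟨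
  V 2 (f 2 · f 2)               ≈⟨ coeffwise (V-cong {2} (coeff Ff₁²)) ⟨
  V 2 (f 1 · f 1 · F)           ≈⟨ V₂-* (f 1 · f 1) F ⟩
  V 2 (f 1 · f 1) · V 2 F       ≈⟨ ≐.*-congʳ {V 2 F} (≐.trans (V₂-* (f 1) (f 1)) (≐.*-cong V₂-f₁ V₂-f₁)) ⟩
  (f 2 · f 2) · V 2 F           ∎))
  where
  open ≐-Reasoning
  Ff₁² : f 1 · f 1 · F ≐ f 2 · f 2
  Ff₁² = begin
    f 1 · f 1 · F               ≈⟨ ≐.*-congʳ {F} gauss ⟨
    Φ · f 2 · F                 ≈⟨ solve 3 (λ p h u → p :* h :* u , (u :* p) :* h) refl Φ (f 2) F ⟩
    F · Φ · f 2                 ≈⟨ ≐.*-congʳ {f 2} FΦ ⟩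
    f 2 · f 2                   ∎

U-V-* : ∀ (r : Fin 5) x y → U 5 (toℕ r) (V 5 x · y) ≐ x · U 5 (toℕ r) y
U-V-* r x y = coeffwise (U-V-· x y (Fin.toℕ<n r))

Φ²ᶜ : Fin 5 → Series
Φ²ᶜ = comps (a ^ˢ 2 +ₛ -ₛ (const (+ 8) · q · b · c)) (-ₛ (const (+ 4) · a · b)) (const (+ 4) · b ^ˢ 2)
            (const (+ 4) · q · c ^ˢ 2) (const (+ 4) · a · c)

Φ²ₑ : ∀ {n} (q a b c : Expr ℤ n) → Fin 5 → Expr ℤ n
Φ²ₑ q a b c = comps (a :^ 2 :- con (+ 8) :* q :* b :* c) (:- (con (+ 4) :* a :* b)) (con (+ 4) :* b :^ 2)
                    (con (+ 4) :* q :* c :^ 2) (con (+ 4) :* a :* c)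

Φ²-dissected : Φ ^ˢ 2 ≐ dissected Φ²ᶜ
Φ²-dissected = ≐.trans (dissected-product Φᶜ Φᶜ Φ-dissected Φ-dissected) (dissected-cong {product Φᶜ Φᶜ} {Φ²ᶜ} λ
  { 0F → solve 4 (λ q a b c → productₑ q (Φₑ a b c) (Φₑ a b c) 0F , Φ²ₑ q a b c 0F) refl q a b c
  ; 1F → solve 4 (λ q a b c → productₑ q (Φₑ a b c) (Φₑ a b c) 1F , Φ²ₑ q a b c 1F) refl q a b c
  ; 2F → solve 4 (λ q a b c → productₑ q (Φₑ a b c) (Φₑ a b c) 2F , Φ²ₑ q a b c 2F) refl q a b c
  ; 3F → solve 4 (λ q a b c → productₑ q (Φₑ a b c) (Φₑ a b c) 3F , Φ²ₑ q a b c 3F) refl q a b c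
  ; 4F → solve 4 (λ q a b c → productₑ q (Φₑ a b c) (Φₑ a b c) 4F , Φ²ₑ q a b c 4F) refl q a b c
  })

U₀-Φ³ : U 5 0 (Φ ^ˢ 3) ≐ a ^ˢ 3 +ₛ -ₛ (const (+ 24) · q · a · b · c)
U₀-Φ³ = ≐.trans (component (product Φ²ᶜ Φᶜ) 0F (dissected-product Φ²ᶜ Φᶜ Φ²-dissected Φ-dissected))
  (solve 4 (λ q a b c → productₑ q (Φ²ₑ q a b c) (Φₑ a b c) 0F , a :^ 3 :- con (+ 24) :* q :* a :* b :* c) refl q a b c)

private
  R₁ R₄ : ∀ {n} (q a b c a′ b′ c′ : Expr ℤ n) → Expr ℤ n
  R₁ q a b c a′ b′ c′ = (b :^ 2 :* a′ :- q :^ 2 :* c :^ 2 :* c′) :- a :^ 2 :* b′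
  R₄ q a b c a′ b′ c′ = a :* (q :* a′ :* c :^ 3 :+ c′ :* b :^ 3) :- b′ :* b :* c :* (a :^ 2 :+ con (+ 2) :* q :* b :* c)

-- `α′` and `γ′` enter only through four times the left side of `relation₁`; together with `−a²β′`
-- this makes the coefficient 3 of `a²`.
U₂-f₂Φ² : U 5 2 (f 2 · Φ ^ˢ 2) ≐ β′ · (const (+ 3) · a ^ˢ 2 +ₛ const (+ 8) · q · b · c)
U₂-f₂Φ² = ≐.trans (component (product f₂ᶜ Φ²ᶜ) 2F (dissected-product f₂ᶜ Φ²ᶜ f₂-dissected Φ²-dissected))
  (combine (vanish (const (+ 4)) relation₁)
    (solve 7 (λ q a b c a′ b′ c′ →
      productₑ q (f₂ₑ a′ b′ c′) (Φ²ₑ q a b c) 2F :- b′ :* (con (+ 3) :* a :^ 2 :+ con (+ 8) :* q :* b :* c) ,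
      con (+ 4) :* R₁ q a b c a′ b′ c′) refl q a b c α′ β′ γ′))

-- Multiplying by Φ² twice keeps the polynomials small. `α′` and `γ′` now enter through the left
-- sides of both `relation₁` and `relation₄`.
U₂-f₂Φ⁴ : U 5 2 (f 2 · Φ ^ˢ 4)
          ≐ β′ · (const (+ 23) · a ^ˢ 4 +ₛ const (+ 16) · q · a ^ˢ 2 · b · c +ₛ -ₛ (const (+ 32) · q ^ˢ 2 · b ^ˢ 2 · c ^ˢ 2))
U₂-f₂Φ⁴ = ≐.trans (U-≐ 5 2 (solve 2 (λ h p → h :* p :^ 4 , (h :* p :^ 2) :* p :^ 2) refl (f 2) Φ))
  (≐.trans (component (product (product f₂ᶜ Φ²ᶜ) Φ²ᶜ) 2F
    (dissected-product (product f₂ᶜ Φ²ᶜ) Φ²ᶜ (dissected-product f₂ᶜ Φ²ᶜ f₂-dissected Φ²-dissected) Φ²-dissected))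
  (combine
    (vanish (const (+ 24) · a ^ˢ 2 +ₛ -ₛ (const (+ 64) · q · b · c)) relation₁ ⊞ vanish (const (+ 32) · q) relation₄)
    (solve 7 (λ q a b c a′ b′ c′ →
      productₑ q (productₑ q (f₂ₑ a′ b′ c′) (Φ²ₑ q a b c)) (Φ²ₑ q a b c) 2F
        :- b′ :* (con (+ 23) :* a :^ 4 :+ con (+ 16) :* q :* a :^ 2 :* b :* c :- con (+ 32) :* q :^ 2 :* b :^ 2 :* c :^ 2) ,
      (con (+ 24) :* a :^ 2 :- con (+ 64) :* q :* b :* c) :* R₁ q a b c a′ b′ c′ :+ con (+ 32) :* q :* R₄ q a b c a′ b′ c′)
      refl q a b c α′ β′ γ′)))

^-0 : ∀ k {x} → x 0 ≡ 1ℤ → (x ^ˢ k) 0 ≡ 1ℤ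
^-0 0             x₀ = refl
^-0 1             x₀ = x₀
^-0 (suc (suc k)) x₀ = ·-0 (^-0 (suc k) x₀) x₀

a²+qbc-0 : (a ^ˢ 2 +ₛ q · b · c) 0 ≡ 1ℤ
a²+qbc-0 = trans (+ₛ-at (a ^ˢ 2) (q · b · c) 0) (cong₂ ℤ._+_ (^-0 2 a-0)
  (trans (coeff (≐.*-assoc q b c) 0) (q^-·-< {1} (b · c) ℕ.z<s)))

-- Modulo 5

module Mod5 where

  open Congruence 5

  frobenius : ∀ x → x ^ˢ 5 ≈ V 5 x
  frobenius x = from-coefficients λ n → ℤ.∣⇒∣ᵤ (go x n)
    where
    -- x = x₀ + q x̂ gives x⁵ ≡ x₀ + q⁵ x̂⁵, which is how V 5 x arises from V 5 x̂.
    remainder : Series → Series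
    remainder x = let y = const (x 0) ; z = q · tail x in
      y ^ˢ 4 · z +ₛ const (+ 2) · y ^ˢ 3 · z ^ˢ 2 +ₛ const (+ 2) · y ^ˢ 2 · z ^ˢ 3 +ₛ y · z ^ˢ 4
    const-^ : ∀ x k → const x ^ˢ k ≐ const (x ℤ.^ k)
    const-^ x 0             = coeffwise 1ₛ≗const
    const-^ x 1             = ≐.reflexive (cong const (sym (ℤ.*-identityʳ x)))
    const-^ x (suc (suc k)) = ≐.trans (≐.*-congʳ {const x} (const-^ x (suc k))) (≐.trans (≐.sym const-*)
        (≐.reflexive (cong const (ℤ.*-comm (x ℤ.^ suc k) x))))
      where
      const-* : const (x ℤ.^ suc k ℤ.* x) ≐ const (x ℤ.^ suc k) · const x
      const-* = ≐.trans (≐.sym (coeffwise (fromℤ≗const _))) (≐.trans (fromℤ-· (x ℤ.^ suc k) x)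
        (≐.*-cong (coeffwise (fromℤ≗const (x ℤ.^ suc k))) (coeffwise (fromℤ≗const x))))
    expand : ∀ x → x ^ˢ 5 ≐ const (x 0 ℤ.^ 5) +ₛ q^ 5 · tail x ^ˢ 5 +ₛ const (+ 5) · remainder x
    expand x = begin
      x ^ˢ 5
        ≈⟨ ^-congˡ 5 (head-tail x) ⟩
      (const (x 0) +ₛ q · tail x) ^ˢ 5
        ≈⟨ solve 3 (λ y q t → let z = q :* t in (y :+ z) :^ 5 ,
             y :^ 5 :+ q :^ 5 :* t :^ 5 :+ con (+ 5) :* (y :^ 4 :* z :+ con (+ 2) :* y :^ 3 :* z :^ 2 :+ con (+ 2) :* y :^ 2 :* z :^ 3 :+ y :* z :^ 4))
             refl (const (x 0)) q (tail x) ⟩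
      const (x 0) ^ˢ 5 +ₛ q ^ˢ 5 · tail x ^ˢ 5 +ₛ const (+ 5) · remainder x
        ≈⟨ ≐.+-congʳ {const (+ 5) · remainder x} (≐.+-cong (const-^ (x 0) 5) (≐.*-congʳ {tail x ^ˢ 5} (q^ˢ 5))) ⟩
      const (x 0 ℤ.^ 5) +ₛ q^ 5 · tail x ^ˢ 5 +ₛ const (+ 5) · remainder x ∎
      where open ≐-Reasoning
    difference-at : ∀ x n → (x ^ˢ 5) n ℤ.- V 5 x n ≡
      (const (x 0 ℤ.^ 5) n ℤ.- const (x 0) n) ℤ.+ ((q^ 5 · tail x ^ˢ 5) n ℤ.- (q^ 5 · V 5 (tail x)) n) ℤ.+ remainder x n ℤ.* + 5
    difference-at x n = trans (cong₂ ℤ._-_ (trans (coeff (expand x) n)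
        (trans (+ₛ-at _ (const (+ 5) · remainder x) n) (cong₂ ℤ._+_ (+ₛ-at (const (x 0 ℤ.^ 5)) (q^ 5 · tail x ^ˢ 5) n) (const-· (+ 5) (remainder x) n))))
        (trans (coeff (V-step-sealed x) n) (+ₛ-at (const (x 0)) (q^ 5 · V 5 (tail x)) n)))
      (rearrange (const (x 0 ℤ.^ 5) n) ((q^ 5 · tail x ^ˢ 5) n) (remainder x n) (const (x 0) n) ((q^ 5 · V 5 (tail x)) n))
      where
      rearrange : ∀ a b c d e → (a ℤ.+ b ℤ.+ + 5 ℤ.* c) ℤ.- (d ℤ.+ e) ≡ (a ℤ.- d) ℤ.+ (b ℤ.- e) ℤ.+ c ℤ.* + 5
      rearrange = ℤ-Solver.solve-∀
    constant-part : ∀ x n → (+ 5) ℤ.∣ const (x 0 ℤ.^ 5) n ℤ.- const (x 0) n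
    constant-part x zero    = fermat (x 0)
    constant-part x (suc n) = ℤ.divides 0ℤ refl
    go : ∀ x n → (+ 5) ℤ.∣ (x ^ˢ 5) n ℤ.- V 5 x n
    shifted : ∀ x n → (+ 5) ℤ.∣ (q^ 5 · tail x ^ˢ 5) n ℤ.- (q^ 5 · V 5 (tail x)) n
    go x n = subst ((+ 5) ℤ.∣_) (sym (difference-at x n))
      (ℤ.∣m∣n⇒∣m+n (ℤ.∣m∣n⇒∣m+n (constant-part x n) (shifted x n)) (ℤ.divides (remainder x n) refl))
    low : ∀ x {n} → n ℕ.< 5 → (+ 5) ℤ.∣ (q^ 5 · tail x ^ˢ 5) n ℤ.- (q^ 5 · V 5 (tail x)) n
    low x n<5 = subst ((+ 5) ℤ.∣_) (sym (cong₂ ℤ._-_ (q^-·-< (tail x ^ˢ 5) n<5) (q^-·-< (V 5 (tail x)) n<5))) (ℤ.divides 0ℤ refl)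
    shifted x 0 = low x (r<5 0)
    shifted x 1 = low x (r<5 1)
    shifted x 2 = low x (r<5 2)
    shifted x 3 = low x (r<5 3)
    shifted x 4 = low x (r<5 4)
    shifted x (suc (suc (suc (suc (suc n))))) =
      subst ((+ 5) ℤ.∣_) (sym (cong₂ ℤ._-_ (q^-·-≥ 5 (tail x ^ˢ 5) n) (q^-·-≥ 5 (V 5 (tail x)) n))) (go (tail x) n)

  -- `x³ − y³` has the factor `x² + xy + y²` with constant term 3, which is no unit over ℤ. Since 2
  -- · 3 = 1 + 5, the series `v` is congruent to twice that factor and has constant term exactly 1.
  cube-root : ∀ {x y} → x 0 ≡ 1ℤ → y 0 ≡ 1ℤ → x ^ˢ 3 ≈ y ^ˢ 3 → x ≈ y
  cube-root {x} {y} x₀ y₀ (by k eq) = cancel v v₀ (by (const (+ 2) · k +ₛ -ₛ (x +ₛ -ₛ y)) (combine (vanish (const (+ 2)) eq)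
    (solve 3 (λ x y k → let v = con (+ 2) :* (x :^ 2 :+ x :* y :+ y :^ 2) :- con (+ 5) in
       v :* x :- (v :* y :+ con (+ 5) :* (con (+ 2) :* k :- (x :- y))) ,
       con (+ 2) :* (x :^ 3 :- (y :^ 3 :+ con (+ 5) :* k))) refl x y k)))
    where
    v : Series
    v = const (+ 2) · (x ^ˢ 2 +ₛ x · y +ₛ y ^ˢ 2) +ₛ -ₛ const (+ 5)
    opaque
      unfolding _·_ _+ₛ_ -ₛ_
      v₀ : v 0 ≡ 1ℤ
      v₀ = cong₂ (λ x₀ y₀ → + 2 ℤ.* ((x₀ ℤ.* x₀ ℤ.+ 0ℤ) ℤ.+ (x₀ ℤ.* y₀ ℤ.+ 0ℤ) ℤ.+ (y₀ ℤ.* y₀ ℤ.+ 0ℤ)) ℤ.+ 0ℤ ℤ.+ -[1+ 4 ]) x₀ y₀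

  open ≈-Reasoning′

  -- Frobenius is used in both directions: `Φ ^ˢ 5` becomes `a`, while in the dissection of the
  -- remaining Φ the series `V 5 a`, `V 5 b`, `V 5 c` become fifth powers, to which `relation₅`
  -- applies.
  Φ²-≈ : Φ ^ˢ 2 ≈ a ^ˢ 2 +ₛ q · b · c
  Φ²-≈ = cube-root (^-0 2 Φ-0) a²+qbc-0 (begin
    (Φ ^ˢ 2) ^ˢ 3                ≈⟨ exact (solve 1 (λ p → (p :^ 2) :^ 3 , p :^ 5 :* p) refl Φ) ⟩
    Φ ^ˢ 5 · Φ                   ≈⟨ ≈-*-cong (frobenius Φ) (exact Φ-dissection) ⟩
    a · (V 5 a +ₛ -ₛ (const (+ 2) · q · V 5 b) +ₛ const (+ 2) · q ^ˢ 4 · V 5 c)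
      ≈⟨ ≈-*-congˡ a (+ₛ-cong (+ₛ-cong (frobenius a) (≈--ₛ-cong (≈-*-congˡ (const (+ 2) · q) (frobenius b))))
           (≈-*-congˡ (const (+ 2) · q ^ˢ 4) (frobenius c))) ⟨
    a · (a ^ˢ 5 +ₛ -ₛ (const (+ 2) · q · b ^ˢ 5) +ₛ const (+ 2) · q ^ˢ 4 · c ^ˢ 5)
      -- `−2q` times `relation₅` yields the coefficients -2, -2, -4, which are 3, 3, 1 modulo 5: the
      -- binomial coefficients of the cube.
      ≈⟨ by (-ₛ (q · a ^ˢ 4 · b · c +ₛ q ^ˢ 2 · a ^ˢ 2 · b ^ˢ 2 · c ^ˢ 2 +ₛ q ^ˢ 3 · b ^ˢ 3 · c ^ˢ 3))
           (combine (vanish (-ₛ (const (+ 2) · q)) relation₅) (solve 4 (λ q a b c →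
             a :* (a :^ 5 :- con (+ 2) :* q :* b :^ 5 :+ con (+ 2) :* q :^ 4 :* c :^ 5)
               :- ((a :^ 2 :+ q :* b :* c) :^ 3 :+ con (+ 5) :* (:- (q :* a :^ 4 :* b :* c :+ q :^ 2 :* a :^ 2 :* b :^ 2 :* c :^ 2 :+ q :^ 3 :* b :^ 3 :* c :^ 3))) ,
             (:- (con (+ 2) :* q)) :* ((a :* b :^ 5 :- q :^ 3 :* a :* c :^ 5)
               :- (a :^ 4 :* b :* c :+ q :* a :^ 2 :* b :^ 2 :* c :^ 2 :+ con (+ 2) :* q :^ 2 :* b :^ 3 :* c :^ 3))) refl q a b c)) ⟩
    (a ^ˢ 2 +ₛ q · b · c) ^ˢ 3    ∎)

  g : Series
  g = U 5 2 F

  -- A factor Φ outside `U 5 2` is `V 5 Φ ≡ Φ⁵` inside, and `Φ⁵ F = f₂ Φ⁴` is free of denominators.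
  g-≈ : g ≈ const (+ 3) · β′ · Φ ^ˢ 3
  g-≈ = cancel Φ Φ-0 (begin
    Φ · g                        ≈⟨ exact (U-V-* 2F Φ F) ⟨
    U 5 2 (V 5 Φ · F)            ≈⟨ U-cong′ (≈-*-congʳ F (frobenius Φ)) ⟨
    U 5 2 (Φ ^ˢ 5 · F)           ≈⟨ exact (U-≐ 5 2 (≐.trans (solve 2 (λ p u → p :^ 5 :* u , (u :* p) :* p :^ 4) refl Φ F) (≐.*-congʳ {Φ ^ˢ 4} FΦ))) ⟩
    U 5 2 (f 2 · Φ ^ˢ 4)         ≈⟨ exact U₂-f₂Φ⁴ ⟩
    β′ · (const (+ 23) · a ^ˢ 4 +ₛ const (+ 16) · q · a ^ˢ 2 · b · c +ₛ -ₛ (const (+ 32) · q ^ˢ 2 · b ^ˢ 2 · c ^ˢ 2))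
      -- The coefficients 23, 16, -32 are 3, 6, 3 modulo 5, three times those of a square.
      ≈⟨ by (β′ · (const (+ 4) · a ^ˢ 4 +ₛ const (+ 2) · q · a ^ˢ 2 · b · c +ₛ -ₛ (const (+ 7) · q ^ˢ 2 · b ^ˢ 2 · c ^ˢ 2)))
           (solve 5 (λ q a b c h → h :* (con (+ 23) :* a :^ 4 :+ con (+ 16) :* q :* a :^ 2 :* b :* c :- con (+ 32) :* q :^ 2 :* b :^ 2 :* c :^ 2) ,
             con (+ 3) :* h :* (a :^ 2 :+ q :* b :* c) :^ 2
               :+ con (+ 5) :* (h :* (con (+ 4) :* a :^ 4 :+ con (+ 2) :* q :* a :^ 2 :* b :* c :- con (+ 7) :* q :^ 2 :* b :^ 2 :* c :^ 2))) refl q a b c β′) ⟩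
    const (+ 3) · β′ · (a ^ˢ 2 +ₛ q · b · c) ^ˢ 2
      ≈⟨ ≈-*-congˡ (const (+ 3) · β′) (^-cong 2 Φ²-≈) ⟨
    const (+ 3) · β′ · (Φ ^ˢ 2) ^ˢ 2
      ≈⟨ exact (solve 2 (λ h p → con (+ 3) :* h :* (p :^ 2) :^ 2 , p :* (con (+ 3) :* h :* p :^ 3)) refl β′ Φ) ⟩
    Φ · (const (+ 3) · β′ · Φ ^ˢ 3) ∎)
    where
    U-cong′ : ∀ {x y} → x ≈ y → U 5 2 x ≈ U 5 2 y
    U-cong′ = ≈-U-cong 5 2

  U₀-g : U 5 0 g ≈ const (+ 3) · f 2 · (a · Φ ^ˢ 2)
  U₀-g = begin
    U 5 0 g                                         ≈⟨ ≈-U-cong 5 0 g-≈ ⟩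
    U 5 0 (const (+ 3) · V 5 (f 2) · Φ ^ˢ 3)
      ≈⟨ exact (U-≐ 5 0 (≐.*-congʳ {Φ ^ˢ 3} (V-⟦⟧ {1} (con (+ 3) :* var 0F) (f 2 ∷ [])))) ⟨
    U 5 0 (V 5 (const (+ 3) · f 2) · Φ ^ˢ 3)        ≈⟨ exact (U-V-* 0F (const (+ 3) · f 2) (Φ ^ˢ 3)) ⟩
    const (+ 3) · f 2 · U 5 0 (Φ ^ˢ 3)              ≈⟨ ≈-*-congˡ (const (+ 3) · f 2) (begin
      U 5 0 (Φ ^ˢ 3)                                  ≈⟨ exact U₀-Φ³ ⟩
      a ^ˢ 3 +ₛ -ₛ (const (+ 24) · q · a · b · c)
        -- -24 = 1 - 25, so that `a² + qbc` appears and Φ² can return.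
        ≈⟨ by (-ₛ (const (+ 5) · q · a · b · c)) (solve 4 (λ q a b c → a :^ 3 :- con (+ 24) :* q :* a :* b :* c ,
             a :* (a :^ 2 :+ q :* b :* c) :+ con (+ 5) :* (:- (con (+ 5) :* q :* a :* b :* c))) refl q a b c) ⟩
      a · (a ^ˢ 2 +ₛ q · b · c)                        ≈⟨ ≈-*-congˡ a Φ²-≈ ⟨
      a · Φ ^ˢ 2                                      ∎) ⟩
    const (+ 3) · f 2 · (a · Φ ^ˢ 2)                ∎

  -- The factor `a = V 5 Φ` leaves `U 5 2` as Φ, and class 2 of `f₂Φ²` is again a multiple of
  -- `a² + qbc`, because 8 ≡ 3. So Φ³ is restored; of the two factors 3, one belongs to `g` and the
  -- other is the eigenvalue.
  g-eigen : U 5 2 (U 5 0 g) ≈ const (+ 3) · g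
  g-eigen = begin
    U 5 2 (U 5 0 g)                                 ≈⟨ ≈-U-cong 5 2 U₀-g ⟩
    U 5 2 (const (+ 3) · f 2 · (V 5 Φ · Φ ^ˢ 2))
      ≈⟨ exact (U-≐ 5 2 (≐.trans (solve 3 (λ h v p → con (+ 3) :* h :* (v :* p :^ 2) , con (+ 3) :* v :* (h :* p :^ 2)) refl (f 2) (V 5 Φ) Φ)
           (≐.*-congʳ {f 2 · Φ ^ˢ 2} (≐.sym (V-⟦⟧ {1} (con (+ 3) :* var 0F) (Φ ∷ [])))))) ⟩
    U 5 2 (V 5 (const (+ 3) · Φ) · (f 2 · Φ ^ˢ 2))  ≈⟨ exact (U-V-* 2F (const (+ 3) · Φ) (f 2 · Φ ^ˢ 2)) ⟩
    const (+ 3) · Φ · U 5 2 (f 2 · Φ ^ˢ 2)          ≈⟨ ≈-*-congˡ (const (+ 3) · Φ) (begin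
      U 5 2 (f 2 · Φ ^ˢ 2)                            ≈⟨ exact U₂-f₂Φ² ⟩
      β′ · (const (+ 3) · a ^ˢ 2 +ₛ const (+ 8) · q · b · c)
        ≈⟨ by (β′ · q · b · c) (solve 5 (λ q a b c h → h :* (con (+ 3) :* a :^ 2 :+ con (+ 8) :* q :* b :* c) ,
             con (+ 3) :* h :* (a :^ 2 :+ q :* b :* c) :+ con (+ 5) :* (h :* q :* b :* c)) refl q a b c β′) ⟩
      const (+ 3) · β′ · (a ^ˢ 2 +ₛ q · b · c)         ≈⟨ ≈-*-congˡ (const (+ 3) · β′) Φ²-≈ ⟨
      const (+ 3) · β′ · Φ ^ˢ 2                       ∎) ⟩
    const (+ 3) · Φ · (const (+ 3) · β′ · Φ ^ˢ 2)
      ≈⟨ exact (solve 2 (λ h p → con (+ 3) :* p :* (con (+ 3) :* h :* p :^ 2) , con (+ 3) :* (con (+ 3) :* h :* p :^ 3)) refl β′ Φ) ⟩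
    const (+ 3) · (const (+ 3) · β′ · Φ ^ˢ 3)       ≈⟨ ≈-*-congˡ (const (+ 3)) g-≈ ⟨
    const (+ 3) · g                                 ∎

-- Modulo 16

module Mod16 where

  -- The components of a³ + 2ua² + 4u²a + 8u³, where Φ = a − 2u; its product with Φ
  -- is a⁴ − 16u⁴.
  Wᶜ Eᶜ : Fin 5 → Series
  Wᶜ = comps
    (a ^ˢ 3 +ₛ -ₛ (const (+ 8) · q · a · b · c))
    (const (+ 2) · a ^ˢ 2 · b +ₛ -ₛ (const (+ 24) · q · b ^ˢ 2 · c))
    (const (+ 4) · a · b ^ˢ 2 +ₛ -ₛ (const (+ 8) · q ^ˢ 2 · c ^ˢ 3))
    (const (+ 4) · q · a · c ^ˢ 2 +ₛ const (+ 8) · b ^ˢ 3)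
    (const (+ 24) · q · b · c ^ˢ 2 +ₛ -ₛ (const (+ 2) · a ^ˢ 2 · c))
  Eᶜ = comps
    (-ₛ (const (+ 6) · q ^ˢ 2 · b ^ˢ 2 · c ^ˢ 2))
    (-ₛ (q ^ˢ 3 · c ^ˢ 4))
    (const (+ 4) · q · b ^ˢ 3 · c)
    (const (+ 4) · q ^ˢ 2 · b · c ^ˢ 3)
    (-ₛ (b ^ˢ 4))

  private
    Wₑ Eₑ : ∀ {n} (q a b c : Expr ℤ n) → Fin 5 → Expr ℤ n
    Wₑ q a b c = comps
      (a :^ 3 :- con (+ 8) :* q :* a :* b :* c)
      (con (+ 2) :* a :^ 2 :* b :- con (+ 24) :* q :* b :^ 2 :* c)
      (con (+ 4) :* a :* b :^ 2 :- con (+ 8) :* q :^ 2 :* c :^ 3)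
      (con (+ 4) :* q :* a :* c :^ 2 :+ con (+ 8) :* b :^ 3)
      (con (+ 24) :* q :* b :* c :^ 2 :- con (+ 2) :* a :^ 2 :* c)
    Eₑ q a b c = comps
      (:- (con (+ 6) :* q :^ 2 :* b :^ 2 :* c :^ 2))
      (:- (q :^ 3 :* c :^ 4))
      (con (+ 4) :* q :* b :^ 3 :* c)
      (con (+ 4) :* q :^ 2 :* b :* c :^ 3)
      (:- (b :^ 4))

    scalarₑ : ∀ {n} → Expr ℤ n → Fin 5 → Expr ℤ n
    scalarₑ x = comps x (con 0ℤ) (con 0ℤ) (con 0ℤ) (con 0ℤ)

    a⁴+16Eₑ : ∀ {n} (q a b c : Expr ℤ n) → Fin 5 → Expr ℤ n
    a⁴+16Eₑ q a b c r = scalarₑ (a :^ 4) r :+ productₑ q (scalarₑ (con (+ 16))) (Eₑ q a b c) r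

  W : Series
  W = dissected Wᶜ

  Φ·W : Φ · W ≐ V 5 (a ^ˢ 4) +ₛ const (+ 16) · dissected Eᶜ
  Φ·W = begin
    Φ · W
      ≈⟨ dissected-product Φᶜ Wᶜ Φ-dissected (≐.refl {W}) ⟩
    dissected (product Φᶜ Wᶜ)
      ≈⟨ dissected-cong {product Φᶜ Wᶜ} {A} (λ
           { 0F → solve 4 (λ q a b c → productₑ q (Φₑ a b c) (Wₑ q a b c) 0F , a⁴+16Eₑ q a b c 0F) refl q a b c
           ; 1F → solve 4 (λ q a b c → productₑ q (Φₑ a b c) (Wₑ q a b c) 1F , a⁴+16Eₑ q a b c 1F) refl q a b c
           ; 2F → solve 4 (λ q a b c → productₑ q (Φₑ a b c) (Wₑ q a b c) 2F , a⁴+16Eₑ q a b c 2F) refl q a b c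
           ; 3F → solve 4 (λ q a b c → productₑ q (Φₑ a b c) (Wₑ q a b c) 3F , a⁴+16Eₑ q a b c 3F) refl q a b c
           ; 4F → solve 4 (λ q a b c → productₑ q (Φₑ a b c) (Wₑ q a b c) 4F , a⁴+16Eₑ q a b c 4F) refl q a b c
           }) ⟩
    dissected A
      ≈⟨ dissected-+ (comps (a ^ˢ 4) 0ₛ 0ₛ 0ₛ 0ₛ) (product (comps (const (+ 16)) 0ₛ 0ₛ 0ₛ 0ₛ) Eᶜ) ⟨
    dissected (comps (a ^ˢ 4) 0ₛ 0ₛ 0ₛ 0ₛ) +ₛ dissected (product (comps (const (+ 16)) 0ₛ 0ₛ 0ₛ 0ₛ) Eᶜ)
      ≈⟨ ≐.+-cong (V-dissected (a ^ˢ 4))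
           (dissected-product (comps (const (+ 16)) 0ₛ 0ₛ 0ₛ 0ₛ) Eᶜ
             (≐.trans (≐.sym (V-fromℤ (+ 16))) (V-dissected (const (+ 16)))) (≐.refl {dissected Eᶜ})) ⟨
    V 5 (a ^ˢ 4) +ₛ const (+ 16) · dissected Eᶜ ∎
    where
    open ≐-Reasoning
    A : Fin 5 → Series
    A r = comps (a ^ˢ 4) 0ₛ 0ₛ 0ₛ 0ₛ r +ₛ product (comps (const (+ 16)) 0ₛ 0ₛ 0ₛ 0ₛ) Eᶜ r

  open Congruence 16
  open ≈-Reasoning′

  -- In effect `1/Φ ≡ W / V 5 (a⁴)`: as `f₂ = FΦ`, the product `f₂ W` is `F` times `Φ W`, whose
  -- deviation from `V 5 (a⁴)` is a multiple of 16.
  Va⁴F : V 5 (a ^ˢ 4) · F ≈ f 2 · W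
  Va⁴F = ≈-sym (by (dissected Eᶜ · F) (≐.trans (≐.*-congʳ {W} (≐.sym FΦ)) (≐.trans
    (solve 3 (λ u p w → (u :* p) :* w , (p :* w) :* u) refl F Φ W) (≐.trans (≐.*-congʳ {F} Φ·W)
    (solve 3 (λ v e u → (v :+ con (+ 16) :* e) :* u , v :* u :+ con (+ 16) :* (e :* u)) refl (V 5 (a ^ˢ 4)) (dissected Eᶜ) F)))))

  -- Four factors `a` come from `Va⁴F`; the fifth is supplied because `relation₄` determines its
  -- bracket only after multiplication by `a`.
  U₂-F : U 5 2 F ≈ const (+ 3) · V 5 F
  U₂-F = cancel (a ^ˢ 5) (^-0 5 a-0) (begin
    a ^ˢ 5 · U 5 2 F             ≈⟨ exact (solve 2 (λ a x → a :^ 5 :* x , a :* (a :^ 4 :* x)) refl a (U 5 2 F)) ⟩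
    a · (a ^ˢ 4 · U 5 2 F)       ≈⟨ ≈-*-congˡ a (exact (U-V-* 2F (a ^ˢ 4) F)) ⟨
    a · U 5 2 (V 5 (a ^ˢ 4) · F) ≈⟨ ≈-*-congˡ a (≈-U-cong 5 2 Va⁴F) ⟩
    a · U 5 2 (f 2 · W)
      ≈⟨ ≈-*-congˡ a (exact (≐.trans (component (product f₂ᶜ Wᶜ) 2F (dissected-product f₂ᶜ Wᶜ f₂-dissected (≐.refl {W})))
           (solve 7 (λ q a b c a′ b′ c′ → productₑ q (f₂ₑ a′ b′ c′) (Wₑ q a b c) 2F ,
             con (+ 4) :* a :* (b :^ 2 :* a′ :- q :^ 2 :* c :^ 2 :* c′) :+ con (+ 8) :* a :* q :* b′ :* b :* c :- b′ :* a :^ 3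
               :- con (+ 8) :* q :* (q :* a′ :* c :^ 3 :+ c′ :* b :^ 3)) refl q a b c α′ β′ γ′))) ⟩
    a · (const (+ 4) · a · (b ^ˢ 2 · α′ +ₛ -ₛ (q ^ˢ 2 · c ^ˢ 2 · γ′)) +ₛ const (+ 8) · a · q · β′ · b · c +ₛ -ₛ (β′ · a ^ˢ 3)
         +ₛ -ₛ (const (+ 8) · q · (q · α′ · c ^ˢ 3 +ₛ γ′ · b ^ˢ 3)))
      -- `relation₁` gives `4a⁴β′ − a⁴β′`. The terms `8qa²bcβ′` cancel against `relation₄`, whose
      -- last summand leaves exactly `−16q²b²c²β′`.
      ≈⟨ by (-ₛ (q ^ˢ 2 · b ^ˢ 2 · c ^ˢ 2 · β′))
           (combine (vanish (const (+ 4) · a ^ˢ 2) relation₁ ⊞ vanish (-ₛ (const (+ 8) · q)) relation₄)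
             (solve 7 (λ Q A B C A′ B′ C′ →
               A :* (con (+ 4) :* A :* (B :^ 2 :* A′ :- Q :^ 2 :* C :^ 2 :* C′) :+ con (+ 8) :* A :* Q :* B′ :* B :* C :- B′ :* A :^ 3
                  :- con (+ 8) :* Q :* (Q :* A′ :* C :^ 3 :+ C′ :* B :^ 3))
                :- (con (+ 3) :* A :^ 4 :* B′ :+ con (+ 16) :* (:- (Q :^ 2 :* B :^ 2 :* C :^ 2 :* B′))) ,
               con (+ 4) :* A :^ 2 :* ((B :^ 2 :* A′ :- Q :^ 2 :* C :^ 2 :* C′) :- A :^ 2 :* B′)
                :+ (:- (con (+ 8) :* Q)) :* (A :* (Q :* A′ :* C :^ 3 :+ C′ :* B :^ 3) :- B′ :* B :* C :* (A :^ 2 :+ con (+ 2) :* Q :* B :* C)))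
               refl q a b c α′ β′ γ′)) ⟩
    const (+ 3) · a ^ˢ 4 · β′    ≈⟨ exact (≐.*-congˡ {const (+ 3) · a ^ˢ 4} β′≐) ⟩
    const (+ 3) · a ^ˢ 4 · (V 5 F · a)
      ≈⟨ exact (solve 2 (λ a x → con (+ 3) :* a :^ 4 :* (x :* a) , a :^ 5 :* (con (+ 3) :* x)) refl a (V 5 F)) ⟩
    a ^ˢ 5 · (const (+ 3) · V 5 F) ∎)
    where
    β′≐ : β′ ≐ V 5 F · a
    β′≐ = ≐.trans (coeffwise (V-cong {5} (λ n → sym (coeff FΦ n)))) (V-* F Φ)

𝓔𝓞ᵤ-even : ∀ m → 𝓔𝓞ᵤ (2 * m) ≡ F m
𝓔𝓞ᵤ-even m = trans (cong 𝓔𝓞ᵤ (ℕ.*-comm 2 m)) (trans (coeff 𝓔𝓞ᵤ-V (m * 2)) (V-∣ F m))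

-- Iteration

-- `(25^j − 1)/24`, described without division.
t : ℕ → ℕ
t zero    = 0
t (suc j) = 25 * t j + 1

5^2j : ∀ j → 5 ^ (2 * j) ≡ suc (24 * t j)
5^2j zero    = refl
5^2j (suc j) = begin
  5 ^ (2 * suc j)           ≡⟨ cong (5 ^_) (ℕ.*-suc 2 j) ⟩
  5 * (5 * 5 ^ (2 * j))     ≡⟨ cong (λ x → 5 * (5 * x)) (5^2j j) ⟩
  5 * (5 * suc (24 * t j))  ≡⟨ rearrange (t j) ⟩
  suc (24 * (25 * t j + 1)) ∎
  where
  open ≡-Reasoning
  rearrange : ∀ t → 5 * (5 * suc (24 * t)) ≡ suc (24 * (25 * t + 1))
  rearrange = ℕ-Solver.solve-∀

[5^2j∸1]/6 : ∀ j → (5 ^ (2 * j) ∸ 1) / 6 ≡ 4 * t j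
[5^2j∸1]/6 j = begin
  (5 ^ (2 * j) ∸ 1) / 6 ≡⟨ cong (λ x → (x ∸ 1) / 6) (5^2j j) ⟩
  24 * t j / 6          ≡⟨ cong (_/ 6) (rearrange (t j)) ⟩
  4 * t j * 6 / 6       ≡⟨ ℕ.m*n/n≡m (4 * t j) 6 ⟩
  4 * t j               ∎
  where
  open ≡-Reasoning
  rearrange : ∀ t → 24 * t ≡ 4 * t * 6
  rearrange = ℕ-Solver.solve-∀

5^odd : ∀ j → 5 ^ (2 * j + 1) ≡ 5 * suc (24 * t j)
5^odd j = trans (cong (5 ^_) (ℕ.+-comm (2 * j) 1)) (cong (5 *_) (5^2j j))

-- Iterates of `n ↦ 25n + 10`, written as the nested index of `U 5 2 (U 5 0 g)` so that `g-eigen`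
-- applies as it stands.
orbit : ℕ → ℕ → ℕ
orbit n zero    = n
orbit n (suc j) = (2 + orbit n j * 5) * 5

orbit-closed : ∀ n j → orbit n j ≡ suc (24 * t j) * n + 10 * t j
orbit-closed n zero    = rearrange n
  where
  rearrange : ∀ n → n ≡ suc 0 * n + 0
  rearrange = ℕ-Solver.solve-∀
orbit-closed n (suc j) = trans (cong (λ x → (2 + x * 5) * 5) (orbit-closed n j)) (rearrange n (t j))
  where
  rearrange : ∀ n t → (2 + (suc (24 * t) * n + 10 * t) * 5) * 5 ≡ suc (24 * (25 * t + 1)) * n + 10 * (25 * t + 1)
  rearrange = ℕ-Solver.solve-∀

g-orbit : ∀ n j → Mod5.g (orbit n j) ≡ (+ 3) ℤ.^ j ℤ.* Mod5.g n [mod 5 ]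
g-orbit n zero    = ℤ.∣⇒∣ᵤ {+ 5} (ℤ.divides 0ℤ (trans (cong (ℤ._-_ (Mod5.g n)) (ℤ.*-identityˡ (Mod5.g n))) (ℤ.+-inverseʳ (Mod5.g n))))
g-orbit n (suc j) = ℤ.∣⇒∣ᵤ {+ 5} (subst ((+ 5) ℤ.∣_)
  (rearrange (Mod5.g (orbit n (suc j))) (Mod5.g (orbit n j)) ((+ 3) ℤ.^ j) (Mod5.g n))
  (ℤ.∣m∣n⇒∣m+n step (ℤ.∣n⇒∣m*n (+ 3) (ℤ.∣ᵤ⇒∣ {+ 5} (g-orbit n j)))))
  where
  step : (+ 5) ℤ.∣ Mod5.g (orbit n (suc j)) ℤ.- + 3 ℤ.* Mod5.g (orbit n j)
  step = subst (λ x → (+ 5) ℤ.∣ Mod5.g (orbit n (suc j)) ℤ.- x) (const-· (+ 3) Mod5.g (orbit n j))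
    (ℤ.∣ᵤ⇒∣ {+ 5} (Congruence.coefficient 5 Mod5.g-eigen (orbit n j)))
  rearrange : ∀ x y z w → (x ℤ.- + 3 ℤ.* y) ℤ.+ + 3 ℤ.* (y ℤ.- z ℤ.* w) ≡ x ℤ.- + 3 ℤ.* z ℤ.* w
  rearrange = ℤ-Solver.solve-∀

index₅ : ∀ n k → 2 * 5 ^ (2 * k + 3) * n + (5 ^ (2 * k + 4) ∸ 1) / 6 ≡ 2 * (2 + orbit n (k + 1) * 5)
index₅ n k = begin
  2 * 5 ^ (2 * k + 3) * n + (5 ^ (2 * k + 4) ∸ 1) / 6
    ≡⟨ cong₂ (λ x y → 2 * 5 ^ x * n + (5 ^ y ∸ 1) / 6) (exponent₁ k) (exponent₂ k) ⟩
  2 * 5 ^ (2 * suc k + 1) * n + (5 ^ (2 * suc (suc k)) ∸ 1) / 6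
    ≡⟨ cong₂ (λ x y → 2 * x * n + y) (5^odd (suc k)) ([5^2j∸1]/6 (suc (suc k))) ⟩
  2 * (5 * suc (24 * t (suc k))) * n + 4 * (25 * t (suc k) + 1)
    ≡⟨ rearrange n (t (suc k)) ⟩
  2 * (2 + (suc (24 * t (suc k)) * n + 10 * t (suc k)) * 5)
    ≡⟨ cong (λ x → 2 * (2 + x * 5)) (trans (cong (orbit n) (ℕ.+-comm k 1)) (orbit-closed n (suc k))) ⟨
  2 * (2 + orbit n (k + 1) * 5) ∎
  where
  open ≡-Reasoning
  exponent₁ : ∀ k → 2 * k + 3 ≡ 2 * suc k + 1
  exponent₁ = ℕ-Solver.solve-∀
  exponent₂ : ∀ k → 2 * k + 4 ≡ 2 * suc (suc k)
  exponent₂ = ℕ-Solver.solve-∀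
  rearrange : ∀ n t → 2 * (5 * suc (24 * t)) * n + 4 * (25 * t + 1) ≡ 2 * (2 + (suc (24 * t) * n + 10 * t) * 5)
  rearrange = ℕ-Solver.solve-∀

-- The start is an index `2 + 5m` with `m ≡ r` modulo 5, where `V 5 F` vanishes for `1 ≤ r ≤ 4`.
-- Each further step `m ↦ 25m + 2` applies `U₂-F` at `5m`, where `V 5 F` takes the value `F m`.
orbit₁₆ : ℕ → ℕ → ℕ → ℕ
orbit₁₆ n r zero    = 2 + (r + n * 5) * 5
orbit₁₆ n r (suc k) = 2 + orbit₁₆ n r k * 5 * 5

orbit₁₆-closed : ∀ n r k → orbit₁₆ n r k ≡ 25 * suc (24 * t k) * n + 5 * suc (24 * t k) * r + 2 * t (suc k)
orbit₁₆-closed n r zero    = rearrange n r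
  where
  rearrange : ∀ n r → 2 + (r + n * 5) * 5 ≡ 25 * 1 * n + 5 * 1 * r + 2
  rearrange = ℕ-Solver.solve-∀
orbit₁₆-closed n r (suc k) = trans (cong (λ x → 2 + x * 5 * 5) (orbit₁₆-closed n r k)) (rearrange n r (t k))
  where
  rearrange : ∀ n r t → 2 + (25 * suc (24 * t) * n + 5 * suc (24 * t) * r + 2 * (25 * t + 1)) * 5 * 5
              ≡ 25 * suc (24 * (25 * t + 1)) * n + 5 * suc (24 * (25 * t + 1)) * r + 2 * (25 * (25 * t + 1) + 1)
  rearrange = ℕ-Solver.solve-∀

F-step : ∀ m → (+ 16) ℤ.∣ F (2 + m * 5) ℤ.- + 3 ℤ.* V 5 F m
F-step m = subst (λ x → (+ 16) ℤ.∣ F (2 + m * 5) ℤ.- x) (const-· (+ 3) (V 5 F) m)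
  (ℤ.∣ᵤ⇒∣ {+ 16} (Congruence.coefficient 16 Mod16.U₂-F m))

F-orbit : ∀ n {r} k → 1 ≤ r → r ≤ 4 → (+ 16) ℤ.∣ F (orbit₁₆ n r k)
F-orbit n {r} zero 1≤r r≤4 = subst ((+ 16) ℤ.∣_)
  (trans (cong (λ x → F (orbit₁₆ n r 0) ℤ.- + 3 ℤ.* x) (U-V F 1≤r (ℕ.s≤s r≤4) n)) (ℤ.+-identityʳ _))
  (F-step (r + n * 5))
F-orbit n {r} (suc k) 1≤r r≤4 = subst ((+ 16) ℤ.∣_)
  (trans (cong (λ x → (F (orbit₁₆ n r (suc k)) ℤ.- + 3 ℤ.* x) ℤ.+ + 3 ℤ.* F (orbit₁₆ n r k)) (V-∣ F (orbit₁₆ n r k)))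
         (rearrange (F (orbit₁₆ n r (suc k))) (F (orbit₁₆ n r k))))
  (ℤ.∣m∣n⇒∣m+n (F-step (orbit₁₆ n r k * 5)) (ℤ.∣n⇒∣m*n (+ 3) (F-orbit n k 1≤r r≤4)))
  where
  rearrange : ∀ x y → (x ℤ.- + 3 ℤ.* y) ℤ.+ + 3 ℤ.* y ≡ x
  rearrange = ℤ-Solver.solve-∀

index₁₆ : ∀ n k r → 2 * 5 ^ (2 * k + 2) * n + 2 * 5 ^ (2 * k + 1) * r + (5 ^ (2 * k + 2) ∸ 1) / 6 ≡ 2 * orbit₁₆ n r k
index₁₆ n k r = begin
  2 * 5 ^ (2 * k + 2) * n + 2 * 5 ^ (2 * k + 1) * r + (5 ^ (2 * k + 2) ∸ 1) / 6
    ≡⟨ cong (λ x → 2 * 5 ^ x * n + 2 * 5 ^ (2 * k + 1) * r + (5 ^ x ∸ 1) / 6) (exponent k) ⟩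
  2 * 5 ^ (2 * suc k) * n + 2 * 5 ^ (2 * k + 1) * r + (5 ^ (2 * suc k) ∸ 1) / 6
    ≡⟨ cong₂ _+_ (cong₂ (λ x y → 2 * x * n + 2 * y * r) (5^2j (suc k)) (5^odd k)) ([5^2j∸1]/6 (suc k)) ⟩
  2 * suc (24 * (25 * t k + 1)) * n + 2 * (5 * suc (24 * t k)) * r + 4 * (25 * t k + 1)
    ≡⟨ rearrange n r (t k) ⟩
  2 * (25 * suc (24 * t k) * n + 5 * suc (24 * t k) * r + 2 * (25 * t k + 1))
    ≡⟨ cong (2 *_) (orbit₁₆-closed n r k) ⟨
  2 * orbit₁₆ n r k ∎
  where
  open ≡-Reasoning
  exponent : ∀ k → 2 * k + 2 ≡ 2 * suc k
  exponent = ℕ-Solver.solve-∀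
  rearrange : ∀ n r t → 2 * suc (24 * (25 * t + 1)) * n + 2 * (5 * suc (24 * t)) * r + 4 * (25 * t + 1)
              ≡ 2 * (25 * suc (24 * t) * n + 5 * suc (24 * t) * r + 2 * (25 * t + 1))
  rearrange = ℕ-Solver.solve-∀

corollary3p1 : (n k : ℕ) →
    (𝓔𝓞ᵤ (2 * 5 ^ (2 * k + 3) * n + (5 ^ (2 * k + 4) ∸ 1) / 6)
    ≡ (+ 3) ℤ.^ (k + 1) ℤ.* 𝓔𝓞ᵤ (10 * n + 4) [mod 5 ])
    × ((r : ℕ) → 1 ≤ r → r ≤ 4 →
    𝓔𝓞ᵤ (2 * 5 ^ (2 * k + 2) * n + 2 * 5 ^ (2 * k + 1) * r + (5 ^ (2 * k + 2) ∸ 1) / 6)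
    ≡ 0ℤ [mod 16 ])
corollary3p1 n k = modulo5 , modulo16
  where
  modulo5 : 𝓔𝓞ᵤ (2 * 5 ^ (2 * k + 3) * n + (5 ^ (2 * k + 4) ∸ 1) / 6)
            ≡ (+ 3) ℤ.^ (k + 1) ℤ.* 𝓔𝓞ᵤ (10 * n + 4) [mod 5 ]
  modulo5 = subst (λ { (x , y) → x ≡ (+ 3) ℤ.^ (k + 1) ℤ.* y [mod 5 ] })
    (cong₂ _,_ (sym (trans (cong 𝓔𝓞ᵤ (index₅ n k)) (𝓔𝓞ᵤ-even (2 + orbit n (k + 1) * 5))))
               (sym (trans (cong 𝓔𝓞ᵤ (rearrange n)) (𝓔𝓞ᵤ-even (2 + n * 5)))))
    (g-orbit n (k + 1))
    where
    rearrange : ∀ n → 10 * n + 4 ≡ 2 * (2 + n * 5)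
    rearrange = ℕ-Solver.solve-∀
  modulo16 : (r : ℕ) → 1 ≤ r → r ≤ 4 →
    𝓔𝓞ᵤ (2 * 5 ^ (2 * k + 2) * n + 2 * 5 ^ (2 * k + 1) * r + (5 ^ (2 * k + 2) ∸ 1) / 6) ≡ 0ℤ [mod 16 ]
  modulo16 r 1≤r r≤4 = ℤ.∣⇒∣ᵤ {+ 16} (subst ((+ 16) ℤ.∣_)
    (sym (trans (ℤ.+-identityʳ _) (trans (cong 𝓔𝓞ᵤ (index₁₆ n k r)) (𝓔𝓞ᵤ-even (orbit₁₆ n r k)))))
    (F-orbit n k 1≤r r≤4))
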